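{- With $Q:=q^{19}$, the following hold: $$4U(1,19,q)U(1,19,q^4)=3\kappa(q)^2\kappa(Q)^2+\kappa(-q)^2\kappa(-Q)^2+4q^5\frac{1}{\kappa(-q^2)^2\kappa(-Q^2)^2},$$ $$4qU(1,19,q)U(1,19,-q)=\kappa(q)^2\kappa(Q)^2-\kappa(-q)^2\kappa(-Q)^2+12q^5\frac{1}{\kappa(-q^2)^2\kappa(-Q^2)^2}.$$
   Context: Let $|q|<1$, $(a;q)_\infty=\prod_{k\ge0}(1-aq^k)$, $(a;q)_n=\prod_{k=0}^{n-1}(1-aq^k)$. $G(q)=\sum_{n\ge0}\frac{q^{n^2}}{(q;q)_n}$, $H(q)=\sum_{n\ge0}\frac{q^{n(n+1)}}{(q;q)_n}$. For positive integers $r,s$ with $s+r\equiv0\pmod 5$, $U(r,s,q)=G(q^r)G(q^s)+q^{(s+r)/5}H(q^r)H(q^s)$; $U(r,s,x)$ denotes this expression with $q$ replaced by $x$ (so $U(1,19,x)=G(x)G(x^{19})+x^4H(x)H(x^{19})$). $\kappa(q)=(-q;q^2)_\infty$. -}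

module Defs where

-- Formal power series in q with integer coefficients, represented by their
-- coefficient sequences.  All identities of the paper are identities of
-- analytic functions on |q| < 1 given by convergent q-series; such an identity
-- is equivalent to equality of all Taylor coefficients at q = 0.

open import Data.Nat as ℕ using (ℕ; zero; suc; _≤?_; _≟_; NonZero)
open import Data.Nat.DivMod using (_/_; _%_)
open import Data.Integer as ℤ using (ℤ; +_; -_)
open import Relation.Nullary using (yes; no)
open import Relation.Binary.PropositionalEquality using (_≡_)

Series : Set
Series = ℕ → ℤ

_≐_ : Series → Series → Set
f ≐ g = ∀ n → f n ≡ g n
infix 4 _≐_

sumTo : ℕ → (ℕ → ℤ) → ℤ
sumTo zero f = f 0
sumTo (suc n) f = sumTo n f ℤ.+ f (suc n)

const : ℤ → Series
const c zero = c
const c (suc n) = + 0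

one : Series
one = const (+ 1)

mono : ℕ → Series
mono e n with n ≟ e
... | yes _ = + 1
... | no _ = + 0

_⊕_ : Series → Series → Series
(f ⊕ g) n = f n ℤ.+ g n

_⊖_ : Series → Series → Series
(f ⊖ g) n = f n ℤ.- g n

_⊛_ : Series → Series → Series
(f ⊛ g) n = sumTo n (λ i → f i ℤ.* g (n ℕ.∸ i))

infixl 6 _⊕_ _⊖_
infixl 7 _⊛_

_·_ : ℤ → Series → Series
(c · f) n = c ℤ.* f n
infixr 8 _·_

shift : ℕ → Series → Series
shift k f n with k ≤? n
... | yes _ = f (n ℕ.∸ k)
... | no _ = + 0

dil : (k : ℕ) → .{{NonZero k}} → Series → Series
dil k f n with n % k ≟ 0
... | yes _ = f (n / k)
... | no _ = + 0

alt : Series → Series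
alt f n = (ℤ.-1ℤ ℤ.^ n) ℤ.* f n

prodTo : ℕ → (ℕ → Series) → Series
prodTo zero F = one
prodTo (suc N) F = prodTo N F ⊛ F N

-- Multiplicative inverse of a series with constant term 1:
-- b 0 = 1,  b (m+1) = - Σ_{j=0}^{m} a (m+1-j) * b j.
-- invPre a n j gives b j for j ≤ n.
invPre : Series → ℕ → ℕ → ℤ
invPre a zero j = + 1
invPre a (suc n) j with j ≤? n
... | yes _ = invPre a n j
... | no _ = - sumTo n (λ i → a (suc n ℕ.∸ i) ℤ.* invPre a n i)

inv : Series → Series
inv a n = invPre a n n

qpoch : ℕ → Series
qpoch n = prodTo n (λ j → one ⊖ mono (suc j))

-- G(q) = Σ_{n≥0} q^{n²}/(q;q)_n ; only n ≤ m contribute to the q^m coefficient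
G : Series
G m = sumTo m (λ n → shift (n ℕ.* n) (inv (qpoch n)) m)

H : Series
H m = sumTo m (λ n → shift (n ℕ.* n ℕ.+ n) (inv (qpoch n)) m)

-- κ(q) = (-q;q²)_∞ = ∏_{k≥0} (1 + q^{2k+1}); factors with k > m do not
-- affect the q^m coefficient
κ : Series
κ m = prodTo (suc m) (λ k → one ⊕ mono (suc (2 ℕ.* k))) m

U1-19 : Series
U1-19 = G ⊛ dil 19 G ⊕ shift 4 (H ⊛ dil 19 H)

κκ : Series
κκ = κ ⊛ κ ⊛ dil 19 κ ⊛ dil 19 κ

κκ⁻ : Series
κκ⁻ = alt κ ⊛ alt κ ⊛ dil 19 (alt κ) ⊛ dil 19 (alt κ)

κm2 : Series
κm2 = dil 2 (alt κ)

κκ2 : Series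
κκ2 = κm2 ⊛ κm2 ⊛ dil 19 κm2 ⊛ dil 19 κm2

{-# OPTIONS --safe #-}
-- Multiply both identities by (q²;q²)_∞ (Q²;Q²)_∞.  By the Rogers–Ramanujan identities and the Jacobi triple product,
-- the eight products G(q)G(q⁴), H(q)H(q⁴), G(q)H(q⁴), H(q)G(q⁴), G(q)G(-q), H(q)H(-q), G(q)H(-q), H(q)G(-q), each times
-- (q²;q²)_∞, are theta functions or half sums and half differences of two theta functions; e.g. the first two are
-- (φ(q) ± φ(q⁵))/2, where the sum is found by Rogers' method and the difference by extracting a square root.  Both sides
-- thereby become binary theta series, and the identities reduce to evaluating Σ q^{4x²+2xy+5y²} over ℤ² and
-- Σ q^{n²+nk+5k²} over odd n in two ways, by splitting the lattice into cosets modulo 5 and modulo 4.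
module Submission where

open import Defs
open import Data.Integer using (+_)
open import Data.Product using (_×_)
open import Algebra using (CommutativeRing)
import Algebra.Solver.CommutativeMonoid
import Algebra.Solver.Ring
open import Algebra.Solver.Ring.AlmostCommutativeRing using (AlmostCommutativeRing; fromCommutativeRing; _-Raw-AlmostCommutative⟶_)
open import Data.Empty using (⊥; ⊥-elim)
open import Data.Fin as Fin using (Fin; toℕ)
import Data.Fin.Properties as Finₚ
open import Data.Integer as ℤ using (ℤ; -[1+_]; -1ℤ; _+_; _*_; _-_; -_; _^_; ∣_∣)
import Data.Integer.DivMod as ZDM
import Data.Integer.Properties as ℤₚ
import Data.Integer.Solver
open import Data.List using (List; []; _∷_; _++_; map; filter; cartesianProduct; downFrom; applyUpTo)
open import Data.List.Membership.Propositional using (_∈_)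
open import Data.List.Membership.Propositional.Properties using (∈-map⁺; ∈-map⁻; ∈-++⁺ˡ; ∈-++⁺ʳ; ∈-cartesianProduct⁺; ∈-filter⁺; ∈-filter⁻; ∈-downFrom⁺; ∈-applyUpTo⁺)
open import Data.List.Membership.Propositional.Properties.WithK using (unique∧set⇒bag)
open import Data.List.Relation.Binary.BagAndSetEquality using (∼bag⇒↭)
open import Data.List.Relation.Binary.Permutation.Propositional as Perm using (_↭_)
open import Data.List.Relation.Unary.AllPairs using ([])
open import Data.List.Relation.Unary.Unique.Propositional using (Unique)
import Data.List.Relation.Unary.Unique.Propositional.Properties as Uniqueₚ
open import Data.Maybe using (Maybe; just; nothing)
open import Data.Nat as ℕ using (ℕ; zero; suc; NonZero; z≤n; s≤s)
import Data.Nat.DivMod as DM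
import Data.Nat.Properties as ℕₚ
import Data.Nat.Solver
open import Data.Product using (_,_; proj₁; proj₂; ∃)
open import Data.Sum using (_⊎_; inj₁; inj₂; map₂)
open import Data.Unit using (tt)
open import Function.Bundles using (mk⇔)
open import Relation.Binary.PropositionalEquality using (_≡_; _≢_; refl; sym; trans; cong; cong₂; subst; module ≡-Reasoning)
open import Relation.Nullary using (yes; no; Dec; ¬?)

module ZS = Data.Integer.Solver.+-*-Solver
module NS = Data.Nat.Solver.+-*-Solver
open ZS using () renaming (_:+_ to _+ᶻ_; _:*_ to _*ᶻ_; _:-_ to _-ᶻ_; :-_ to -ᶻ_; _:=_ to _=ᶻ_)
open NS using () renaming (_:+_ to _+ⁿ_; _:*_ to _*ⁿ_; _:=_ to _=ⁿ_; con to #ⁿ)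

-- One multiplier serves every term: (q²;q²)_∞ κ(q)² = φ(q) and (q²;q²)_∞ / κ(-q²)² = ψ(q²), and it
-- also makes H(q)G(q⁴) and its companions theta functions. The obstacle is that G(q)G(q⁴) and
-- qH(q)H(q⁴) are not single theta functions. Their product is known, being that of H(q)G(q⁴) and
-- G(q)H(q⁴) up to a factor q; so their sum determines the square of their difference. What is
-- wanted is (value at q)(value at Q) added over both, and that is half of the same expression
-- formed from their sum and their difference. The number 19 enters by completing squares:
-- 5(4x²+2xy+5y²) = 19x² + (x+5y)² and 4(4x²+2xy+5y²) = 19y² + (4x+y)²; likewise 20(n²+nk+5k²) =
-- 19n² + (n+10k)² and 4(n²+nk+5k²) = 19k² + (2n+k)². On each coset the two squares become
-- independent, so it contributes a theta function in Q times one in q. Limits are taken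
-- coefficientwise: equality up to degree n, for every n, replaces convergence.

#ᶻ : ∀ {n} → ℕ → ZS.Polynomial n
#ᶻ k = ZS.con (+ k)

-- The ring of formal power series

infix 4 _≈_
infixr 9 ⊝_

-- The record wrapper lets unification recover both sides of an equation from its type.
record _≈_ (f g : Series) : Set where
  constructor mk≈
  field at : f ≐ g
open _≈_

tail : Series → Series
tail f n = f (suc n)

𝟘 : Series
𝟘 _ = + 0

⊝_ : Series → Series
(⊝ f) n = - f n

sumTo-cong≤ : ∀ n {f g} → (∀ i → i ℕ.≤ n → f i ≡ g i) → sumTo n f ≡ sumTo n g
sumTo-cong≤ zero p = p 0 z≤n
sumTo-cong≤ (suc n) p = cong₂ _+_ (sumTo-cong≤ n λ i i≤n → p i (ℕₚ.m≤n⇒m≤1+n i≤n)) (p (suc n) ℕₚ.≤-refl)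

sumTo-cong : ∀ n {f g} → (∀ i → f i ≡ g i) → sumTo n f ≡ sumTo n g
sumTo-cong n p = sumTo-cong≤ n (λ i _ → p i)

sumTo-0 : ∀ n → sumTo n (λ _ → + 0) ≡ + 0
sumTo-0 zero = refl
sumTo-0 (suc n) = cong (_+ + 0) (sumTo-0 n)

sumTo-+ : ∀ n f g → sumTo n (λ i → f i + g i) ≡ sumTo n f + sumTo n g
sumTo-+ zero f g = refl
sumTo-+ (suc n) f g = trans (cong (λ x → x + (f (suc n) + g (suc n))) (sumTo-+ n f g))
  (ZS.solve 4 (λ a b c d → (a +ᶻ b) +ᶻ (c +ᶻ d) =ᶻ (a +ᶻ c) +ᶻ (b +ᶻ d)) refl (sumTo n f) (sumTo n g) (f (suc n)) (g (suc n)))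

sumTo-* : ∀ n c f → sumTo n (λ i → c * f i) ≡ c * sumTo n f
sumTo-* zero c f = refl
sumTo-* (suc n) c f = trans (cong (λ x → x + c * f (suc n)) (sumTo-* n c f)) (sym (ℤₚ.*-distribˡ-+ c _ _))

sumTo-head : ∀ n f → sumTo (suc n) f ≡ f 0 + sumTo n (λ i → f (suc i))
sumTo-head zero f = refl
sumTo-head (suc n) f = trans (cong (_+ f (suc (suc n))) (sumTo-head n f)) (ℤₚ.+-assoc (f 0) _ _)

-- Writing f = f 0 + q · `tail f` turns the Cauchy product into a recursion on the degree in which
-- the factors vary; commutativity, associativity and cancellation are inductions along it.
⊛-sucˡ : ∀ f g n → (f ⊛ g) (suc n) ≡ f 0 * g (suc n) + (tail f ⊛ g) n
⊛-sucˡ f g n = sumTo-head n _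

⊛-sucʳ : ∀ f g n → (f ⊛ g) (suc n) ≡ (f ⊛ tail g) n + f (suc n) * g 0
⊛-sucʳ f g n = cong₂ _+_
  (sumTo-cong≤ n λ i i≤n → cong (λ k → f i * g k) (ℕₚ.+-∸-assoc 1 i≤n))
  (cong (λ k → f (suc n) * g k) (ℕₚ.n∸n≡0 n))

⊛-cong≤ : ∀ n {f f′ g g′} → (∀ i → i ℕ.≤ n → f i ≡ f′ i) → (∀ i → i ℕ.≤ n → g i ≡ g′ i) → (f ⊛ g) n ≡ (f′ ⊛ g′) n
⊛-cong≤ n p q = sumTo-cong≤ n λ i i≤n → cong₂ _*_ (p i i≤n) (q (n ℕ.∸ i) (ℕₚ.m∸n≤m n i))

⊛-comm : ∀ f g n → (f ⊛ g) n ≡ (g ⊛ f) n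
⊛-comm f g zero = ℤₚ.*-comm (f 0) (g 0)
⊛-comm f g (suc n) = trans (⊛-sucˡ f g n)
  (trans (ℤₚ.+-comm _ ((tail f ⊛ g) n))
  (trans (cong₂ _+_ (⊛-comm (tail f) g n) (ℤₚ.*-comm (f 0) _)) (sym (⊛-sucʳ g f n))))

⊛-distribʳ : ∀ h f g n → ((f ⊕ g) ⊛ h) n ≡ (f ⊛ h ⊕ g ⊛ h) n
⊛-distribʳ h f g n = trans (sumTo-cong n λ i → ℤₚ.*-distribʳ-+ (h (n ℕ.∸ i)) (f i) (g i)) (sumTo-+ n _ _)

·-⊛ : ∀ c f g n → ((c · f) ⊛ g) n ≡ (c · (f ⊛ g)) n
·-⊛ c f g n = trans (sumTo-cong n λ i → ℤₚ.*-assoc c (f i) _) (sumTo-* n c _)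

⊛-assoc : ∀ f g h n → ((f ⊛ g) ⊛ h) n ≡ (f ⊛ (g ⊛ h)) n
⊛-assoc f g h zero = ℤₚ.*-assoc (f 0) (g 0) (h 0)
⊛-assoc f g h (suc n) = begin
  ((f ⊛ g) ⊛ h) (suc n)
    ≡⟨ ⊛-sucˡ (f ⊛ g) h n ⟩
  f 0 * g 0 * h (suc n) + (tail (f ⊛ g) ⊛ h) n
    ≡⟨ cong (λ x → f 0 * g 0 * h (suc n) + x) step ⟩
  f 0 * g 0 * h (suc n) + (f 0 * (tail g ⊛ h) n + (tail f ⊛ (g ⊛ h)) n)
    ≡⟨ ZS.solve 5 (λ a b c d e → a *ᶻ b *ᶻ c +ᶻ (a *ᶻ d +ᶻ e) =ᶻ a *ᶻ (b *ᶻ c +ᶻ d) +ᶻ e) refl (f 0) (g 0) (h (suc n)) ((tail g ⊛ h) n) _ ⟩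
  f 0 * (g 0 * h (suc n) + (tail g ⊛ h) n) + (tail f ⊛ (g ⊛ h)) n
    ≡⟨ cong (λ x → f 0 * x + (tail f ⊛ (g ⊛ h)) n) (sym (⊛-sucˡ g h n)) ⟩
  f 0 * (g ⊛ h) (suc n) + (tail f ⊛ (g ⊛ h)) n
    ≡⟨ sym (⊛-sucˡ f (g ⊛ h) n) ⟩
  (f ⊛ (g ⊛ h)) (suc n) ∎
  where
  open ≡-Reasoning
  step : (tail (f ⊛ g) ⊛ h) n ≡ f 0 * (tail g ⊛ h) n + (tail f ⊛ (g ⊛ h)) n
  step = trans (⊛-cong≤ n {g = h} (λ i _ → ⊛-sucˡ f g i) (λ _ _ → refl))
    (trans (⊛-distribʳ h (f 0 · tail g) (tail f ⊛ g) n)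
    (cong₂ _+_ (·-⊛ (f 0) (tail g) h n) (⊛-assoc (tail f) g h n)))

𝟘-⊛ : ∀ f n → (𝟘 ⊛ f) n ≡ + 0
𝟘-⊛ f n = sumTo-0 n

const-⊛ : ∀ c f n → (const c ⊛ f) n ≡ c * f n
const-⊛ c f zero = refl
const-⊛ c f (suc n) = trans (⊛-sucˡ (const c) f n) (trans (cong (λ x → c * f (suc n) + x) (𝟘-⊛ f n)) (ℤₚ.+-identityʳ _))

seriesRing : CommutativeRing _ _
seriesRing = record
  { Carrier = Series ; _≈_ = _≈_ ; _+_ = _⊕_ ; _*_ = _⊛_ ; -_ = ⊝_ ; 0# = 𝟘 ; 1# = one
  ; isCommutativeRing = record
    { isRing = record
      { +-isAbelianGroup = record
        { isGroup = record
          { isMonoid = record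
            { isSemigroup = record
              { isMagma = record
                { isEquivalence = record
                  { refl = mk≈ λ _ → refl
                  ; sym = λ p → mk≈ λ n → sym (at p n)
                  ; trans = λ p q → mk≈ λ n → trans (at p n) (at q n) }
                ; ∙-cong = λ p q → mk≈ λ n → cong₂ _+_ (at p n) (at q n) }
              ; assoc = λ f g h → mk≈ λ n → ℤₚ.+-assoc (f n) (g n) (h n) }
            ; identity = (λ f → mk≈ λ n → ℤₚ.+-identityˡ (f n)) , (λ f → mk≈ λ n → ℤₚ.+-identityʳ (f n)) }
          ; inverse = (λ f → mk≈ λ n → ℤₚ.+-inverseˡ (f n)) , (λ f → mk≈ λ n → ℤₚ.+-inverseʳ (f n))
          ; ⁻¹-cong = λ p → mk≈ λ n → cong -_ (at p n) }
        ; comm = λ f g → mk≈ λ n → ℤₚ.+-comm (f n) (g n) }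
      ; *-cong = λ p q → mk≈ λ n → ⊛-cong≤ n (λ i _ → at p i) (λ i _ → at q i)
      ; *-assoc = λ f g h → mk≈ (⊛-assoc f g h)
      ; *-identity = (λ f → mk≈ (1⊛ f)) , (λ f → mk≈ λ n → trans (⊛-comm f one n) (1⊛ f n))
      ; distrib = (λ h f g → mk≈ λ n → trans (⊛-comm h (f ⊕ g) n) (trans (⊛-distribʳ h f g n)
                      (cong₂ _+_ (⊛-comm f h n) (⊛-comm g h n))))
                , (λ h f g → mk≈ (⊛-distribʳ h f g)) }
    ; *-comm = λ f g → mk≈ (⊛-comm f g) } }
  where
  1⊛ : ∀ f n → (one ⊛ f) n ≡ f n
  1⊛ f n = trans (const-⊛ (+ 1) f n) (ℤₚ.*-identityˡ (f n))

module R = CommutativeRing seriesRing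
open R using () renaming (refl to ≈-refl; sym to ≈-sym; trans to ≈-trans; +-cong to ⊕-cong; *-cong to ⊛-cong; -‿cong to ⊝-cong)
open import Relation.Binary.Reasoning.Setoid R.setoid

seriesACR : AlmostCommutativeRing _ _
seriesACR = fromCommutativeRing seriesRing

-- Taking ℤ as coefficient ring lets the ring solver evaluate the numerals 2, 3, 4, 8 and 12 that
-- occur in the identities.
constMorphism : CommutativeRing.rawRing ℤₚ.+-*-commutativeRing -Raw-AlmostCommutative⟶ seriesACR
constMorphism = record
  { ⟦_⟧ = const
  ; +-homo = λ a b → mk≈ λ { zero → refl ; (suc n) → refl }
  ; *-homo = λ a b → mk≈ λ n → sym (trans (const-⊛ a (const b) n) (lem a b n))
  ; -‿homo = λ a → mk≈ λ { zero → refl ; (suc n) → refl }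
  ; 0-homo = mk≈ λ { zero → refl ; (suc n) → refl }
  ; 1-homo = ≈-refl }
  where
  lem : ∀ a b n → a * const b n ≡ const (a * b) n
  lem a b zero = refl
  lem a b (suc n) = ℤₚ.*-zeroʳ a

const≟ : (a b : ℤ) → Maybe (const a ≈ const b)
const≟ a b with a ℤₚ.≟ b
... | yes refl = just ≈-refl
... | no _ = nothing

module SS = Algebra.Solver.Ring (CommutativeRing.rawRing ℤₚ.+-*-commutativeRing) seriesACR constMorphism const≟
open SS using (_:+_; _:*_; _:-_; :-_; _:=_; con; solve)


module CM = Algebra.Solver.CommutativeMonoid R.*-commutativeMonoid
open CM using (_⊜_) renaming (_⊕_ to infixl 7 _∙_; solve to solve∙)

⊛-congˡ : ∀ h {f g} → f ≈ g → h ⊛ f ≈ h ⊛ g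
⊛-congˡ h p = ⊛-cong {h} {h} ≈-refl p

⊛-congʳ : ∀ h {f g} → f ≈ g → f ⊛ h ≈ g ⊛ h
⊛-congʳ h p = ⊛-cong {u = h} {v = h} p ≈-refl

⊕-congˡ : ∀ h {f g} → f ≈ g → h ⊕ f ≈ h ⊕ g
⊕-congˡ h p = ⊕-cong {h} {h} ≈-refl p

⊕-congʳ : ∀ h {f g} → f ≈ g → f ⊕ h ≈ g ⊕ h
⊕-congʳ h p = ⊕-cong {u = h} {v = h} p ≈-refl

-- Monomials, dilations, inverses

Agree : ℕ → Series → Series → Set
Agree n f g = ∀ m → m ℕ.≤ n → f m ≡ g m

·-cong : ∀ c {f g} → f ≈ g → c · f ≈ c · g
·-cong c p = mk≈ λ n → cong (c *_) (at p n)

·≈const : ∀ c f → c · f ≈ const c ⊛ f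
·≈const c f = mk≈ λ n → sym (const-⊛ c f n)

mono-off : ∀ {e n} → n ≢ e → mono e n ≡ + 0
mono-off {e} {n} n≢e with n ℕ.≟ e
... | yes p = ⊥-elim (n≢e p)
... | no _ = refl

mono-suc : ∀ e n → mono (suc e) (suc n) ≡ mono e n
mono-suc e n with suc n ℕ.≟ suc e | n ℕ.≟ e
... | yes _ | yes _ = refl
... | yes p | no q = ⊥-elim (q (ℕₚ.suc-injective p))
... | no p | yes q = ⊥-elim (p (cong suc q))
... | no _ | no _ = refl

mono-0 : mono 0 ≈ one
mono-0 = mk≈ λ { zero → refl ; (suc n) → refl }

mono-⊛ : ∀ a b → mono a ⊛ mono b ≈ mono (a ℕ.+ b)
mono-⊛ zero b = ≈-trans (⊛-congʳ (mono b) mono-0) (R.*-identityˡ (mono b))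
mono-⊛ (suc a) b = mk≈ λ where
  zero → refl
  (suc n) → trans (⊛-sucˡ (mono (suc a)) (mono b) n) (trans (ℤₚ.+-identityˡ _)
    (trans (⊛-cong≤ n {g = mono b} (λ i _ → mono-suc a i) (λ _ _ → refl))
    (trans (at (mono-⊛ a b) n) (sym (mono-suc (a ℕ.+ b) n)))))

-- `local` is continuity in the q-adic topology. Shifts, dilations, q ↦ -q and multiplication by a
-- fixed series are all of this kind.
record CLinear (Φ : Series → Series) : Set where
  field
    scale : ∀ c f → Φ (c · f) ≈ c · Φ f
    add   : ∀ f g → Φ (f ⊕ g) ≈ Φ f ⊕ Φ g
    local : ∀ n {f g} → Agree n f g → Agree n (Φ f) (Φ g)

  ≈-cong : ∀ {f g} → f ≈ g → Φ f ≈ Φ g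
  ≈-cong p = mk≈ λ n → local n (λ m _ → at p m) n ℕₚ.≤-refl

  Φ-𝟘 : Φ 𝟘 ≈ 𝟘
  Φ-𝟘 = ≈-trans (≈-cong (mk≈ λ _ → refl)) (≈-trans (scale (+ 0) 𝟘) (mk≈ λ _ → refl))

module CL = CLinear

psum : ℕ → Series → Series
psum zero f = f 0 · mono 0
psum (suc n) f = psum n f ⊕ f (suc n) · mono (suc n)

psum-above : ∀ n f m → n ℕ.< m → psum n f m ≡ + 0
psum-above zero f m 0<m = trans (cong (f 0 *_) (mono-off (ℕₚ.>⇒≢ 0<m))) (ℤₚ.*-zeroʳ (f 0))
psum-above (suc n) f m n<m = cong₂ _+_ (psum-above n f m (ℕₚ.<-trans (ℕₚ.n<1+n n) n<m))
  (trans (cong (f (suc n) *_) (mono-off (ℕₚ.>⇒≢ n<m))) (ℤₚ.*-zeroʳ (f (suc n))))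

psum-agree : ∀ n f → Agree n (psum n f) f
psum-agree zero f .zero z≤n = ℤₚ.*-identityʳ (f 0)
psum-agree (suc n) f m m≤ with m ℕ.≟ suc n
... | yes refl = trans (cong₂ _+_ (psum-above n f (suc n) ℕₚ.≤-refl) (ℤₚ.*-identityʳ (f (suc n))))
        (ℤₚ.+-identityˡ (f (suc n)))
... | no p = trans (cong₂ _+_ (psum-agree n f m (ℕₚ.≤-pred (ℕₚ.≤∧≢⇒< m≤ p))) (ℤₚ.*-zeroʳ (f (suc n))))
        (ℤₚ.+-identityʳ (f m))

-- Polynomials are q-adically dense: up to degree n, f may be replaced by `psum n f`, a finite
-- combination of monomials, on which Φ and Ψ agree by linearity.
clinear-ext : ∀ {Φ Ψ} → CLinear Φ → CLinear Ψ → (∀ e → Φ (mono e) ≈ Ψ (mono e)) → ∀ f → Φ f ≈ Ψ f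
clinear-ext {Φ} {Ψ} φ ψ p f = mk≈ λ n →
  trans (sym (CL.local φ n (psum-agree n f) n ℕₚ.≤-refl))
  (trans (at (fin n) n) (CL.local ψ n (psum-agree n f) n ℕₚ.≤-refl))
  where
  term : ∀ c e → Φ (c · mono e) ≈ Ψ (c · mono e)
  term c e = ≈-trans (CL.scale φ c (mono e)) (≈-trans (·-cong c (p e)) (≈-sym (CL.scale ψ c (mono e))))
  fin : ∀ n → Φ (psum n f) ≈ Ψ (psum n f)
  fin zero = term (f 0) 0
  fin (suc n) = ≈-trans (CL.add φ (psum n f) (f (suc n) · mono (suc n))) (≈-trans (⊕-cong (fin n) (term (f (suc n)) (suc n)))
    (≈-sym (CL.add ψ (psum n f) (f (suc n) · mono (suc n)))))

clinear-∘ : ∀ {Φ Ψ} → CLinear Φ → CLinear Ψ → CLinear (λ f → Φ (Ψ f))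
clinear-∘ {Φ} {Ψ} φ ψ = record
  { scale = λ c f → ≈-trans (CL.≈-cong φ (CL.scale ψ c f)) (CL.scale φ c (Ψ f))
  ; add = λ f g → ≈-trans (CL.≈-cong φ (CL.add ψ f g)) (CL.add φ (Ψ f) (Ψ g))
  ; local = λ n p → CL.local φ n (CL.local ψ n p) }

clinear-⊛ʳ : ∀ g → CLinear (_⊛ g)
clinear-⊛ʳ g = record
  { scale = λ c f → mk≈ (·-⊛ c f g)
  ; add = λ f f′ → mk≈ (⊛-distribʳ g f f′)
  ; local = λ n p m m≤n → ⊛-cong≤ m {g = g} (λ i i≤m → p i (ℕₚ.≤-trans i≤m m≤n)) (λ _ _ → refl) }

clinear-⊛ˡ : ∀ g → CLinear (g ⊛_)
clinear-⊛ˡ g = record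
  { scale = λ c f → ≈-trans (R.*-comm g (c · f)) (≈-trans (CL.scale (clinear-⊛ʳ g) c f) (·-cong c (R.*-comm f g)))
  ; add = λ f f′ → R.distribˡ g f f′
  ; local = λ n p m m≤n → ⊛-cong≤ m {f = g} (λ _ _ → refl) (λ i i≤m → p i (ℕₚ.≤-trans i≤m m≤n)) }

-- Both sides are continuous and linear in each factor separately, so `clinear-ext`, used once per
-- factor, reduces the claim to monomials.
multiplicative : ∀ {Φ} → CLinear Φ → (∀ a b → Φ (mono a ⊛ mono b) ≈ Φ (mono a) ⊛ Φ (mono b)) →
  ∀ f g → Φ (f ⊛ g) ≈ Φ f ⊛ Φ g
multiplicative {Φ} φ p f g = clinear-ext (clinear-∘ φ (clinear-⊛ʳ g)) (clinear-∘ (clinear-⊛ʳ (Φ g)) φ)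
  (λ e → clinear-ext (clinear-∘ φ (clinear-⊛ˡ (mono e))) (clinear-∘ (clinear-⊛ˡ (Φ (mono e))) φ) (p e) g) f

shift-clinear : ∀ k → CLinear (shift k)
shift-clinear k = record { scale = λ c f → mk≈ (sc c f) ; add = λ f g → mk≈ (ad f g) ; local = lo }
  where
  sc : ∀ c f n → shift k (c · f) n ≡ c * shift k f n
  sc c f n with k ℕ.≤? n
  ... | yes _ = refl
  ... | no _ = sym (ℤₚ.*-zeroʳ c)
  ad : ∀ f g n → shift k (f ⊕ g) n ≡ shift k f n + shift k g n
  ad f g n with k ℕ.≤? n
  ... | yes _ = refl
  ... | no _ = refl
  lo : ∀ n {f g} → Agree n f g → Agree n (shift k f) (shift k g)
  lo n p m m≤n with k ℕ.≤? m
  ... | yes _ = p (m ℕ.∸ k) (ℕₚ.≤-trans (ℕₚ.m∸n≤m m k) m≤n)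
  ... | no _ = refl

shift-mono : ∀ k e → shift k (mono e) ≈ mono (k ℕ.+ e)
shift-mono k e = mk≈ lem
  where
  lem : ∀ n → shift k (mono e) n ≡ mono (k ℕ.+ e) n
  lem n with k ℕ.≤? n
  lem n | no k≰n = sym (mono-off λ { refl → k≰n (ℕₚ.m≤m+n k e) })
  lem n | yes k≤n with n ℕ.∸ k ℕ.≟ e | n ℕ.≟ k ℕ.+ e
  ... | yes _ | yes _ = refl
  ... | no _ | no _ = refl
  ... | yes refl | no q = ⊥-elim (q (sym (ℕₚ.m+[n∸m]≡n k≤n)))
  ... | no p | yes refl = ⊥-elim (p (ℕₚ.m+n∸m≡n k e))

shift≈⊛ : ∀ k f → shift k f ≈ mono k ⊛ f
shift≈⊛ k = clinear-ext (shift-clinear k) (clinear-⊛ˡ (mono k)) λ e → ≈-trans (shift-mono k e) (≈-sym (mono-⊛ k e))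

dil-clinear : ∀ k .{{_ : NonZero k}} → CLinear (dil k)
dil-clinear k = record { scale = λ c f → mk≈ (sc c f) ; add = λ f g → mk≈ (ad f g) ; local = lo }
  where
  sc : ∀ c f n → dil k (c · f) n ≡ c * dil k f n
  sc c f n with n DM.% k ℕ.≟ 0
  ... | yes _ = refl
  ... | no _ = sym (ℤₚ.*-zeroʳ c)
  ad : ∀ f g n → dil k (f ⊕ g) n ≡ dil k f n + dil k g n
  ad f g n with n DM.% k ℕ.≟ 0
  ... | yes _ = refl
  ... | no _ = refl
  lo : ∀ n {f g} → Agree n f g → Agree n (dil k f) (dil k g)
  lo n p m m≤n with m DM.% k ℕ.≟ 0
  ... | yes _ = p (m DM./ k) (ℕₚ.≤-trans (DM.m/n≤m m k) m≤n)
  ... | no _ = refl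

dil-mono : ∀ k .{{_ : NonZero k}} e → dil k (mono e) ≈ mono (k ℕ.* e)
dil-mono k e = mk≈ lem
  where
  lem : ∀ n → dil k (mono e) n ≡ mono (k ℕ.* e) n
  lem n with n DM.% k ℕ.≟ 0
  lem n | no p = sym (mono-off λ { refl → p (trans (cong (DM._% k) (ℕₚ.*-comm k e)) (DM.m*n%n≡0 e k)) })
  lem n | yes r with n DM./ k ℕ.≟ e | n ℕ.≟ k ℕ.* e
  ... | yes _ | yes _ = refl
  ... | no _ | no _ = refl
  ... | yes refl | no q = ⊥-elim (q (trans (DM.m≡m%n+[m/n]*n n k) (trans (cong (ℕ._+ n DM./ k ℕ.* k) r) (ℕₚ.*-comm (n DM./ k) k))))
  ... | no p | yes refl = ⊥-elim (p (trans (cong (DM._/ k) (ℕₚ.*-comm k e)) (DM.m*n/n≡m e k)))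

dil-⊛ : ∀ k .{{_ : NonZero k}} f g → dil k (f ⊛ g) ≈ dil k f ⊛ dil k g
dil-⊛ k = multiplicative (dil-clinear k) λ a b → begin
  dil k (mono a ⊛ mono b) ≈⟨ CL.≈-cong (dil-clinear k) (mono-⊛ a b) ⟩
  dil k (mono (a ℕ.+ b)) ≈⟨ dil-mono k (a ℕ.+ b) ⟩
  mono (k ℕ.* (a ℕ.+ b)) ≡⟨ cong mono (ℕₚ.*-distribˡ-+ k a b) ⟩
  mono (k ℕ.* a ℕ.+ k ℕ.* b) ≈⟨ mono-⊛ (k ℕ.* a) (k ℕ.* b) ⟨
  mono (k ℕ.* a) ⊛ mono (k ℕ.* b) ≈⟨ ⊛-cong (dil-mono k a) (dil-mono k b) ⟨
  dil k (mono a) ⊛ dil k (mono b) ∎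

dil-∘ : ∀ a b c .{{_ : NonZero a}} .{{_ : NonZero b}} .{{_ : NonZero c}} → a ℕ.* b ≡ c → ∀ f → dil a (dil b f) ≈ dil c f
dil-∘ a b c p = clinear-ext (clinear-∘ (dil-clinear a) (dil-clinear b)) (dil-clinear c) λ e → begin
  dil a (dil b (mono e)) ≈⟨ CL.≈-cong (dil-clinear a) (dil-mono b e) ⟩
  dil a (mono (b ℕ.* e)) ≈⟨ dil-mono a (b ℕ.* e) ⟩
  mono (a ℕ.* (b ℕ.* e)) ≡⟨ cong mono (trans (sym (ℕₚ.*-assoc a b e)) (cong (ℕ._* e) p)) ⟩
  mono (c ℕ.* e) ≈⟨ dil-mono c e ⟨
  dil c (mono e) ∎

dil-comm : ∀ a b .{{_ : NonZero a}} .{{_ : NonZero b}} → ∀ f → dil a (dil b f) ≈ dil b (dil a f)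
dil-comm a b f = ≈-trans (dil-∘ a b (a ℕ.* b) {{_}} {{_}} {{ℕₚ.m*n≢0 a b}} refl f)
  (≈-sym (dil-∘ b a (a ℕ.* b) {{_}} {{_}} {{ℕₚ.m*n≢0 a b}} (ℕₚ.*-comm b a) f))

dil-one : ∀ k .{{_ : NonZero k}} → dil k one ≈ one
dil-one k = ≈-trans (CL.≈-cong (dil-clinear k) (≈-sym mono-0))
  (≈-trans (dil-mono k 0) (≈-trans (mk≈ λ n → cong (λ e → mono e n) (ℕₚ.*-zeroʳ k)) mono-0))

alt-clinear : CLinear alt
alt-clinear = record
  { scale = λ c f → mk≈ λ n → ZS.solve 3 (λ a b d → a *ᶻ (b *ᶻ d) =ᶻ b *ᶻ (a *ᶻ d)) refl (-1ℤ ^ n) c (f n)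
  ; add = λ f g → mk≈ λ n → ℤₚ.*-distribˡ-+ (-1ℤ ^ n) (f n) (g n)
  ; local = λ n p m m≤n → cong (-1ℤ ^ m *_) (p m m≤n) }

alt-mono : ∀ e → alt (mono e) ≈ (-1ℤ ^ e) · mono e
alt-mono e = mk≈ lem
  where
  lem : ∀ n → alt (mono e) n ≡ (-1ℤ ^ e) * mono e n
  lem n with n ℕ.≟ e
  ... | yes refl = refl
  ... | no _ = trans (ℤₚ.*-zeroʳ (-1ℤ ^ n)) (sym (ℤₚ.*-zeroʳ (-1ℤ ^ e)))

·mono-⊛ : ∀ c a d b → (c · mono a) ⊛ (d · mono b) ≈ (c * d) · mono (a ℕ.+ b)
·mono-⊛ c a d b = ≈-trans (CL.scale (clinear-⊛ʳ (d · mono b)) c (mono a))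
  (≈-trans (·-cong c (≈-trans (CL.scale (clinear-⊛ˡ (mono a)) d (mono b)) (·-cong d (mono-⊛ a b))))
  (mk≈ λ n → sym (ℤₚ.*-assoc c d _)))

alt-⊛ : ∀ f g → alt (f ⊛ g) ≈ alt f ⊛ alt g
alt-⊛ = multiplicative alt-clinear λ a b → begin
  alt (mono a ⊛ mono b) ≈⟨ CL.≈-cong alt-clinear (mono-⊛ a b) ⟩
  alt (mono (a ℕ.+ b)) ≈⟨ alt-mono (a ℕ.+ b) ⟩
  (-1ℤ ^ (a ℕ.+ b)) · mono (a ℕ.+ b) ≡⟨ cong (_· mono (a ℕ.+ b)) (ℤₚ.^-distribˡ-+-* -1ℤ a b) ⟩
  (-1ℤ ^ a * -1ℤ ^ b) · mono (a ℕ.+ b) ≈⟨ ·mono-⊛ (-1ℤ ^ a) a (-1ℤ ^ b) b ⟨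
  ((-1ℤ ^ a) · mono a) ⊛ ((-1ℤ ^ b) · mono b) ≈⟨ ⊛-cong (alt-mono a) (alt-mono b) ⟨
  alt (mono a) ⊛ alt (mono b) ∎

-- Oddness of k is expressed by (-1)^k = -1 because this is `refl` for the numerals 5 and 19 that
-- occur.
-1^odd* : ∀ k e → -1ℤ ^ k ≡ -1ℤ → -1ℤ ^ (k ℕ.* e) ≡ -1ℤ ^ e
-1^odd* k e p = trans (sym (ℤₚ.^-*-assoc -1ℤ k e)) (cong (_^ e) p)

alt-dil : ∀ k .{{_ : NonZero k}} → -1ℤ ^ k ≡ -1ℤ → ∀ f → alt (dil k f) ≈ dil k (alt f)
alt-dil k p = clinear-ext (clinear-∘ alt-clinear (dil-clinear k)) (clinear-∘ (dil-clinear k) alt-clinear) λ e → begin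
  alt (dil k (mono e)) ≈⟨ CL.≈-cong alt-clinear (dil-mono k e) ⟩
  alt (mono (k ℕ.* e)) ≈⟨ alt-mono (k ℕ.* e) ⟩
  (-1ℤ ^ (k ℕ.* e)) · mono (k ℕ.* e) ≡⟨ cong (_· mono (k ℕ.* e)) (-1^odd* k e p) ⟩
  (-1ℤ ^ e) · mono (k ℕ.* e) ≈⟨ ·-cong (-1ℤ ^ e) (dil-mono k e) ⟨
  (-1ℤ ^ e) · dil k (mono e) ≈⟨ CL.scale (dil-clinear k) (-1ℤ ^ e) (mono e) ⟨
  dil k ((-1ℤ ^ e) · mono e) ≈⟨ CL.≈-cong (dil-clinear k) (alt-mono e) ⟨
  dil k (alt (mono e)) ∎

alt-dil-even : ∀ k .{{_ : NonZero k}} → -1ℤ ^ k ≡ + 1 → ∀ f → alt (dil k f) ≈ dil k f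
alt-dil-even k p = clinear-ext (clinear-∘ alt-clinear (dil-clinear k)) (dil-clinear k) λ e → begin
  alt (dil k (mono e)) ≈⟨ CL.≈-cong alt-clinear (dil-mono k e) ⟩
  alt (mono (k ℕ.* e)) ≈⟨ alt-mono (k ℕ.* e) ⟩
  (-1ℤ ^ (k ℕ.* e)) · mono (k ℕ.* e) ≡⟨ cong (_· mono (k ℕ.* e)) (trans (sym (ℤₚ.^-*-assoc -1ℤ k e)) (trans (cong (_^ e) p) (ℤₚ.^-zeroˡ e))) ⟩
  (+ 1) · mono (k ℕ.* e) ≈⟨ mk≈ (λ n → ℤₚ.*-identityˡ _) ⟩
  mono (k ℕ.* e) ≈⟨ dil-mono k e ⟨
  dil k (mono e) ∎

-- Inverses and cancellation of power series

invPre-inv : ∀ a n j → j ℕ.≤ n → invPre a n j ≡ inv a j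
invPre-inv a zero .zero z≤n = refl
invPre-inv a (suc n) j j≤ with j ℕ.≟ suc n
... | yes refl = refl
... | no p with j ℕ.≤? n
...   | yes j≤n = invPre-inv a n j j≤n
...   | no j≰n = ⊥-elim (j≰n (ℕₚ.≤-pred (ℕₚ.≤∧≢⇒< j≤ p)))

inv-suc : ∀ a n → inv a (suc n) ≡ - sumTo n (λ i → a (suc n ℕ.∸ i) * inv a i)
inv-suc a n with suc n ℕ.≤? n
... | yes p = ⊥-elim (ℕₚ.1+n≰n p)
... | no _ = cong -_ (sumTo-cong≤ n λ i i≤n → cong (a (suc n ℕ.∸ i) *_) (invPre-inv a n i i≤n))

⊛-inv : ∀ a → a 0 ≡ + 1 → a ⊛ inv a ≈ one
⊛-inv a a0 = ≈-trans (R.*-comm a (inv a)) (mk≈ lem)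
  where
  lem : ∀ n → (inv a ⊛ a) n ≡ one n
  lem zero = trans (ℤₚ.*-identityˡ (a 0)) a0
  lem (suc n) = trans (cong₂ _+_ (sumTo-cong n λ i → ℤₚ.*-comm (inv a i) (a (suc n ℕ.∸ i)))
      (trans (cong₂ _*_ (inv-suc a n) (trans (cong a (ℕₚ.n∸n≡0 n)) a0)) (ℤₚ.*-identityʳ _)))
    (ℤₚ.+-inverseʳ (sumTo n (λ i → a (suc n ℕ.∸ i) * inv a i)))

-- If g vanishes up to degree n, then the coefficient of q^(n+1) in f ⊛ g is f 0 · g (n+1), and ℤ
-- has no zero divisors.
annihilator : ∀ f g → f 0 ≢ + 0 → f ⊛ g ≈ 𝟘 → g ≈ 𝟘
annihilator f g f0 p = mk≈ λ n → below n n ℕₚ.≤-refl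
  where
  lead : ∀ {x} → f 0 * x ≡ + 0 → x ≡ + 0
  lead {x} e with ℤₚ.i*j≡0⇒i≡0∨j≡0 (f 0) e
  ... | inj₁ z = ⊥-elim (f0 z)
  ... | inj₂ z = z
  below : ∀ n → Agree n g 𝟘
  below zero .zero z≤n = lead (at p 0)
  below (suc n) m m≤ with m ℕ.≟ suc n
  ... | no q = below n m (ℕₚ.≤-pred (ℕₚ.≤∧≢⇒< m≤ q))
  ... | yes refl = lead (trans (sym (trans (⊛-sucˡ f g n)
          (trans (cong (λ x → f 0 * g (suc n) + x)
            (trans (⊛-cong≤ n {f = tail f} (λ _ _ → refl) (below n)) (at (R.zeroʳ (tail f)) n)))
          (ℤₚ.+-identityʳ _)))) (at p (suc n)))

⊖≈𝟘⇒≈ : ∀ {f g} → f ⊖ g ≈ 𝟘 → f ≈ g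
⊖≈𝟘⇒≈ {f} {g} p = mk≈ λ n → ℤₚ.i-j≡0⇒i≡j (f n) (g n) (at p n)

⊛-cancelˡ : ∀ f {g h} → f 0 ≢ + 0 → f ⊛ g ≈ f ⊛ h → g ≈ h
⊛-cancelˡ f {g} {h} f0 p = ⊖≈𝟘⇒≈ (annihilator f (g ⊖ h) f0
  (≈-trans (solve 3 (λ f g h → f :* (g :- h) := f :* g :- f :* h) ≈-refl f g h)
  (≈-trans (⊕-cong p ≈-refl) (R.-‿inverseʳ (f ⊛ h)))))

-- Sums over arbitrary index types

sumS : ∀ {I : Set} → List I → (I → Series) → Series
sumS [] F = 𝟘
sumS (i ∷ L) F = F i ⊕ sumS L F

sumS-↭ : ∀ {I : Set} (F : I → Series) n {L M} → L ↭ M → sumS L F n ≡ sumS M F n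
sumS-↭ F n Perm.refl = refl
sumS-↭ F n (Perm.prep x p) = cong (λ s → F x n + s) (sumS-↭ F n p)
sumS-↭ F n (Perm.swap {L} {M} x y p) = trans (cong (λ s → F x n + (F y n + s)) (sumS-↭ F n p))
  (ZS.solve 3 (λ a b c → a +ᶻ (b +ᶻ c) =ᶻ b +ᶻ (a +ᶻ c)) refl (F x n) (F y n) (sumS M F n))
sumS-↭ F n (Perm.trans p q) = trans (sumS-↭ F n p) (sumS-↭ F n q)

module _ {I : Set} (F : I → Series) (n : ℕ) where
  nonzero? : ∀ i → Dec (F i n ≢ + 0)
  nonzero? i = ¬? (F i n ℤₚ.≟ + 0)

  sumS-filter : ∀ L → sumS (filter nonzero? L) F n ≡ sumS L F n
  sumS-filter [] = refl
  sumS-filter (i ∷ L) with F i n ℤₚ.≟ + 0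
  ... | yes z = trans (sumS-filter L) (sym (trans (cong (_+ sumS L F n) z) (ℤₚ.+-identityˡ _)))
  ... | no _ = cong (λ s → F i n + s) (sumS-filter L)

  -- Once the zero terms are filtered out, the two duplicate-free lists have the same members and
  -- are therefore permutations of each other.
  sumS-support : ∀ {L M} → Unique L → Unique M →
    (∀ i → i ∈ L ⊎ F i n ≡ + 0) → (∀ i → i ∈ M ⊎ F i n ≡ + 0) → sumS L F n ≡ sumS M F n
  sumS-support {L} {M} uL uM cL cM = trans (sym (sumS-filter L)) (trans
    (sumS-↭ F n (∼bag⇒↭ (unique∧set⇒bag (Uniqueₚ.filter⁺ nonzero? uL) (Uniqueₚ.filter⁺ nonzero? uM)
      (mk⇔ (into {L} {M} cM) (into {M} {L} cL)))))
    (sumS-filter M))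
    where
    into : ∀ {A B} → (∀ i → i ∈ B ⊎ F i n ≡ + 0) → ∀ {i} → i ∈ filter nonzero? A → i ∈ filter nonzero? B
    into {A} c {i} p with ∈-filter⁻ nonzero? {xs = A} p
    ... | _ , nz with c i
    ...   | inj₁ q = ∈-filter⁺ nonzero? q nz
    ...   | inj₂ z = ⊥-elim (nz z)

-- Every coefficient of Σ F is a finite sum: `support` contains all indices whose terms are nonzero in degree ≤ n.
record SumUpTo {I : Set} (F : I → Series) (S : Series) (n : ℕ) : Set where
  field
    support : List I
    unique  : Unique support
    cover   : ∀ i → i ∈ support ⊎ Agree n (F i) 𝟘
    total   : Agree n (sumS support F) S

record HasSum {I : Set} (F : I → Series) (S : Series) : Set where
  constructor mkSum
  field upTo′ : ∀ n → SumUpTo F S n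

open SumUpTo
open HasSum

variable
  I J : Set

-- The recorded support may be exchanged for a convenient one, such as an interval of integers
-- centred at 0.
HasSum-window : {F : I → Series} → ∀ {S L} k → HasSum F S → Unique L → (∀ i → i ∈ L ⊎ F i k ≡ + 0) → sumS L F k ≡ S k
HasSum-window {F = F} {L = L} k h u cov = window (upTo′ h k)
  where
  window : ∀ {S} → SumUpTo F S k → sumS L F k ≡ S k
  window s = trans (sumS-support F k u (unique s) cov weaken) (total s k ℕₚ.≤-refl)
    where
    weaken : ∀ i → i ∈ support s ⊎ F i k ≡ + 0
    weaken i with cover s i
    ... | inj₁ x = inj₁ x
    ... | inj₂ y = inj₂ (y k ℕₚ.≤-refl)

-- This is how every theta identity arises: one family is summed in two ways, and the two values
-- must coincide.
HasSum-unique : {F : I → Series} → ∀ {S T} → HasSum F S → HasSum F T → S ≈ T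
HasSum-unique {F = F} {T = T} p q = mk≈ λ n → compare n (upTo′ p n)
  where
  compare : ∀ {S} n → SumUpTo F S n → S n ≡ T n
  compare n s = trans (sym (total s n ℕₚ.≤-refl)) (HasSum-window n q (unique s) weaken)
    where
    weaken : ∀ i → i ∈ support s ⊎ F i n ≡ + 0
    weaken i with cover s i
    ... | inj₁ x = inj₁ x
    ... | inj₂ y = inj₂ (y n ℕₚ.≤-refl)

sumS-cong : {F G : I → Series} → ∀ L → (∀ i → F i ≈ G i) → sumS L F ≈ sumS L G
sumS-cong [] p = ≈-refl
sumS-cong (i ∷ L) p = ⊕-cong (p i) (sumS-cong L p)

HasSum-cong : {F G : I → Series} → ∀ {S T} → (∀ i → F i ≈ G i) → S ≈ T → HasSum F S → HasSum G T
HasSum-cong p q h = mkSum λ n → let s = upTo′ h n in record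
  { support = support s
  ; unique = unique s
  ; cover = λ i → map₂ (λ v m m≤n → trans (sym (at (p i) m)) (v m m≤n)) (cover s i)
  ; total = λ m m≤n → trans (sym (at (sumS-cong (support s) p) m)) (trans (total s m m≤n) (at q m)) }

sumS-map : (f : I → J) (F : J → Series) → ∀ L → sumS (map f L) F ≈ sumS L (λ i → F (f i))
sumS-map f F [] = ≈-refl
sumS-map f F (i ∷ L) = ⊕-congˡ (F (f i)) (sumS-map f F L)

HasSum-reindex : (f : I → J) → (∀ {x y} → f x ≡ f y → x ≡ y) → (∀ j → ∃ λ i → f i ≡ j) →
  {F : J → Series} → ∀ {S} → HasSum (λ i → F (f i)) S → HasSum F S
HasSum-reindex f inj surj {F} {S} h = mkSum λ n → let s = upTo′ h n in record
  { support = map f (support s)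
  ; unique = Uniqueₚ.map⁺ inj (unique s)
  ; cover = λ j → cov s j (surj j)
  ; total = λ m m≤n → trans (at (sumS-map f F (support s)) m) (total s m m≤n) }
  where
  cov : ∀ {n} (s : SumUpTo (λ i → F (f i)) S n) → ∀ j → (∃ λ i → f i ≡ j) → j ∈ map f (support s) ⊎ Agree n (F j) 𝟘
  cov s .(f i) (i , refl) with cover s i
  ... | inj₁ x = inj₁ (∈-map⁺ f x)
  ... | inj₂ y = inj₂ y

sumS-++ : (F : I → Series) → ∀ L M → sumS (L ++ M) F ≈ sumS L F ⊕ sumS M F
sumS-++ F [] M = ≈-sym (R.+-identityˡ (sumS M F))
sumS-++ F (i ∷ L) M = ≈-trans (⊕-congˡ (F i) (sumS-++ F L M)) (≈-sym (R.+-assoc (F i) (sumS L F) (sumS M F)))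

HasSum-⊎ : {F : I ⊎ J → Series} → ∀ {S T} → HasSum (λ i → F (inj₁ i)) S → HasSum (λ j → F (inj₂ j)) T → HasSum F (S ⊕ T)
HasSum-⊎ {F = F} {S} {T} h k = mkSum λ n → let s = upTo′ h n; t = upTo′ k n in record
  { support = map inj₁ (support s) ++ map inj₂ (support t)
  ; unique = Uniqueₚ.++⁺ (Uniqueₚ.map⁺ (λ { refl → refl }) (unique s)) (Uniqueₚ.map⁺ (λ { refl → refl }) (unique t))
      (λ (a , b) → disj (∈-map⁻ inj₁ a) (∈-map⁻ inj₂ b))
  ; cover = cov s t
  ; total = λ m m≤n → trans (at (sumS-++ F (map inj₁ (support s)) (map inj₂ (support t))) m)
      (cong₂ _+_ (trans (at (sumS-map inj₁ F (support s)) m) (total s m m≤n))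
                     (trans (at (sumS-map inj₂ F (support t)) m) (total t m m≤n))) }
  where
  disj : ∀ {v L M} → (∃ λ i → i ∈ L × v ≡ inj₁ i) → (∃ λ j → j ∈ M × v ≡ inj₂ j) → ⊥
  disj (_ , _ , refl) (_ , _ , ())
  cov : ∀ {n} (s : SumUpTo (λ i → F (inj₁ i)) S n) (t : SumUpTo (λ j → F (inj₂ j)) T n) → ∀ i →
    i ∈ map inj₁ (support s) ++ map inj₂ (support t) ⊎ Agree n (F i) 𝟘
  cov s t (inj₁ i) with cover s i
  ... | inj₁ x = inj₁ (∈-++⁺ˡ (∈-map⁺ inj₁ x))
  ... | inj₂ y = inj₂ y
  cov s t (inj₂ j) with cover t j
  ... | inj₁ x = inj₁ (∈-++⁺ʳ (map inj₁ (support s)) (∈-map⁺ inj₂ x))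
  ... | inj₂ y = inj₂ y

sumS-clinear : ∀ {Φ} → CLinear Φ → (F : I → Series) → ∀ L → sumS L (λ i → Φ (F i)) ≈ Φ (sumS L F)
sumS-clinear φ F [] = ≈-sym (CL.Φ-𝟘 φ)
sumS-clinear {Φ = Φ} φ F (i ∷ L) = ≈-trans (⊕-congˡ (Φ (F i)) (sumS-clinear φ F L)) (≈-sym (CL.add φ (F i) (sumS L F)))

-- Continuity carries over both the vanishing of the omitted terms and the value of the finite sum,
-- degree by degree.
HasSum-clinear : ∀ {Φ} → CLinear Φ → {F : I → Series} → ∀ {S} → HasSum F S → HasSum (λ i → Φ (F i)) (Φ S)
HasSum-clinear φ {F} h = mkSum λ n → let s = upTo′ h n in record
  { support = support s
  ; unique = unique s
  ; cover = λ i → map₂ (λ v m m≤n → trans (CL.local φ n v m m≤n) (at (CL.Φ-𝟘 φ) m)) (cover s i)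
  ; total = λ m m≤n → trans (at (sumS-clinear φ F (support s)) m) (CL.local φ n (total s) m m≤n) }

sumS-× : (F : I → Series) (G : J → Series) → ∀ L M → sumS (cartesianProduct L M) (λ (i , j) → F i ⊛ G j) ≈ sumS L F ⊛ sumS M G
sumS-× F G [] M = ≈-sym (R.zeroˡ (sumS M G))
sumS-× F G (i ∷ L) M = begin
  sumS (map (i ,_) M ++ cartesianProduct L M) FG ≈⟨ sumS-++ FG (map (i ,_) M) (cartesianProduct L M) ⟩
  sumS (map (i ,_) M) FG ⊕ sumS (cartesianProduct L M) FG
    ≈⟨ ⊕-cong (≈-trans (sumS-map (i ,_) FG M) (sumS-clinear (clinear-⊛ˡ (F i)) G M)) (sumS-× F G L M) ⟩
  F i ⊛ sumS M G ⊕ sumS L F ⊛ sumS M G ≈⟨ R.distribʳ (sumS M G) (F i) (sumS L F) ⟨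
  (F i ⊕ sumS L F) ⊛ sumS M G ∎
  where FG = λ (i , j) → F i ⊛ G j

HasSum-× : {F : I → Series} {G : J → Series} → ∀ {S T} → HasSum F S → HasSum G T → HasSum (λ (i , j) → F i ⊛ G j) (S ⊛ T)
HasSum-× {F = F} {G} {S} {T} h k = mkSum λ n → let s = upTo′ h n; t = upTo′ k n in record
  { support = cartesianProduct (support s) (support t)
  ; unique = Uniqueₚ.cartesianProduct⁺ (unique s) (unique t)
  ; cover = cov s t
  ; total = λ m m≤n → trans (at (sumS-× F G (support s) (support t)) m)
      (⊛-cong≤ m (λ i i≤m → total s i (ℕₚ.≤-trans i≤m m≤n)) (λ i i≤m → total t i (ℕₚ.≤-trans i≤m m≤n))) }
  where
  cov : ∀ {n} (s : SumUpTo F S n) (t : SumUpTo G T n) → ∀ ij →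
    ij ∈ cartesianProduct (support s) (support t) ⊎ Agree n (F (proj₁ ij) ⊛ G (proj₂ ij)) 𝟘
  cov {n} s t (i , j) with cover s i | cover t j
  ... | inj₁ x | inj₁ y = inj₁ (∈-cartesianProduct⁺ x y)
  ... | inj₂ v | _ = inj₂ λ m m≤n → trans (CL.local (clinear-⊛ʳ (G j)) n v m m≤n) (at (R.zeroˡ (G j)) m)
  ... | inj₁ _ | inj₂ v = inj₂ λ m m≤n → trans (CL.local (clinear-⊛ˡ (F i)) n v m m≤n) (at (R.zeroʳ (F i)) m)

sumFin : ∀ d → (Fin d → Series) → Series
sumFin zero S = 𝟘
sumFin (suc d) S = S Fin.zero ⊕ sumFin d (λ r → S (Fin.suc r))

HasSum-Fin : ∀ d {F : Fin d × I → Series} {S : Fin d → Series} →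
  (∀ r → HasSum (λ i → F (r , i)) (S r)) → HasSum F (sumFin d S)
HasSum-Fin zero h = mkSum λ n → record
  { support = [] ; unique = [] ; cover = λ { (() , _) } ; total = λ _ _ → refl }
HasSum-Fin {I = I} (suc d) {F} h = HasSum-reindex f inj surj
  (HasSum-⊎ (h Fin.zero) (HasSum-Fin d (λ r → h (Fin.suc r))))
  where
  f : I ⊎ Fin d × I → Fin (suc d) × I
  f (inj₁ i) = Fin.zero , i
  f (inj₂ (r , i)) = Fin.suc r , i
  inj : ∀ {x y} → f x ≡ f y → x ≡ y
  inj {inj₁ _} {inj₁ _} refl = refl
  inj {inj₂ _} {inj₂ _} refl = refl
  surj : ∀ j → ∃ λ i → f i ≡ j
  surj (Fin.zero , i) = inj₁ i , refl
  surj (Fin.suc r , i) = inj₂ (r , i) , refl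

-- Summation over residue classes and after unimodular substitutions

+-cancelˡ : ∀ x a b → x + a ≡ x + b → a ≡ b
+-cancelˡ x a b e = trans (undo a) (trans (cong (_- x) e) (sym (undo b)))
  where
  undo : ∀ a → a ≡ x + a - x
  undo a = ZS.solve 2 (λ x a → a =ᶻ x +ᶻ a -ᶻ x) refl x a

-- Uniqueness of division with remainder: d · |k - k′| = |r′ - r| < d forces k = k′, and then r =
-- r′.
divMod-injective : ∀ d (r r′ : Fin d) k k′ → + d * k + + toℕ r ≡ + d * k′ + + toℕ r′ → r ≡ r′ × k ≡ k′
divMod-injective d r r′ k k′ e = Finₚ.toℕ-injective (ℤₚ.+-injective (+-cancelˡ (+ d * k) (+ toℕ r) (+ toℕ r′) e′)) , k≡k′
  where
  gap : + d * (k - k′) ≡ toℕ r′ ℤ.⊖ toℕ r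
  gap = trans (ZS.solve 4 (λ d k k′ r → d *ᶻ (k -ᶻ k′) =ᶻ d *ᶻ k +ᶻ r -ᶻ d *ᶻ k′ -ᶻ r) refl (+ d) k k′ (+ toℕ r))
    (trans (cong (λ x → x - + d * k′ - + toℕ r) e)
    (trans (ZS.solve 3 (λ x r r′ → x +ᶻ r′ -ᶻ x -ᶻ r =ᶻ r′ -ᶻ r) refl (+ d * k′) (+ toℕ r) (+ toℕ r′))
      (ℤₚ.m-n≡m⊖n (toℕ r′) (toℕ r))))
  small : d ℕ.* ∣ k - k′ ∣ ℕ.< d
  small = subst (ℕ._< d) (trans (cong ∣_∣ (sym gap)) (ℤₚ.abs-* (+ d) (k - k′)))
    (ℕₚ.≤-<-trans (ℤₚ.∣m⊝n∣≤m⊔n (toℕ r′) (toℕ r)) (ℕₚ.⊔-pres-<m (Finₚ.toℕ<n r′) (Finₚ.toℕ<n r)))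
  isZero : ∀ x → d ℕ.* x ℕ.< d → x ≡ 0
  isZero zero _ = refl
  isZero (suc x) p = ⊥-elim (ℕₚ.<-irrefl refl (ℕₚ.<-≤-trans p (ℕₚ.m≤m*n d (suc x))))
  k≡k′ : k ≡ k′
  k≡k′ = ℤₚ.i-j≡0⇒i≡j k k′ (ℤₚ.∣i∣≡0⇒i≡0 (isZero _ small))
  e′ : + d * k + + toℕ r ≡ + d * k + + toℕ r′
  e′ = trans e (cong (λ x → + d * x + + toℕ r′) (sym k≡k′))

-- Division with remainder is a bijection between pairs (residue, quotient) and integers; the second
-- index is carried along untouched.
HasSum-mod : ∀ d .{{_ : NonZero d}} {F : ℤ × J → Series} {S : Fin d → Series} →
  (∀ r → HasSum (λ (k , j) → F (+ d * k + + toℕ r , j)) (S r)) → HasSum F (sumFin d S)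
HasSum-mod {J = J} d {F} h = HasSum-reindex f inj surj (HasSum-Fin d h)
  where
  f : Fin d × ℤ × J → ℤ × J
  f (r , k , j) = + d * k + + toℕ r , j
  inj : ∀ {x y} → f x ≡ f y → x ≡ y
  inj {r , k , j} {r′ , k′ , j′} e with divMod-injective d r r′ k k′ (cong proj₁ e) | cong proj₂ e
  ... | refl , refl | refl = refl
  surj : ∀ y → ∃ λ x → f x ≡ y
  surj (a , j) = (Fin.fromℕ< (ZDM.n%ℕd<d a d) , a ZDM./ℕ d , j) , cong (_, j)
    (trans (cong (λ r → + d * (a ZDM./ℕ d) + + r) (Finₚ.toℕ-fromℕ< (ZDM.n%ℕd<d a d)))
    (trans (ZS.solve 3 (λ d q r → d *ᶻ q +ᶻ r =ᶻ r +ᶻ q *ᶻ d) refl (+ d) (a ZDM./ℕ d) (+ (a ZDM.%ℕ d)))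
      (sym (ZDM.a≡a%ℕn+[a/ℕn]*n a d))))

ℤ² : Set
ℤ² = ℤ × ℤ

affine : (a b c d e f : ℤ) → ℤ² → ℤ²
affine a b c d e f (x , y) = a * x + b * y + e , c * x + d * y + f

-- For determinant δ = ±1 the inverse matrix is δ times the adjugate, so the inverse substitution is
-- again integral and both round trips are polynomial identities.
HasSum-affine : ∀ a b c d e f δ → a * d - b * c ≡ δ → δ * δ ≡ + 1 →
  ∀ {F : ℤ² → Series} {S} → HasSum (λ p → F (affine a b c d e f p)) S → HasSum F S
HasSum-affine a b c d e f δ det δδ = HasSum-reindex to
  (λ {p} {q} eq → trans (sym (from-to p)) (trans (cong from eq) (from-to q)))
  (λ q → from q , to-from q)
  where
  to from : ℤ² → ℤ²
  to = affine a b c d e f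
  from (X , Y) = δ * (d * (X - e) - b * (Y - f)) , δ * (a * (Y - f) - c * (X - e))
  δ² : (a * d - b * c) * δ ≡ + 1
  δ² = trans (cong (_* δ) det) δδ
  unit : ∀ x → (a * d - b * c) * δ * x ≡ x
  unit x = trans (cong (_* x) δ²) (ℤₚ.*-identityˡ x)
  from-to : ∀ p → from (to p) ≡ p
  from-to (x , y) = cong₂ _,_
    (trans (ZS.solve 9 (λ a b c d e f δ x y →
      δ *ᶻ (d *ᶻ (a *ᶻ x +ᶻ b *ᶻ y +ᶻ e -ᶻ e) -ᶻ b *ᶻ (c *ᶻ x +ᶻ d *ᶻ y +ᶻ f -ᶻ f))
      =ᶻ (a *ᶻ d -ᶻ b *ᶻ c) *ᶻ δ *ᶻ x) refl a b c d e f δ x y) (unit x))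
    (trans (ZS.solve 9 (λ a b c d e f δ x y →
      δ *ᶻ (a *ᶻ (c *ᶻ x +ᶻ d *ᶻ y +ᶻ f -ᶻ f) -ᶻ c *ᶻ (a *ᶻ x +ᶻ b *ᶻ y +ᶻ e -ᶻ e))
      =ᶻ (a *ᶻ d -ᶻ b *ᶻ c) *ᶻ δ *ᶻ y) refl a b c d e f δ x y) (unit y))
  to-from : ∀ p → to (from p) ≡ p
  to-from (X , Y) = cong₂ _,_
    (trans (ZS.solve 9 (λ a b c d e f δ X Y →
      a *ᶻ (δ *ᶻ (d *ᶻ (X -ᶻ e) -ᶻ b *ᶻ (Y -ᶻ f))) +ᶻ b *ᶻ (δ *ᶻ (a *ᶻ (Y -ᶻ f) -ᶻ c *ᶻ (X -ᶻ e))) +ᶻ e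
      =ᶻ (a *ᶻ d -ᶻ b *ᶻ c) *ᶻ δ *ᶻ (X -ᶻ e) +ᶻ e) refl a b c d e f δ X Y)
      (trans (cong (_+ e) (unit (X - e))) (ZS.solve 2 (λ X e → X -ᶻ e +ᶻ e =ᶻ X) refl X e)))
    (trans (ZS.solve 9 (λ a b c d e f δ X Y →
      c *ᶻ (δ *ᶻ (d *ᶻ (X -ᶻ e) -ᶻ b *ᶻ (Y -ᶻ f))) +ᶻ d *ᶻ (δ *ᶻ (a *ᶻ (Y -ᶻ f) -ᶻ c *ᶻ (X -ᶻ e))) +ᶻ f
      =ᶻ (a *ᶻ d -ᶻ b *ᶻ c) *ᶻ δ *ᶻ (Y -ᶻ f) +ᶻ f) refl a b c d e f δ X Y)
      (trans (cong (_+ f) (unit (Y - f))) (ZS.solve 2 (λ Y f → Y -ᶻ f +ᶻ f =ᶻ Y) refl Y f)))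

-- Theta series

-- The same truncation as in the definitions of `G` and `H`: it is harmless when the i-th term has
-- no coefficients below degree i.
sumN : (ℕ → Series) → Series
sumN F n = sumTo n (λ i → F i n)

sumTo-vanish : ∀ m n f → m ℕ.≤ n → (∀ i → m ℕ.< i → f i ≡ + 0) → sumTo n f ≡ sumTo m f
sumTo-vanish m n f m≤n v with m ℕ.≟ n
... | yes refl = refl
sumTo-vanish m zero f z≤n v | no p = ⊥-elim (p refl)
sumTo-vanish m (suc n) f m≤n v | no p =
  trans (cong₂ _+_ (sumTo-vanish m n f (ℕₚ.≤-pred m<) v) (v (suc n) m<)) (ℤₚ.+-identityʳ _)
  where m< = ℕₚ.≤∧≢⇒< m≤n p

sumS-downFrom : ∀ F n m → sumS (downFrom (suc n)) F m ≡ sumTo n (λ i → F i m)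
sumS-downFrom F zero m = ℤₚ.+-identityʳ (F 0 m)
sumS-downFrom F (suc n) m = trans (cong (λ s → F (suc n) m + s) (sumS-downFrom F n m)) (ℤₚ.+-comm (F (suc n) m) _)

HasSum-ℕ : ∀ {F : ℕ → Series} → (∀ i m → m ℕ.< i → F i m ≡ + 0) → HasSum F (sumN F)
HasSum-ℕ {F} v = mkSum λ n → record
  { support = downFrom (suc n)
  ; unique = Uniqueₚ.downFrom⁺ (suc n)
  ; cover = cov n
  ; total = λ m m≤n → trans (sumS-downFrom F n m) (sumTo-vanish m n (λ i → F i m) m≤n (λ i → v i m)) }
  where
  cov : ∀ n i → _
  cov n i with i ℕ.≤? n
  ... | yes i≤n = inj₁ (∈-downFrom⁺ (s≤s i≤n))
  ... | no i≰n = inj₂ λ m m≤n → v i m (ℕₚ.≤-<-trans m≤n (ℕₚ.≰⇒> i≰n))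

sumZ : (ℤ → Series) → Series
sumZ F = sumN (λ n → F (+ n)) ⊕ sumN (λ n → F -[1+ n ])

HasSum-ℤ-halves : ∀ {F : ℤ → Series} {S T} → HasSum (λ n → F (+ n)) S → HasSum (λ n → F -[1+ n ]) T → HasSum F (S ⊕ T)
HasSum-ℤ-halves h k = HasSum-reindex to inj surj (HasSum-⊎ h k)
  where
  to : ℕ ⊎ ℕ → ℤ
  to (inj₁ n) = + n
  to (inj₂ n) = -[1+ n ]
  inj : ∀ {x y} → to x ≡ to y → x ≡ y
  inj {inj₁ _} {inj₁ _} refl = refl
  inj {inj₂ _} {inj₂ _} refl = refl
  surj : ∀ j → ∃ λ i → to i ≡ j
  surj (+ n) = inj₁ n , refl
  surj -[1+ n ] = inj₂ n , refl

HasSum-ℤ : ∀ {F : ℤ → Series} → (∀ i m → m ℕ.< ∣ i ∣ → F i m ≡ + 0) → HasSum F (sumZ F)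
HasSum-ℤ {F} v = HasSum-ℤ-halves (HasSum-ℕ (λ n → v (+ n)))
  (HasSum-ℕ (λ n m m<n → v -[1+ n ] m (ℕₚ.<-trans m<n (ℕₚ.n<1+n n))))

HasSum-mod₁ : ∀ d .{{_ : NonZero d}} {F : ℤ → Series} {S : Fin d → Series} →
  (∀ r → HasSum (λ k → F (+ d * k + + toℕ r)) (S r)) → HasSum F (sumFin d S)
HasSum-mod₁ d h = HasSum-reindex proj₁ (λ { refl → refl }) (λ j → (j , tt) , refl)
  (HasSum-mod d (λ r → HasSum-reindex (_, tt) (λ { refl → refl }) (λ { (j , tt) → j , refl }) (h r)))

HasSum-neg : ∀ e {F : ℤ → Series} {S} → HasSum (λ k → F (e - k)) S → HasSum F S
HasSum-neg e = HasSum-reindex (λ k → e - k)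
  (λ {x} {y} p → trans (sym (invol x)) (trans (cong (λ z → e - z) p) (invol y)))
  (λ j → e - j , invol j)
  where
  invol : ∀ x → e - (e - x) ≡ x
  invol x = ZS.solve 2 (λ e x → e -ᶻ (e -ᶻ x) =ᶻ x) refl e x

HasSum-shear : ∀ c {F : ℤ² → Series} {S} → HasSum (λ (x , y) → F (x + c * y , y)) S → HasSum F S
HasSum-shear c = HasSum-reindex (λ (x , y) → x + c * y , y)
  (λ { {x , y} {x′ , y′} p → cong₂ _,_
      (trans (undo x y) (trans (cong (λ (X , Y) → X - c * Y) p) (sym (undo x′ y′)))) (cong proj₂ p) })
  (λ (X , Y) → (X - c * Y , Y) , cong (_, Y) (ZS.solve 3 (λ X c Y → X -ᶻ c *ᶻ Y +ᶻ c *ᶻ Y =ᶻ X) refl X c Y))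
  where
  undo : ∀ x y → x ≡ x + c * y - c * y
  undo x y = ZS.solve 3 (λ x c y → x =ᶻ x +ᶻ c *ᶻ y -ᶻ c *ᶻ y) refl x c y

HasSum-swap : ∀ {F : ℤ² → Series} {S} → HasSum (λ (x , y) → F (y , x)) S → HasSum F S
HasSum-swap = HasSum-reindex (λ (x , y) → y , x) (λ { refl → refl }) (λ (x , y) → (y , x) , refl)

tri : ℕ → ℕ
tri zero = 0
tri (suc n) = suc n ℕ.+ tri n

-- T j = j (j + 1) / 2
T : ℤ → ℕ
T (+ n) = tri n
T -[1+ n ] = tri n

double-tri : ∀ n → 2 ℕ.* tri n ≡ n ℕ.* n ℕ.+ n
double-tri zero = refl
double-tri (suc n) = trans (ℕₚ.*-distribˡ-+ 2 (suc n) (tri n)) (trans (cong (2 ℕ.* suc n ℕ.+_) (double-tri n))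
  (NS.solve 1 (λ n → #ⁿ 2 *ⁿ (#ⁿ 1 +ⁿ n) +ⁿ (n *ⁿ n +ⁿ n)
    =ⁿ (#ⁿ 1 +ⁿ n) *ⁿ (#ⁿ 1 +ⁿ n) +ⁿ (#ⁿ 1 +ⁿ n)) refl n))

double-tri-ℤ : ∀ n → + 2 * + tri n ≡ + n * + n + + n
double-tri-ℤ n = trans (sym (ℤₚ.pos-* 2 (tri n))) (trans (cong +_ (double-tri n))
  (trans (ℤₚ.pos-+ (n ℕ.* n) n) (cong (_+ + n) (ℤₚ.pos-* n n))))

double-T : ∀ j → + 2 * + T j ≡ j * j + j
double-T (+ n) = double-tri-ℤ n
double-T -[1+ n ] = trans (double-tri-ℤ n)
  (trans (ZS.solve 1 (λ n → n *ᶻ n +ᶻ n =ᶻ (-ᶻ (#ᶻ 1 +ᶻ n)) *ᶻ (-ᶻ (#ᶻ 1 +ᶻ n)) +ᶻ (-ᶻ (#ᶻ 1 +ᶻ n))) refl (+ n))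
  refl)

double-injective : ∀ {x y} → + 2 * x ≡ + 2 * y → x ≡ y
double-injective {x} {y} = ℤₚ.*-cancelˡ-≡ (+ 2) x y

-- c^j for c = ±1
pw : ℤ → ℤ → ℤ
pw c j = c ^ ∣ j ∣

pw-1 : ∀ j → pw (+ 1) j ≡ + 1
pw-1 j = ℤₚ.^-zeroˡ ∣ j ∣

module _ (c : ℤ) (cc : c * c ≡ + 1) where
  pw-suc : ∀ j → pw c (+ 1 + j) ≡ c * pw c j
  pw-suc (+ n) = refl
  pw-suc -[1+ zero ] = sym (trans (cong (c *_) (ℤₚ.*-identityʳ c)) cc)
  pw-suc -[1+ suc n ] = sym (trans (sym (ℤₚ.*-assoc c c _)) (trans (cong (_* (c ^ suc n)) cc) (ℤₚ.*-identityˡ _)))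

  pw-+ℕ : ∀ i n → pw c (i + + n) ≡ pw c i * c ^ n
  pw-+ℕ i zero = trans (cong (pw c) (ℤₚ.+-identityʳ i)) (sym (ℤₚ.*-identityʳ (pw c i)))
  pw-+ℕ i (suc n) = trans (cong (pw c) (ZS.solve 2 (λ i n → i +ᶻ (#ᶻ 1 +ᶻ n) =ᶻ #ᶻ 1 +ᶻ (i +ᶻ n)) refl i (+ n)))
    (trans (pw-suc (i + + n)) (trans (cong (c *_) (pw-+ℕ i n))
    (ZS.solve 3 (λ c p q → c *ᶻ (p *ᶻ q) =ᶻ p *ᶻ (c *ᶻ q)) refl c (pw c i) (c ^ n))))

  ^-square : ∀ n → c ^ n * c ^ n ≡ + 1
  ^-square zero = refl
  ^-square (suc n) = trans (ZS.solve 2 (λ c x → (c *ᶻ x) *ᶻ (c *ᶻ x) =ᶻ (c *ᶻ c) *ᶻ (x *ᶻ x)) refl c (c ^ n))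
    (trans (cong (_* (c ^ n * c ^ n)) cc) (trans (ℤₚ.*-identityˡ _) (^-square n)))

  -- For negative j the case of a natural shift is read backwards, which costs a factor c^(2n+2) =
  -- 1.
  pw-+ : ∀ i j → pw c (i + j) ≡ pw c i * pw c j
  pw-+ i (+ n) = pw-+ℕ i n
  pw-+ i -[1+ n ] = sym (trans (cong (_* (c ^ suc n)) i-eq)
    (trans (ℤₚ.*-assoc (pw c (i + -[1+ n ])) (c ^ suc n) (c ^ suc n))
    (trans (cong (pw c (i + -[1+ n ]) *_) (^-square (suc n))) (ℤₚ.*-identityʳ _))))
    where
    i-eq : pw c i ≡ pw c (i + -[1+ n ]) * c ^ suc n
    i-eq = trans (cong (pw c) (ZS.solve 2 (λ i n → i =ᶻ i +ᶻ -ᶻ n +ᶻ n) refl i (+ suc n))) (pw-+ℕ (i + -[1+ n ]) (suc n))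

  pw-neg : ∀ j → pw c (- j) ≡ pw c j
  pw-neg j = cong (c ^_) (ℤₚ.∣-i∣≡∣i∣ j)

  pw-double : ∀ j → pw c (+ 2 * j) ≡ + 1
  pw-double j = trans (cong (pw c) (ZS.solve 1 (λ j → #ᶻ 2 *ᶻ j =ᶻ j +ᶻ j) refl j)) (trans (pw-+ j j) (^-square ∣ j ∣))

-- Since T(-j) = j(j-1)/2, this is the exponent of a^(j(j+1)/2) b^(j(j-1)/2) at a = q^A, b = q^B.
thExp : ℕ → ℕ → ℤ → ℕ
thExp A B j = A ℕ.* T j ℕ.+ B ℕ.* T (- j)

-- The two factors c contribute c^(T j + T(-j)) = c^(j²), which is c^j for c = ±1.
thTerm : ℕ → ℕ → ℤ → ℤ → Series
thTerm A B c j = pw c j · mono (thExp A B j)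

-- Ramanujan's f(c q^A, c q^B) for c = ±1
th : ℕ → ℕ → ℤ → Series
th A B c = sumZ (thTerm A B c)

f⁺ f⁻ : ℕ → ℕ → Series
f⁺ A B = th A B (+ 1)
f⁻ A B = th A B -1ℤ

-- Doubling removes the halves: exponents are compared as integer polynomials, which the ring solver
-- can do, and `double-injective` removes the 2 afterwards.
double-thExp : ∀ A B j → + 2 * + thExp A B j ≡ + A * (j * j + j) + + B * (j * j - j)
double-thExp A B j = trans (cong (+ 2 *_) (trans (ℤₚ.pos-+ (A ℕ.* T j) (B ℕ.* T (- j))) (cong₂ _+_ (ℤₚ.pos-* A (T j)) (ℤₚ.pos-* B (T (- j))))))
  (trans (ZS.solve 4 (λ a b s t → #ᶻ 2 *ᶻ (a *ᶻ s +ᶻ b *ᶻ t) =ᶻ a *ᶻ (#ᶻ 2 *ᶻ s) +ᶻ b *ᶻ (#ᶻ 2 *ᶻ t)) refl (+ A) (+ B) (+ T j) (+ T (- j)))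
  (trans (cong₂ (λ s t → + A * s + + B * t) (double-T j) (double-T (- j)))
  (ZS.solve 3 (λ a b j → a *ᶻ (j *ᶻ j +ᶻ j) +ᶻ b *ᶻ ((-ᶻ j) *ᶻ (-ᶻ j) +ᶻ (-ᶻ j))
     =ᶻ a *ᶻ (j *ᶻ j +ᶻ j) +ᶻ b *ᶻ (j *ᶻ j -ᶻ j)) refl (+ A) (+ B) j)))

·mono-vanish : ∀ c {e m} → m ℕ.< e → (c · mono e) m ≡ + 0
·mono-vanish c m<e = trans (cong (c *_) (mono-off (ℕₚ.<⇒≢ m<e))) (ℤₚ.*-zeroʳ c)

n≤tri : ∀ n → n ℕ.≤ tri n
n≤tri zero = z≤n
n≤tri (suc n) = ℕₚ.m≤m+n (suc n) (tri n)

-- The convergence of the theta series: only |j| ≤ n reaches degree n. The A-part suffices for j ≥ 0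
-- and the B-part for j < 0.
∣∣≤thExp : ∀ A B .{{_ : NonZero A}} .{{_ : NonZero B}} j → ∣ j ∣ ℕ.≤ thExp A B j
∣∣≤thExp A B (+ n) = ℕₚ.≤-trans (ℕₚ.≤-trans (n≤tri n) (ℕₚ.m≤n*m (tri n) A)) (ℕₚ.m≤m+n _ _)
∣∣≤thExp A B -[1+ n ] = ℕₚ.≤-trans (ℕₚ.≤-trans (n≤tri (suc n)) (ℕₚ.m≤n*m (tri (suc n)) B)) (ℕₚ.m≤n+m _ (A ℕ.* tri n))

HasSum-th : ∀ A B .{{_ : NonZero A}} .{{_ : NonZero B}} c → HasSum (thTerm A B c) (th A B c)
HasSum-th A B c = HasSum-ℤ λ j m m<j → ·mono-vanish (pw c j) (ℕₚ.<-≤-trans m<j (∣∣≤thExp A B j))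

dil-·mono : ∀ k .{{_ : NonZero k}} c e → dil k (c · mono e) ≈ c · mono (k ℕ.* e)
dil-·mono k c e = ≈-trans (CL.scale (dil-clinear k) c (mono e)) (·-cong c (dil-mono k e))

alt-·mono : ∀ c e → alt (c · mono e) ≈ ((-1ℤ ^ e) * c) · mono e
alt-·mono c e = ≈-trans (CL.scale alt-clinear c (mono e)) (≈-trans (·-cong c (alt-mono e))
  (mk≈ λ n → ZS.solve 3 (λ c a m → c *ᶻ (a *ᶻ m) =ᶻ a *ᶻ c *ᶻ m) refl c (-1ℤ ^ e) (mono e n)))

dil-th : ∀ k A B .{{_ : NonZero k}} .{{_ : NonZero A}} .{{_ : NonZero B}} c → dil k (th A B c) ≈ th (k ℕ.* A) (k ℕ.* B) c
dil-th k A B c = HasSum-unique (HasSum-clinear (dil-clinear k) (HasSum-th A B c))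
  (HasSum-cong (λ j → ≈-sym (≈-trans (dil-·mono k (pw c j) (thExp A B j)) (mk≈ λ n → cong (λ e → (pw c j · mono e) n) (lem j)))) ≈-refl
    (HasSum-th (k ℕ.* A) (k ℕ.* B) {{ℕₚ.m*n≢0 k A}} {{ℕₚ.m*n≢0 k B}} c))
  where
  lem : ∀ j → k ℕ.* thExp A B j ≡ thExp (k ℕ.* A) (k ℕ.* B) j
  lem j = NS.solve 5 (λ k a b s t → k *ⁿ (a *ⁿ s +ⁿ b *ⁿ t) =ⁿ k *ⁿ a *ⁿ s +ⁿ k *ⁿ b *ⁿ t) refl k A B (T j) (T (- j))

Sums : {I : Set} → (I → ℤ) → (I → ℕ) → Series → Set
Sums u e S = HasSum (λ i → u i · mono (e i)) S

Sums-cong : ∀ {I : Set} {u u′ : I → ℤ} {e e′ : I → ℕ} {S T} → (∀ i → u i ≡ u′ i) → (∀ i → e i ≡ e′ i) → S ≈ T →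
  Sums u e S → Sums u′ e′ T
Sums-cong p q s = HasSum-cong (λ i → mk≈ λ n → cong₂ (λ c k → (c · mono k) n) (p i) (q i)) s

abs-double : ∀ {x e} → + 2 * x ≡ + 2 * + e → e ≡ ∣ x ∣
abs-double p = sym (cong ∣_∣ (double-injective p))

·-clinear : ∀ c → CLinear (c ·_)
·-clinear c = record
  { scale = λ d f → mk≈ λ n → ZS.solve 3 (λ c d x → c *ᶻ (d *ᶻ x) =ᶻ d *ᶻ (c *ᶻ x)) refl c d (f n)
  ; add = λ f g → mk≈ λ n → ℤₚ.*-distribˡ-+ c (f n) (g n)
  ; local = λ n p m m≤n → cong (c *_) (p m m≤n) }

double-AT : ∀ A j → + 2 * + (A ℕ.* T j) ≡ + A * (j * j + j)
double-AT A j = trans (cong (+ 2 *_) (ℤₚ.pos-* A (T j)))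
  (trans (ZS.solve 2 (λ a t → #ᶻ 2 *ᶻ (a *ᶻ t) =ᶻ a *ᶻ (#ᶻ 2 *ᶻ t)) refl (+ A) (+ T j))
  (cong (+ A *_) (double-T j)))

-- The even index j = 2k has exponent A k(2k+1), which is that of the k-th term of ψ(q^A) =
-- f(q^(3A), q^A). The odd index j = -1 - 2k has the same exponent, as T(-1 - j) = T j, and sign c.
-- So the sum is 2ψ(q^A) for c = 1 and 0 for c = -1.
HasSum-tri : ∀ A .{{_ : NonZero A}} c → c * c ≡ + 1 →
  Sums (pw c) (λ j → A ℕ.* T j) (th (3 ℕ.* A) A (+ 1) ⊕ c · th (3 ℕ.* A) A (+ 1))
HasSum-tri A c cc = HasSum-cong (λ _ → ≈-refl) (⊕-congˡ ψ (R.+-identityʳ (c · ψ)))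
  (HasSum-mod₁ 2 {S = λ { Fin.zero → ψ ; (Fin.suc Fin.zero) → c · ψ }} λ where
    Fin.zero → Sums-cong (λ k → trans (pw-1 k) (sym (trans (cong (pw c) (ℤₚ.+-identityʳ (+ 2 * k))) (pw-double c cc k))))
      (λ k → ℤₚ.+-injective (double-injective (trans (double-thExp (3 ℕ.* A) A k)
         (trans (cong (λ a → a * (k * k + k) + + A * (k * k - k)) (ℤₚ.pos-* 3 A))
         (trans (ZS.solve 2 (λ a k → #ᶻ 3 *ᶻ a *ᶻ (k *ᶻ k +ᶻ k) +ᶻ a *ᶻ (k *ᶻ k -ᶻ k)
             =ᶻ a *ᶻ ((#ᶻ 2 *ᶻ k +ᶻ #ᶻ 0) *ᶻ (#ᶻ 2 *ᶻ k +ᶻ #ᶻ 0) +ᶻ (#ᶻ 2 *ᶻ k +ᶻ #ᶻ 0))) refl (+ A) k)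
           (sym (double-AT A (+ 2 * k + + 0))))))))
      ≈-refl ψsum
    (Fin.suc Fin.zero) → HasSum-neg (- + 1) (HasSum-cong (λ k → mk≈ λ n → trans (sym (ℤₚ.*-assoc c (pw (+ 1) k) _))
        (cong₂ (λ x e → (x · mono e) n)
          (trans (cong (c *_) (pw-1 k)) (trans (ℤₚ.*-identityʳ c) (sym (odd k))))
          (ℤₚ.+-injective (double-injective (trans (double-thExp (3 ℕ.* A) A k)
         (trans (cong (λ a → a * (k * k + k) + + A * (k * k - k)) (ℤₚ.pos-* 3 A))
         (trans (ZS.solve 2 (λ a k → #ᶻ 3 *ᶻ a *ᶻ (k *ᶻ k +ᶻ k) +ᶻ a *ᶻ (k *ᶻ k -ᶻ k)
             =ᶻ a *ᶻ ((#ᶻ 2 *ᶻ (ZS.con (- + 1) -ᶻ k) +ᶻ #ᶻ 1) *ᶻ (#ᶻ 2 *ᶻ (ZS.con (- + 1) -ᶻ k) +ᶻ #ᶻ 1) +ᶻ (#ᶻ 2 *ᶻ (ZS.con (- + 1) -ᶻ k) +ᶻ #ᶻ 1))) refl (+ A) k)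
           (sym (double-AT A (+ 2 * (- + 1 - k) + + 1))))))))))
      ≈-refl (HasSum-clinear (·-clinear c) ψsum)))
  where
  ψ = th (3 ℕ.* A) A (+ 1)
  ψsum : HasSum (thTerm (3 ℕ.* A) A (+ 1)) ψ
  ψsum = HasSum-th (3 ℕ.* A) A {{ℕₚ.m*n≢0 3 A}} (+ 1)
  odd : ∀ k → pw c (+ 2 * (- + 1 - k) + + 1) ≡ c
  odd k = trans (pw-+ c cc (+ 2 * (- + 1 - k)) (+ 1))
    (trans (cong₂ _*_ (pw-double c cc (- + 1 - k)) (ℤₚ.*-identityʳ c)) (ℤₚ.*-identityˡ c))

-- Infinite products

agree-trans : ∀ {n f g h} → Agree n f g → Agree n g h → Agree n f h
agree-trans p q m m≤n = trans (p m m≤n) (q m m≤n)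

agree-sym : ∀ {n f g} → Agree n f g → Agree n g f
agree-sym p m m≤n = sym (p m m≤n)

≈⇒agree : ∀ {n f g} → f ≈ g → Agree n f g
≈⇒agree p m _ = at p m

agree⇒≈ : ∀ {f g} → (∀ n → Agree n f g) → f ≈ g
agree⇒≈ p = mk≈ λ n → p n n ℕₚ.≤-refl

agree-mono : ∀ {m n f g} → m ℕ.≤ n → Agree n f g → Agree m f g
agree-mono m≤n p k k≤m = p k (ℕₚ.≤-trans k≤m m≤n)

agree-⊛ : ∀ {n f f′ g g′} → Agree n f f′ → Agree n g g′ → Agree n (f ⊛ g) (f′ ⊛ g′)
agree-⊛ p q m m≤n = ⊛-cong≤ m (agree-mono m≤n p) (agree-mono m≤n q)

prodTo-cong : ∀ N {F G : ℕ → Series} → (∀ i → F i ≈ G i) → prodTo N F ≈ prodTo N G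
prodTo-cong zero p = ≈-refl
prodTo-cong (suc N) p = ⊛-cong (prodTo-cong N p) (p N)

prodTo-⊛ : ∀ N (F G : ℕ → Series) → prodTo N (λ i → F i ⊛ G i) ≈ prodTo N F ⊛ prodTo N G
prodTo-⊛ zero F G = ≈-sym (R.*-identityˡ one)
prodTo-⊛ (suc N) F G = ≈-trans (⊛-congʳ (F N ⊛ G N) (prodTo-⊛ N F G))
  (solve 4 (λ a b c d → (a :* b) :* (c :* d) := (a :* c) :* (b :* d)) ≈-refl (prodTo N F) (prodTo N G) (F N) (G N))

prodTo-+ : ∀ M N F → prodTo (M ℕ.+ N) F ≈ prodTo M F ⊛ prodTo N (λ i → F (M ℕ.+ i))
prodTo-+ M zero F = ≈-trans (mk≈ λ n → cong (λ k → prodTo k F n) (ℕₚ.+-identityʳ M)) (≈-sym (R.*-identityʳ (prodTo M F)))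
prodTo-+ M (suc N) F = begin
  prodTo (M ℕ.+ suc N) F ≡⟨ cong (λ k → prodTo k F) (ℕₚ.+-suc M N) ⟩
  prodTo (M ℕ.+ N) F ⊛ F (M ℕ.+ N) ≈⟨ ⊛-congʳ (F (M ℕ.+ N)) (prodTo-+ M N F) ⟩
  prodTo M F ⊛ prodTo N (λ i → F (M ℕ.+ i)) ⊛ F (M ℕ.+ N) ≈⟨ R.*-assoc (prodTo M F) (prodTo N (λ i → F (M ℕ.+ i))) (F (M ℕ.+ N)) ⟩
  prodTo M F ⊛ (prodTo N (λ i → F (M ℕ.+ i)) ⊛ F (M ℕ.+ N)) ∎

-- The infinite product of F; it converges when the i-th factor is 1 + O(q^{i+1}).
∏ : (ℕ → Series) → Series
∏ F n = prodTo (suc n) F n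

Tame : (ℕ → Series) → Set
Tame F = ∀ i → Agree i (F i) one

prodTo-stable : ∀ {F} → Tame F → ∀ N k → Agree N (prodTo (k ℕ.+ N) F) (prodTo N F)
prodTo-stable t N zero = λ _ _ → refl
prodTo-stable {F} t N (suc k) = agree-trans (agree-⊛ (prodTo-stable t N k) (agree-mono (ℕₚ.m≤n+m N k) (t (k ℕ.+ N))))
  (≈⇒agree (R.*-identityʳ (prodTo N F)))

∏-agree : ∀ {F} → Tame F → ∀ N → Agree N (∏ F) (prodTo N F)
∏-agree {F} t N m m≤N = trans (prodTo-stable t m 1 m ℕₚ.≤-refl)
  (sym (trans (cong (λ k → prodTo k F m) (sym (ℕₚ.m∸n+n≡m m≤N))) (prodTo-stable t m (N ℕ.∸ m) m ℕₚ.≤-refl)))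

∏-cong : ∀ {F G} → (∀ i → F i ≈ G i) → ∏ F ≈ ∏ G
∏-cong p = mk≈ λ n → at (prodTo-cong (suc n) p) n

tame-⊛ : ∀ {F G} → Tame F → Tame G → Tame (λ i → F i ⊛ G i)
tame-⊛ s t i = agree-trans (agree-⊛ (s i) (t i)) (≈⇒agree (R.*-identityˡ one))

∏-⊛ : ∀ {F G} → Tame F → Tame G → ∏ F ⊛ ∏ G ≈ ∏ (λ i → F i ⊛ G i)
∏-⊛ {F} {G} s t = agree⇒≈ λ N → agree-trans (agree-⊛ (∏-agree s N) (∏-agree t N))
  (agree-trans (agree-sym (≈⇒agree (prodTo-⊛ N F G))) (agree-sym (∏-agree (tame-⊛ s t) N)))

prodTo-blocks : ∀ c N F → prodTo (N ℕ.* c) F ≈ prodTo N (λ i → prodTo c (λ r → F (i ℕ.* c ℕ.+ r)))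
prodTo-blocks c zero F = ≈-refl
prodTo-blocks c (suc N) F = begin
  prodTo (c ℕ.+ N ℕ.* c) F ≡⟨ cong (λ k → prodTo k F) (ℕₚ.+-comm c (N ℕ.* c)) ⟩
  prodTo (N ℕ.* c ℕ.+ c) F ≈⟨ prodTo-+ (N ℕ.* c) c F ⟩
  prodTo (N ℕ.* c) F ⊛ prodTo c (λ r → F (N ℕ.* c ℕ.+ r)) ≈⟨ ⊛-congʳ (prodTo c (λ r → F (N ℕ.* c ℕ.+ r))) (prodTo-blocks c N F) ⟩
  prodTo N (λ i → prodTo c (λ r → F (i ℕ.* c ℕ.+ r))) ⊛ prodTo c (λ r → F (N ℕ.* c ℕ.+ r)) ∎

tame-block : ∀ c .{{_ : NonZero c}} {F} → Tame F → ∀ N → Tame (λ i → prodTo N (λ r → F (i ℕ.* c ℕ.+ r)))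
tame-block c t zero i = λ _ _ → refl
tame-block c t (suc N) i = agree-trans (agree-⊛ (tame-block c t N i)
  (agree-mono (ℕₚ.≤-trans (ℕₚ.m≤m*n i c) (ℕₚ.m≤m+n (i ℕ.* c) N)) (t (i ℕ.* c ℕ.+ N)))) (≈⇒agree (R.*-identityˡ one))

-- Up to degree N, both infinite products may be cut off, after N·c factors and after N blocks of c
-- factors respectively.
∏-blocks : ∀ c .{{_ : NonZero c}} {F} → Tame F → ∏ F ≈ ∏ (λ i → prodTo c (λ r → F (i ℕ.* c ℕ.+ r)))
∏-blocks c {F} t = agree⇒≈ λ N → agree-trans (agree-mono (ℕₚ.m≤m*n N c) (∏-agree t (N ℕ.* c)))
  (agree-trans (≈⇒agree (prodTo-blocks c N F)) (agree-sym (∏-agree (tame-block c t c) N)))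

module _ {Φ} (φ : CLinear Φ) (φ-one : Φ one ≈ one) (φ-⊛ : ∀ f g → Φ (f ⊛ g) ≈ Φ f ⊛ Φ g) where
  prodTo-hom : ∀ N F → Φ (prodTo N F) ≈ prodTo N (λ i → Φ (F i))
  prodTo-hom zero F = φ-one
  prodTo-hom (suc N) F = ≈-trans (φ-⊛ (prodTo N F) (F N)) (⊛-congʳ (Φ (F N)) (prodTo-hom N F))

  -- A continuous ring homomorphism passes through the limit; it is applied to dilations and to q ↦
  -- -q.
  ∏-hom : ∀ {F} → Tame F → Φ (∏ F) ≈ ∏ (λ i → Φ (F i))
  ∏-hom {F} t = agree⇒≈ λ N → agree-trans (CL.local φ N (∏-agree t N))
    (agree-trans (≈⇒agree (prodTo-hom N F)) (agree-sym (∏-agree (λ i → agree-trans (CL.local φ i (t i)) (≈⇒agree φ-one)) N)))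

-- Infinite q-Pochhammer products with a sign

factor : ℤ → ℕ → Series
factor c e = one ⊕ c · mono e

-- (-c q^a; q^d)_∞
poch : ℤ → ℕ → ℕ → Series
poch c a d = ∏ (λ i → factor c (a ℕ.+ d ℕ.* i))

factor-agree : ∀ c e i → i ℕ.< e → Agree i (factor c e) one
factor-agree c e i i<e m m≤i = trans (cong (λ x → one m + c * x) (mono-off (ℕₚ.<⇒≢ (ℕₚ.≤-<-trans m≤i i<e))))
  (trans (cong (λ x → one m + x) (ℤₚ.*-zeroʳ c)) (ℤₚ.+-identityʳ (one m)))

tame-poch : ∀ c a d .{{_ : NonZero a}} .{{_ : NonZero d}} → Tame (λ i → factor c (a ℕ.+ d ℕ.* i))
tame-poch c a d i = factor-agree c (a ℕ.+ d ℕ.* i) i (ℕₚ.+-mono-≤ (ℕ.>-nonZero⁻¹ a) (ℕₚ.m≤n*m i d))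

poch-0 : ∀ c a d .{{_ : NonZero a}} .{{_ : NonZero d}} → poch c a d 0 ≡ + 1
poch-0 c a d = ∏-agree (tame-poch c a d) 0 0 z≤n

dil-factor : ∀ k .{{_ : NonZero k}} c e → dil k (factor c e) ≈ factor c (k ℕ.* e)
dil-factor k c e = ≈-trans (CL.add (dil-clinear k) one (c · mono e))
  (⊕-cong (dil-one k) (≈-trans (CL.scale (dil-clinear k) c (mono e)) (·-cong c (dil-mono k e))))

factor-cong : ∀ c {e e′} → e ≡ e′ → factor c e ≈ factor c e′
factor-cong c refl = ≈-refl

dil-poch : ∀ k .{{_ : NonZero k}} c a d .{{_ : NonZero a}} .{{_ : NonZero d}} → dil k (poch c a d) ≈ poch c (k ℕ.* a) (k ℕ.* d)
dil-poch k c a d = ≈-trans (∏-hom (dil-clinear k) (dil-one k) (dil-⊛ k) (tame-poch c a d))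
  (∏-cong λ i → ≈-trans (dil-factor k c (a ℕ.+ d ℕ.* i)) (factor-cong c
    (NS.solve 4 (λ k a d i → k *ⁿ (a +ⁿ d *ⁿ i) =ⁿ k *ⁿ a +ⁿ k *ⁿ d *ⁿ i) refl k a d i)))

-- Factor by factor, (1 + x)(1 - x) = 1 - x². This is the only source of plus signs in the product
-- identities.
poch-pair : ∀ a d .{{_ : NonZero a}} .{{_ : NonZero d}} → poch (+ 1) a d ⊛ poch -1ℤ a d ≈ poch -1ℤ (2 ℕ.* a) (2 ℕ.* d)
poch-pair a d = ≈-trans (∏-⊛ (tame-poch (+ 1) a d) (tame-poch -1ℤ a d)) (∏-cong λ i → begin
  factor (+ 1) (e i) ⊛ factor -1ℤ (e i) ≈⟨ ⊛-cong (⊕-congˡ one (·≈const (+ 1) (mono (e i)))) (⊕-congˡ one (·≈const -1ℤ (mono (e i)))) ⟩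
  (one ⊕ const (+ 1) ⊛ mono (e i)) ⊛ (one ⊕ const -1ℤ ⊛ mono (e i))
    ≈⟨ solve 1 (λ x → (con (+ 1) :+ con (+ 1) :* x) :* (con (+ 1) :+ con -1ℤ :* x) := con (+ 1) :+ con -1ℤ :* (x :* x)) ≈-refl (mono (e i)) ⟩
  one ⊕ const -1ℤ ⊛ (mono (e i) ⊛ mono (e i)) ≈⟨ ⊕-congˡ one (≈-trans (⊛-congˡ (const -1ℤ) (mono-⊛ (e i) (e i))) (≈-sym (·≈const -1ℤ (mono (e i ℕ.+ e i))))) ⟩
  factor -1ℤ (e i ℕ.+ e i) ≈⟨ factor-cong -1ℤ (NS.solve 3 (λ a d i → (a +ⁿ d *ⁿ i) +ⁿ (a +ⁿ d *ⁿ i) =ⁿ #ⁿ 2 *ⁿ a +ⁿ #ⁿ 2 *ⁿ d *ⁿ i) refl a d i) ⟩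
  factor -1ℤ (2 ℕ.* a ℕ.+ 2 ℕ.* d ℕ.* i) ∎)
  where
  e : ℕ → ℕ
  e i = a ℕ.+ d ℕ.* i

poch-split-tail : ∀ c a d n .{{_ : NonZero a}} .{{_ : NonZero d}} → ∀ N →
  ∏ (λ i → prodTo N (λ r → factor c ((a ℕ.+ d ℕ.* r) ℕ.+ (d ℕ.* suc n) ℕ.* i))) ≈ prodTo N (λ r → poch c (a ℕ.+ d ℕ.* r) (d ℕ.* suc n))
poch-split-tail c a d n zero = agree⇒≈ λ N → agree-trans (∏-agree (λ _ _ _ → refl) N) (≈⇒agree (ones N))
  where
  ones : ∀ N → prodTo N (λ _ → one) ≈ one
  ones zero = ≈-refl
  ones (suc N) = ≈-trans (R.*-identityʳ (prodTo N (λ _ → one))) (ones N)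
poch-split-tail c a d n (suc N) = ≈-trans (≈-sym (∏-⊛ (tame N) (tame-poch c (a ℕ.+ d ℕ.* N) (d ℕ.* suc n) {{nz N}} {{ℕₚ.m*n≢0 d (suc n)}})))
  (⊛-congʳ (poch c (a ℕ.+ d ℕ.* N) (d ℕ.* suc n)) (poch-split-tail c a d n N))
  where
  nz : ∀ r → NonZero (a ℕ.+ d ℕ.* r)
  nz r = ℕ.>-nonZero (ℕₚ.≤-trans (ℕ.>-nonZero⁻¹ a) (ℕₚ.m≤m+n a (d ℕ.* r)))
  tame : ∀ N → Tame (λ i → prodTo N (λ r → factor c ((a ℕ.+ d ℕ.* r) ℕ.+ (d ℕ.* suc n) ℕ.* i)))
  tame zero i = λ _ _ → refl
  tame (suc N) i = agree-trans (agree-⊛ (tame N i) (tame-poch c (a ℕ.+ d ℕ.* N) (d ℕ.* suc n) {{nz N}} {{ℕₚ.m*n≢0 d (suc n)}} i)) (≈⇒agree (R.*-identityˡ one))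

-- Blocks of n+1 consecutive factors contain each residue of the index modulo n+1 once; collecting
-- the r-th factors of all blocks gives the r-th product.
poch-split : ∀ c a d n .{{_ : NonZero a}} .{{_ : NonZero d}} →
  poch c a d ≈ prodTo (suc n) (λ r → poch c (a ℕ.+ d ℕ.* r) (d ℕ.* suc n))
poch-split c a d n = ≈-trans (∏-blocks (suc n) (tame-poch c a d)) (≈-trans
  (∏-cong λ i → prodTo-cong (suc n) λ r → factor-cong c
    (NS.solve 5 (λ a d i n r → a +ⁿ d *ⁿ (i *ⁿ n +ⁿ r) =ⁿ a +ⁿ d *ⁿ r +ⁿ d *ⁿ n *ⁿ i) refl a d i (suc n) r))
  (poch-split-tail c a d n (suc n)))

alt-one : alt one ≈ one
alt-one = mk≈ λ { zero → refl ; (suc n) → ℤₚ.*-zeroʳ (-1ℤ ^ suc n) }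

alt-factor : ∀ c e → alt (factor c e) ≈ factor ((-1ℤ ^ e) * c) e
alt-factor c e = ≈-trans (CL.add alt-clinear one (c · mono e))
  (⊕-cong alt-one (≈-trans (CL.scale alt-clinear c (mono e)) (≈-trans (·-cong c (alt-mono e))
    (mk≈ λ n → ZS.solve 3 (λ c a m → c *ᶻ (a *ᶻ m) =ᶻ a *ᶻ c *ᶻ m) refl c (-1ℤ ^ e) (mono e n)))))

-- For even d all exponents a + d i have the parity of a, so q ↦ -q changes the sign in every factor
-- or in none.
alt-poch : ∀ c a d .{{_ : NonZero a}} .{{_ : NonZero d}} → -1ℤ ^ d ≡ + 1 → alt (poch c a d) ≈ poch ((-1ℤ ^ a) * c) a d
alt-poch c a d even = ≈-trans (∏-hom alt-clinear alt-one alt-⊛ (tame-poch c a d)) (∏-cong λ i →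
  ≈-trans (alt-factor c (a ℕ.+ d ℕ.* i)) (mk≈ λ n → cong (λ s → factor (s * c) (a ℕ.+ d ℕ.* i) n)
    (trans (ℤₚ.^-distribˡ-+-* -1ℤ a (d ℕ.* i)) (trans (cong (-1ℤ ^ a *_)
      (trans (sym (ℤₚ.^-*-assoc -1ℤ d i)) (trans (cong (_^ i) even) (ℤₚ.^-zeroˡ i)))) (ℤₚ.*-identityʳ (-1ℤ ^ a))))))

-- The Rogers–Ramanujan identities

mono-cong : ∀ {a b} → a ≡ b → mono a ≈ mono b
mono-cong refl = ≈-refl

vanish-⊛ : ∀ {n f} g → Agree n f 𝟘 → Agree n (f ⊛ g) 𝟘
vanish-⊛ {n} g p m m≤n = trans (CL.local (clinear-⊛ʳ g) n p m m≤n) (at (R.zeroˡ g) m)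

·mono-agree : ∀ c {e n} → n ℕ.< e → Agree n (c · mono e) 𝟘
·mono-agree c n<e m m≤n = ·mono-vanish c (ℕₚ.≤-<-trans m≤n n<e)

mono-agree : ∀ {e n} → n ℕ.< e → Agree n (mono e) 𝟘
mono-agree n<e m m≤n = mono-off (ℕₚ.<⇒≢ (ℕₚ.≤-<-trans m≤n n<e))

sumN-cong : ∀ {F G : ℕ → Series} → (∀ i → F i ≈ G i) → sumN F ≈ sumN G
sumN-cong p = mk≈ λ n → sumTo-cong n λ i → at (p i) n

sumN-⊕ : ∀ F G → sumN (λ i → F i ⊕ G i) ≈ sumN F ⊕ sumN G
sumN-⊕ F G = mk≈ λ n → sumTo-+ n (λ i → F i n) (λ i → G i n)

Vanishing : (ℕ → Series) → Set
Vanishing F = ∀ i m → m ℕ.< i → F i m ≡ + 0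

sumN-shift : ∀ F → Vanishing F → sumN F ≈ F 0 ⊕ sumN (λ i → F (suc i))
sumN-shift F v = mk≈ λ n → trans
  (sym (trans (cong (λ x → sumTo n (λ i → F i n) + x) (v (suc n) n ℕₚ.≤-refl)) (ℤₚ.+-identityʳ (sumN F n))))
  (sumTo-head n (λ i → F i n))

sumN-⊛ : ∀ f F → Vanishing F → f ⊛ sumN F ≈ sumN (λ i → f ⊛ F i)
sumN-⊛ f F v = HasSum-unique (HasSum-clinear (clinear-⊛ˡ f) (HasSum-ℕ v))
  (HasSum-ℕ λ i m m<i → trans (CL.local (clinear-⊛ˡ f) m {F i} {𝟘} (λ k k≤m → v i k (ℕₚ.≤-<-trans k≤m m<i)) m ℕₚ.≤-refl) (at (R.zeroʳ f) m))

-- As Y 0 = 0, the summands Y may be moved down by one index, so that each X n meets Y (n+1) instead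
-- of Y n.
sumN-telescope : ∀ {t t′} X Y → Vanishing Y → (∀ n → t n ≈ X n ⊕ Y n) → Y 0 ≈ 𝟘 → (∀ n → X n ⊕ Y (suc n) ≈ t′ n) →
  sumN t ≈ sumN t′
sumN-telescope {t} {t′} X Y v p y0 q = begin
  sumN t ≈⟨ sumN-cong p ⟩
  sumN (λ n → X n ⊕ Y n) ≈⟨ sumN-⊕ X Y ⟩
  sumN X ⊕ sumN Y ≈⟨ ⊕-congˡ (sumN X) (≈-trans (sumN-shift Y v) (≈-trans (⊕-congʳ (sumN (λ n → Y (suc n))) y0) (R.+-identityˡ (sumN (λ n → Y (suc n)))))) ⟩
  sumN X ⊕ sumN (λ n → Y (suc n)) ≈⟨ sumN-⊕ X (λ n → Y (suc n)) ⟨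
  sumN (λ n → X n ⊕ Y (suc n)) ≈⟨ sumN-cong q ⟩
  sumN t′ ∎

-- The q-difference equation of the Rogers-Ramanujan sums

q : Series
q = mono 1

mono-sucʳ : ∀ n → mono (suc n) ≈ mono n ⊛ q
mono-sucʳ n = ≈-sym (≈-trans (mono-⊛ n 1) (mono-cong (ℕₚ.+-comm n 1)))

mono-n⊖ : one ⊖ mono 0 ≈ 𝟘
mono-n⊖ = ≈-trans (⊕-congˡ one (⊝-cong mono-0)) (R.-‿inverseʳ one)

-- The equation F(z) = F(zq) + zq F(zq²) along z = q^k, with X k in the place of F(q^k).
FibRec : (ℕ → Series) → Set
FibRec X = ∀ k → X k ≈ X (suc k) ⊕ mono (suc k) ⊛ X (suc (suc k))

mono-suc-⊛-vanish : ∀ e f n → (∀ m → m ℕ.< n → f m ≡ + 0) → (mono (suc e) ⊛ f) n ≡ + 0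
mono-suc-⊛-vanish e f zero v = refl
mono-suc-⊛-vanish e f (suc n) v = trans (⊛-sucˡ (mono (suc e)) f n) (trans (ℤₚ.+-identityˡ _)
  (trans (CL.local (clinear-⊛ˡ (tail (mono (suc e)))) n {f} {𝟘} (λ m m≤n → v m (s≤s m≤n)) n ℕₚ.≤-refl) (at (R.zeroʳ (tail (mono (suc e)))) n)))

-- Induction on the degree n. The term with q^(k+1) involves only coefficients below n, which are
-- already zero; hence D k, D (k+1), ..., D (k+n) share their coefficient of q^n, and for the last
-- of them it is zero by smallness.
fibRec-vanish : ∀ D → FibRec D → (∀ k → Agree k (D k) 𝟘) → ∀ k → D k ≈ 𝟘
fibRec-vanish D rec small k = mk≈ λ n → below (suc n) k n ℕₚ.≤-refl
  where
  below : ∀ n k m → m ℕ.< n → D k m ≡ + 0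
  climb : ∀ n j k → D k n ≡ D (j ℕ.+ k) n
  below (suc n) k m m≤n with m ℕ.≟ n
  ... | no p = below n k m (ℕₚ.≤∧≢⇒< (ℕₚ.≤-pred m≤n) p)
  ... | yes refl = trans (climb m m k) (small (m ℕ.+ k) m (ℕₚ.m≤m+n m k))
  climb n zero k = refl
  climb n (suc j) k = trans (climb n j k) (trans (at (rec (j ℕ.+ k)) n)
    (trans (cong (λ x → D (suc (j ℕ.+ k)) n + x) (mono-suc-⊛-vanish (j ℕ.+ k) (D (suc (suc (j ℕ.+ k)))) n (below n (suc (suc (j ℕ.+ k))))))
      (ℤₚ.+-identityʳ _)))

fibRec-unique : ∀ X Y → FibRec X → FibRec Y → (∀ k → Agree k (X k) (Y k)) → ∀ k → X k ≈ Y k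
fibRec-unique X Y x y p k = ⊖≈𝟘⇒≈ (fibRec-vanish (λ k → X k ⊖ Y k)
  (λ k → ≈-trans (⊕-cong (x k) (⊝-cong (y k)))
     (solve 5 (λ a b c d m → (a :+ m :* b) :- (c :+ m :* d) := (a :- c) :+ m :* (b :- d)) ≈-refl (X (suc k)) (X (suc (suc k))) (Y (suc k)) (Y (suc (suc k))) (mono (suc k))))
  (λ k m m≤k → trans (cong (_- Y k m) (p k m m≤k)) (ℤₚ.+-inverseʳ (Y k m))) k)

-- The summand of Σ z^n q^(n²) / (q;q)_n at z = q^k; k = 0 gives `G` and k = 1 gives `H`.
gTerm : ℕ → ℕ → Series
gTerm k n = mono (n ℕ.* n ℕ.+ k ℕ.* n) ⊛ inv (qpoch n)

Gₖ : ℕ → Series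
Gₖ k = sumN (gTerm k)

G≈G₀ : G ≈ Gₖ 0
G≈G₀ = mk≈ λ m → sumTo-cong m λ n → at (≈-trans (shift≈⊛ (n ℕ.* n) (inv (qpoch n)))
  (⊛-congʳ (inv (qpoch n)) (mono-cong (sym (ℕₚ.+-identityʳ (n ℕ.* n)))))) m

H≈G₁ : H ≈ Gₖ 1
H≈G₁ = mk≈ λ m → sumTo-cong m λ n → at (≈-trans (shift≈⊛ (n ℕ.* n ℕ.+ n) (inv (qpoch n)))
  (⊛-congʳ (inv (qpoch n)) (mono-cong (cong (n ℕ.* n ℕ.+_) (sym (ℕₚ.+-identityʳ n)))))) m

qpoch-0 : ∀ n → qpoch n 0 ≡ + 1
qpoch-0 zero = refl
qpoch-0 (suc n) = cong (_* + 1) (qpoch-0 n)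

unit≢0 : ∀ {x} → x ≡ + 1 → x ≢ + 0
unit≢0 refl ()

inv-qpoch-suc : ∀ n → (one ⊖ mono (suc n)) ⊛ inv (qpoch (suc n)) ≈ inv (qpoch n)
inv-qpoch-suc n = ⊛-cancelˡ (qpoch n) (unit≢0 (qpoch-0 n)) (begin
  qpoch n ⊛ ((one ⊖ mono (suc n)) ⊛ inv (qpoch (suc n))) ≈⟨ R.*-assoc (qpoch n) (one ⊖ mono (suc n)) (inv (qpoch (suc n))) ⟨
  qpoch (suc n) ⊛ inv (qpoch (suc n)) ≈⟨ ⊛-inv (qpoch (suc n)) (qpoch-0 (suc n)) ⟩
  one ≈⟨ ⊛-inv (qpoch n) (qpoch-0 n) ⟨
  qpoch n ⊛ inv (qpoch n) ∎)

gTerm-vanish : ∀ k → Vanishing (gTerm k)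
gTerm-vanish k i m m<i = vanish-⊛ (inv (qpoch i)) (mono-agree (ℕₚ.<-≤-trans m<i (ℕₚ.≤-trans (n≤n² i) (ℕₚ.m≤m+n _ _)))) m ℕₚ.≤-refl
  where
  n≤n² : ∀ n → n ℕ.≤ n ℕ.* n
  n≤n² zero = z≤n
  n≤n² (suc n) = ℕₚ.m≤m+n (suc n) (n ℕ.* suc n)

-- Split z^n = z^n q^n + z^n (1 - q^n). In the second part 1 - q^n cancels the last factor of
-- (q;q)_n, and lowering n by one pulls out zq and leaves the sum at zq².
Gₖ-rec : FibRec Gₖ
Gₖ-rec k = begin
  sumN (gTerm k) ≈⟨ sumN-cong split ⟩
  sumN (λ n → gTerm (suc k) n ⊕ Z n) ≈⟨ sumN-⊕ (gTerm (suc k)) Z ⟩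
  Gₖ (suc k) ⊕ sumN Z ≈⟨ ⊕-congˡ (Gₖ (suc k)) (begin
    sumN Z ≈⟨ sumN-shift Z Z-vanish ⟩
    Z 0 ⊕ sumN (λ n → Z (suc n)) ≈⟨ ⊕-cong (≈-trans (⊛-congˡ (mono (k ℕ.* 0)) (≈-trans (⊛-congʳ (inv one) mono-n⊖) (R.zeroˡ (inv one)))) (R.zeroʳ (mono (k ℕ.* 0)))) (sumN-cong Z-suc) ⟩
    𝟘 ⊕ sumN (λ n → mono (suc k) ⊛ gTerm (suc (suc k)) n) ≈⟨ R.+-identityˡ (sumN (λ n → mono (suc k) ⊛ gTerm (suc (suc k)) n)) ⟩
    sumN (λ n → mono (suc k) ⊛ gTerm (suc (suc k)) n) ≈⟨ sumN-⊛ (mono (suc k)) (gTerm (suc (suc k))) (gTerm-vanish (suc (suc k))) ⟨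
    mono (suc k) ⊛ Gₖ (suc (suc k)) ∎) ⟩
  Gₖ (suc k) ⊕ mono (suc k) ⊛ Gₖ (suc (suc k)) ∎
  where
  Z : ℕ → Series
  Z n = mono (n ℕ.* n ℕ.+ k ℕ.* n) ⊛ ((one ⊖ mono n) ⊛ inv (qpoch n))
  e-suc : ∀ n → n ℕ.* n ℕ.+ suc k ℕ.* n ≡ (n ℕ.* n ℕ.+ k ℕ.* n) ℕ.+ n
  e-suc n = NS.solve 2 (λ n k → n *ⁿ n +ⁿ (#ⁿ 1 +ⁿ k) *ⁿ n =ⁿ (n *ⁿ n +ⁿ k *ⁿ n) +ⁿ n) refl n k
  split : ∀ n → gTerm k n ≈ gTerm (suc k) n ⊕ Z n
  split n = begin
    mono e ⊛ i ≈⟨ solve 3 (λ e n i → e :* i := (e :* n) :* i :+ e :* ((con (+ 1) :- n) :* i)) ≈-refl (mono e) (mono n) i ⟩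
    (mono e ⊛ mono n) ⊛ i ⊕ Z n ≈⟨ ⊕-congʳ (Z n) (⊛-congʳ i (≈-trans (mono-⊛ e n) (mono-cong (sym (e-suc n))))) ⟩
    gTerm (suc k) n ⊕ Z n ∎
    where
    e = n ℕ.* n ℕ.+ k ℕ.* n
    i = inv (qpoch n)
  Z-vanish : Vanishing Z
  Z-vanish i m m<i = trans (at (solve 3 (λ e x y → e :* (x :* y) := (e :* y) :* x) ≈-refl (mono (i ℕ.* i ℕ.+ k ℕ.* i)) (one ⊖ mono i) (inv (qpoch i))) m)
    (vanish-⊛ (one ⊖ mono i) (λ k′ k′≤m → gTerm-vanish k i k′ (ℕₚ.≤-<-trans k′≤m m<i)) m ℕₚ.≤-refl)
  Z-suc : ∀ n → Z (suc n) ≈ mono (suc k) ⊛ gTerm (suc (suc k)) n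
  Z-suc n = begin
    mono (suc n ℕ.* suc n ℕ.+ k ℕ.* suc n) ⊛ ((one ⊖ mono (suc n)) ⊛ inv (qpoch (suc n))) ≈⟨ ⊛-cong
      (≈-trans (mono-cong (NS.solve 2 (λ n k → (#ⁿ 1 +ⁿ n) *ⁿ (#ⁿ 1 +ⁿ n) +ⁿ k *ⁿ (#ⁿ 1 +ⁿ n)
        =ⁿ (#ⁿ 1 +ⁿ k) +ⁿ (n *ⁿ n +ⁿ (#ⁿ 2 +ⁿ k) *ⁿ n)) refl n k)) (≈-sym (mono-⊛ (suc k) (n ℕ.* n ℕ.+ suc (suc k) ℕ.* n))))
      (inv-qpoch-suc n) ⟩
    (mono (suc k) ⊛ mono (n ℕ.* n ℕ.+ suc (suc k) ℕ.* n)) ⊛ inv (qpoch n) ≈⟨ R.*-assoc (mono (suc k)) (mono (n ℕ.* n ℕ.+ suc (suc k) ℕ.* n)) (inv (qpoch n)) ⟩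
    mono (suc k) ⊛ gTerm (suc (suc k)) n ∎

-- n (5 n + 1) / 2
pent : ℕ → ℕ
pent zero = 0
pent (suc n) = pent n ℕ.+ (5 ℕ.* n ℕ.+ 3)

double-pent : ∀ n → 2 ℕ.* pent n ≡ 5 ℕ.* (n ℕ.* n) ℕ.+ n
double-pent zero = refl
double-pent (suc n) = trans (ℕₚ.*-distribˡ-+ 2 (pent n) (5 ℕ.* n ℕ.+ 3)) (trans (cong (ℕ._+ 2 ℕ.* (5 ℕ.* n ℕ.+ 3)) (double-pent n))
  (NS.solve 1 (λ n → #ⁿ 5 *ⁿ (n *ⁿ n) +ⁿ n +ⁿ #ⁿ 2 *ⁿ (#ⁿ 5 *ⁿ n +ⁿ #ⁿ 3)
    =ⁿ #ⁿ 5 *ⁿ ((#ⁿ 1 +ⁿ n) *ⁿ (#ⁿ 1 +ⁿ n)) +ⁿ (#ⁿ 1 +ⁿ n)) refl n))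

n≤pent : ∀ n → n ℕ.≤ pent n
n≤pent zero = z≤n
n≤pent (suc n) = subst (suc n ℕ.≤_) (ℕₚ.+-comm (5 ℕ.* n ℕ.+ 3) (pent n))
  (ℕₚ.≤-trans (ℕₚ.≤-trans (ℕₚ.≤-reflexive (ℕₚ.+-comm 1 n)) (ℕₚ.+-mono-≤ (ℕₚ.m≤n*m n 5) (s≤s z≤n))) (ℕₚ.m≤m+n (5 ℕ.* n ℕ.+ 3) (pent n)))

-- The Rogers-Selberg solution of the same equation

w : ℕ → Series
w n = (-1ℤ ^ n) · mono (pent n)

w-vanish : (Z : ℕ → Series) → Vanishing (λ n → w n ⊛ Z n)
w-vanish Z i m m<i = vanish-⊛ (Z i) (·mono-agree (-1ℤ ^ i) (ℕₚ.<-≤-trans m<i (n≤pent i))) m ℕₚ.≤-refl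

_⊙_ : ∀ {f a} → f ≈ mono a → ∀ b → f ⊛ mono b ≈ mono (a ℕ.+ b)
_⊙_ {a = a} p b = ≈-trans (⊛-congʳ (mono b) p) (mono-⊛ a b)

w-suc : ∀ n → let N = mono n in w (suc n) ≈ ⊝ (N ⊛ N ⊛ N ⊛ N ⊛ N ⊛ q ⊛ q ⊛ q ⊛ w n)
w-suc n = begin
  (-1ℤ * s) · mono (pent n ℕ.+ (5 ℕ.* n ℕ.+ 3)) ≈⟨ mk≈ (λ m → ℤₚ.*-assoc -1ℤ s _) ⟩
  -1ℤ · s · mono (pent n ℕ.+ (5 ℕ.* n ℕ.+ 3)) ≈⟨ ·-cong -1ℤ (·-cong s (≈-trans (≈-sym (mono-⊛ (pent n) (5 ℕ.* n ℕ.+ 3))) (⊛-congˡ (mono (pent n)) powers))) ⟩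
  -1ℤ · s · (mono (pent n) ⊛ (N ⊛ N ⊛ N ⊛ N ⊛ N ⊛ q ⊛ q ⊛ q)) ≈⟨ ·-cong -1ℤ (≈-sym (CL.scale (clinear-⊛ʳ (N ⊛ N ⊛ N ⊛ N ⊛ N ⊛ q ⊛ q ⊛ q)) s (mono (pent n)))) ⟩
  -1ℤ · (w n ⊛ (N ⊛ N ⊛ N ⊛ N ⊛ N ⊛ q ⊛ q ⊛ q)) ≈⟨ ·≈const -1ℤ (w n ⊛ (N ⊛ N ⊛ N ⊛ N ⊛ N ⊛ q ⊛ q ⊛ q)) ⟩
  const -1ℤ ⊛ (w n ⊛ (N ⊛ N ⊛ N ⊛ N ⊛ N ⊛ q ⊛ q ⊛ q)) ≈⟨ solve 3 (λ w N q → con -1ℤ :* (w :* (N :* N :* N :* N :* N :* q :* q :* q)) := :- (N :* N :* N :* N :* N :* q :* q :* q :* w)) ≈-refl (w n) N q ⟩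
  ⊝ (N ⊛ N ⊛ N ⊛ N ⊛ N ⊛ q ⊛ q ⊛ q ⊛ w n) ∎
  where
  s = -1ℤ ^ n
  N = mono n
  powers : mono (5 ℕ.* n ℕ.+ 3) ≈ N ⊛ N ⊛ N ⊛ N ⊛ N ⊛ q ⊛ q ⊛ q
  powers = ≈-sym (≈-trans (((((((≈-refl {N} ⊙ n) ⊙ n) ⊙ n) ⊙ n) ⊙ 1) ⊙ 1) ⊙ 1)
    (mono-cong (NS.solve 1 (λ n → n +ⁿ n +ⁿ n +ⁿ n +ⁿ n +ⁿ #ⁿ 1 +ⁿ #ⁿ 1 +ⁿ #ⁿ 1 =ⁿ #ⁿ 5 *ⁿ n +ⁿ #ⁿ 3) refl n)))

-- The factor z^(2n) at z = q^k.
M : ℕ → ℕ → Series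
M k n = mono (2 ℕ.* (k ℕ.* n))

M-sucʳ : ∀ k n → M k (suc n) ≈ M k n ⊛ mono k ⊛ mono k
M-sucʳ k n = ≈-sym (≈-trans (⊛-congʳ (mono k) (mono-⊛ (2 ℕ.* (k ℕ.* n)) k)) (≈-trans (mono-⊛ (2 ℕ.* (k ℕ.* n) ℕ.+ k) k)
  (mono-cong (NS.solve 2 (λ k n → #ⁿ 2 *ⁿ (k *ⁿ n) +ⁿ k +ⁿ k =ⁿ #ⁿ 2 *ⁿ (k *ⁿ (#ⁿ 1 +ⁿ n))) refl k n))))

M-sucˡ : ∀ k n → M (suc k) n ≈ M k n ⊛ mono n ⊛ mono n
M-sucˡ k n = ≈-sym (≈-trans (⊛-congʳ (mono n) (mono-⊛ (2 ℕ.* (k ℕ.* n)) n)) (≈-trans (mono-⊛ (2 ℕ.* (k ℕ.* n) ℕ.+ n) n)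
  (mono-cong (NS.solve 2 (λ k n → #ⁿ 2 *ⁿ (k *ⁿ n) +ⁿ n +ⁿ n =ⁿ #ⁿ 2 *ⁿ ((#ⁿ 1 +ⁿ k) *ⁿ n)) refl k n))))

-- The polynomial (q^(n+1);q)_k = (q;q)_(n+k) / (q;q)_n, to which (zq;q)_n / (q;q)_n · (q;q)_∞ /
-- (zq;q)_∞ reduces at z = q^k.
P : ℕ → ℕ → Series
P n k = prodTo k (λ i → one ⊖ mono (n ℕ.+ suc i))

P-last : ∀ n k → P n (suc k) ≈ P n k ⊛ (one ⊖ mono n ⊛ mono k ⊛ q)
P-last n k = ⊛-congˡ (P n k) (⊕-congˡ one (⊝-cong (≈-sym (≈-trans (⊛-congʳ q (mono-⊛ n k)) (≈-trans (mono-⊛ (n ℕ.+ k) 1)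
  (mono-cong (trans (ℕₚ.+-assoc n k 1) (cong (n ℕ.+_) (ℕₚ.+-comm k 1)))))))))

P-first : ∀ n k → (one ⊖ mono (suc n)) ⊛ P (suc n) k ≈ P n (suc k)
P-first n k = ≈-sym (≈-trans (prodTo-+ 1 k (λ i → one ⊖ mono (n ℕ.+ suc i))) (⊛-cong
  (≈-trans (R.*-identityˡ (one ⊖ mono (n ℕ.+ 1))) (⊕-congˡ one (⊝-cong (mono-cong (ℕₚ.+-comm n 1)))))
  (prodTo-cong k λ i → ⊕-congˡ one (⊝-cong (mono-cong (ℕₚ.+-suc n (suc i)))))))

-- The specialisations z = q^k of the Rogers–Selberg functions, cleared of the denominator (q; q)_∞.
tA tB : ℕ → ℕ → Series
tA k n = let N = mono n; K = mono k in w n ⊛ (M k n ⊛ ((one ⊖ K ⊛ K ⊛ N ⊛ N ⊛ N ⊛ N ⊛ q ⊛ q) ⊛ P n k))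
tB k n = let N = mono n; K = mono k in w n ⊛ (M k n ⊛ (N ⊛ ((one ⊖ K ⊛ N ⊛ N ⊛ q) ⊛ P n k)))

Aₖ Bₖ : ℕ → Series
Aₖ k = sumN (tA k)
Bₖ k = sumN (tB k)

-- Both hypotheses, in their uses, are rearrangements of pure products and go to the monoid solver;
-- the ring solver sees only the factor 1 - X and never the high powers inside X.
subtract-multiple : ∀ a b u v X → u ⊛ v ≈ X ⊛ a → (one ⊖ X) ⊛ a ≈ b → a ⊕ (⊝ u) ⊛ v ≈ b
subtract-multiple a b u v X p q = begin
  a ⊕ (⊝ u) ⊛ v ≈⟨ solve 3 (λ a u v → a :+ (:- u) :* v := a :- u :* v) ≈-refl a u v ⟩
  a ⊖ u ⊛ v ≈⟨ ⊕-congˡ a (⊝-cong p) ⟩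
  a ⊖ X ⊛ a ≈⟨ solve 2 (λ a X → a :- X :* a := (con (+ 1) :- X) :* a) ≈-refl a X ⟩
  (one ⊖ X) ⊛ a ≈⟨ q ⟩
  b ∎

factor-out : ∀ w M N K q P →
  w ⊛ (M ⊛ (N ⊛ N ⊛ P)) ⊕ ⊝ (N ⊛ N ⊛ N ⊛ N ⊛ N ⊛ q ⊛ q ⊛ q ⊛ w) ⊛ (M ⊛ K ⊛ K ⊛ (N ⊛ q ⊛ P))
  ≈ w ⊛ (M ⊛ N ⊛ N ⊛ ((one ⊖ (K ⊛ q) ⊛ (K ⊛ q) ⊛ N ⊛ N ⊛ N ⊛ N ⊛ q ⊛ q) ⊛ P))
factor-out w M N K q P = subtract-multiple (w ⊛ (M ⊛ (N ⊛ N ⊛ P))) _ (N ⊛ N ⊛ N ⊛ N ⊛ N ⊛ q ⊛ q ⊛ q ⊛ w) (M ⊛ K ⊛ K ⊛ (N ⊛ q ⊛ P))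
  ((K ⊛ q) ⊛ (K ⊛ q) ⊛ N ⊛ N ⊛ N ⊛ N ⊛ q ⊛ q)
  (solve∙ 6 (λ w M N K q P → (N ∙ N ∙ N ∙ N ∙ N ∙ q ∙ q ∙ q ∙ w) ∙ (M ∙ K ∙ K ∙ (N ∙ q ∙ P))
    ⊜ ((K ∙ q) ∙ (K ∙ q) ∙ N ∙ N ∙ N ∙ N ∙ q ∙ q) ∙ (w ∙ (M ∙ (N ∙ N ∙ P)))) ≈-refl w M N K q P)
  (solve∙ 5 (λ Z w M N P → Z ∙ (w ∙ (M ∙ (N ∙ N ∙ P))) ⊜ w ∙ (M ∙ N ∙ N ∙ (Z ∙ P))) ≈-refl
    (one ⊖ (K ⊛ q) ⊛ (K ⊛ q) ⊛ N ⊛ N ⊛ N ⊛ N ⊛ q ⊛ q) w M N P)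

factor-out′ : ∀ w M N K q P →
  w ⊛ (M ⊛ (K ⊛ N ⊛ N ⊛ N ⊛ q ⊛ P)) ⊕ ⊝ (N ⊛ N ⊛ N ⊛ N ⊛ N ⊛ q ⊛ q ⊛ q ⊛ w) ⊛ (M ⊛ K ⊛ K ⊛ P)
  ≈ (K ⊛ q) ⊛ (w ⊛ (M ⊛ N ⊛ N ⊛ (N ⊛ ((one ⊖ (K ⊛ q) ⊛ N ⊛ N ⊛ q) ⊛ P))))
factor-out′ w M N K q P = subtract-multiple (w ⊛ (M ⊛ (K ⊛ N ⊛ N ⊛ N ⊛ q ⊛ P))) _ (N ⊛ N ⊛ N ⊛ N ⊛ N ⊛ q ⊛ q ⊛ q ⊛ w) (M ⊛ K ⊛ K ⊛ P)
  ((K ⊛ q) ⊛ N ⊛ N ⊛ q)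
  (solve∙ 6 (λ w M N K q P → (N ∙ N ∙ N ∙ N ∙ N ∙ q ∙ q ∙ q ∙ w) ∙ (M ∙ K ∙ K ∙ P)
    ⊜ ((K ∙ q) ∙ N ∙ N ∙ q) ∙ (w ∙ (M ∙ (K ∙ N ∙ N ∙ N ∙ q ∙ P)))) ≈-refl w M N K q P)
  (solve∙ 7 (λ Z w M N K q P → Z ∙ (w ∙ (M ∙ (K ∙ N ∙ N ∙ N ∙ q ∙ P))) ⊜ (K ∙ q) ∙ (w ∙ (M ∙ N ∙ N ∙ (N ∙ (Z ∙ P))))) ≈-refl
    (one ⊖ (K ⊛ q) ⊛ N ⊛ N ⊛ q) w M N K q P)

module _ (k : ℕ) where
  private
    K = mono k

    zero-term : ∀ f g h → f ⊛ (g ⊛ ((one ⊖ mono 0) ⊛ h)) ≈ 𝟘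
    zero-term f g h = ≈-trans (⊛-congˡ f (⊛-congˡ g (⊛-congʳ h mono-n⊖)))
      (≈-trans (⊛-congˡ f (≈-trans (⊛-congˡ g (R.zeroˡ h)) (R.zeroʳ g))) (R.zeroʳ f))

  -- From 1 - zq^(2n+1) = q^n (1 - zq^(n+1)) + (1 - q^n): the first part lengthens `P n k` at its
  -- end; the second vanishes at n = 0 and, with n raised by one, lengthens `P (suc n) k` at its
  -- beginning. Both then share `P n (suc k)`.
  B≈A-suc : Bₖ k ≈ Aₖ (suc k)
  B≈A-suc = sumN-telescope X Y (w-vanish (λ n → M k n ⊛ (mono n ⊛ ((one ⊖ mono n) ⊛ P n k)))) split
    (≈-trans (⊛-congˡ (w 0) (≈-sym (R.*-assoc (M k 0) (mono 0) ((one ⊖ mono 0) ⊛ P 0 k)))) (zero-term (w 0) (M k 0 ⊛ mono 0) (P 0 k))) join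
    where
    X Y : ℕ → Series
    X n = w n ⊛ (M k n ⊛ (mono n ⊛ mono n ⊛ P n (suc k)))
    Y n = w n ⊛ (M k n ⊛ (mono n ⊛ ((one ⊖ mono n) ⊛ P n k)))
    split : ∀ n → tB k n ≈ X n ⊕ Y n
    split n = ≈-sym (≈-trans (⊕-congʳ (Y n) (⊛-congˡ (w n) (⊛-congˡ (M k n) (⊛-congˡ (mono n ⊛ mono n) (P-last n k)))))
      (solve 6 (λ w M N K q P → w :* (M :* (N :* N :* (P :* (con (+ 1) :- N :* K :* q)))) :+ w :* (M :* (N :* ((con (+ 1) :- N) :* P)))
        := w :* (M :* (N :* ((con (+ 1) :- K :* N :* N :* q) :* P)))) ≈-refl (w n) (M k n) (mono n) K q (P n k)))
    join : ∀ n → X n ⊕ Y (suc n) ≈ tA (suc k) n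
    join n = begin
      X n ⊕ Y (suc n) ≈⟨ ⊕-congˡ (X n) (⊛-cong (w-suc n) (⊛-cong (M-sucʳ k n) (⊛-cong (mono-sucʳ n) (P-first n k)))) ⟩
      X n ⊕ ⊝ (N ⊛ N ⊛ N ⊛ N ⊛ N ⊛ q ⊛ q ⊛ q ⊛ w n) ⊛ (M k n ⊛ K ⊛ K ⊛ (N ⊛ q ⊛ P′))
        ≈⟨ factor-out (w n) (M k n) N K q P′ ⟩
      w n ⊛ (M k n ⊛ N ⊛ N ⊛ ((one ⊖ (K ⊛ q) ⊛ (K ⊛ q) ⊛ N ⊛ N ⊛ N ⊛ N ⊛ q ⊛ q) ⊛ P′))
        ≈⟨ ⊛-congˡ (w n) (⊛-cong (M-sucˡ k n) (⊛-congʳ P′ (⊕-congˡ one (⊝-cong (⊛-congʳ q (⊛-congʳ q (⊛-congʳ N (⊛-congʳ N (⊛-congʳ N (⊛-congʳ N (⊛-cong (mono-sucʳ k) (mono-sucʳ k)))))))))))) ⟨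
      tA (suc k) n ∎
      where
      N = mono n
      P′ = P n (suc k)

  -- From 1 - z²q^(4n+2) = q^n (1 - zq^(2n+1)) + zq^(3n+1) (1 - zq^(n+1)) + (1 - q^n): the first
  -- part is `tB k n`, and the other two telescope as before into zq times the B-sum at zq.
  A≈B+B : Aₖ k ≈ Bₖ k ⊕ mono (suc k) ⊛ Bₖ (suc k)
  A≈B+B = begin
    Aₖ k ≈⟨ sumN-cong split ⟩
    sumN (λ n → tB k n ⊕ (X n ⊕ Y n)) ≈⟨ sumN-⊕ (tB k) (λ n → X n ⊕ Y n) ⟩
    Bₖ k ⊕ sumN (λ n → X n ⊕ Y n) ≈⟨ ⊕-congˡ (Bₖ k) (sumN-telescope {λ n → X n ⊕ Y n} {λ n → mono (suc k) ⊛ tB (suc k) n} X Y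
        (w-vanish (λ n → M k n ⊛ ((one ⊖ mono n) ⊛ P n k))) (λ n → ≈-refl) (zero-term (w 0) (M k 0) (P 0 k)) join) ⟩
    Bₖ k ⊕ sumN (λ n → mono (suc k) ⊛ tB (suc k) n) ≈⟨ ⊕-congˡ (Bₖ k) (sumN-⊛ (mono (suc k)) (tB (suc k))
        (w-vanish (λ n → M (suc k) n ⊛ (mono n ⊛ ((one ⊖ mono (suc k) ⊛ mono n ⊛ mono n ⊛ q) ⊛ P n (suc k)))))) ⟨
    Bₖ k ⊕ mono (suc k) ⊛ Bₖ (suc k) ∎
    where
    X Y : ℕ → Series
    X n = w n ⊛ (M k n ⊛ (K ⊛ mono n ⊛ mono n ⊛ mono n ⊛ q ⊛ P n (suc k)))
    Y n = w n ⊛ (M k n ⊛ ((one ⊖ mono n) ⊛ P n k))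
    split : ∀ n → tA k n ≈ tB k n ⊕ (X n ⊕ Y n)
    split n = ≈-sym (≈-trans (⊕-congˡ (tB k n) (⊕-congʳ (Y n) (⊛-congˡ (w n) (⊛-congˡ (M k n) (⊛-congˡ (K ⊛ mono n ⊛ mono n ⊛ mono n ⊛ q) (P-last n k))))))
      (≈-trans (solve 8 (λ w M N P a b c d → w :* (M :* (N :* (a :* P))) :+ (w :* (M :* (b :* (P :* c))) :+ w :* (M :* (d :* P)))
          := w :* (M :* ((N :* a :+ b :* c :+ d) :* P))) ≈-refl (w n) (M k n) N (P n k)
          (one ⊖ K ⊛ N ⊛ N ⊛ q) (K ⊛ N ⊛ N ⊛ N ⊛ q) (one ⊖ N ⊛ K ⊛ q) (one ⊖ N))
        (⊛-congˡ (w n) (⊛-congˡ (M k n) (⊛-congʳ (P n k)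
          (solve 3 (λ N K q → N :* (con (+ 1) :- K :* N :* N :* q) :+ (K :* N :* N :* N :* q) :* (con (+ 1) :- N :* K :* q) :+ (con (+ 1) :- N)
            := con (+ 1) :- K :* K :* N :* N :* N :* N :* q :* q) ≈-refl N K q))))))
      where N = mono n
    join : ∀ n → X n ⊕ Y (suc n) ≈ mono (suc k) ⊛ tB (suc k) n
    join n = begin
      X n ⊕ Y (suc n) ≈⟨ ⊕-congˡ (X n) (⊛-cong (w-suc n) (⊛-cong (M-sucʳ k n) (P-first n k))) ⟩
      X n ⊕ ⊝ (N ⊛ N ⊛ N ⊛ N ⊛ N ⊛ q ⊛ q ⊛ q ⊛ w n) ⊛ (M k n ⊛ K ⊛ K ⊛ P′)
        ≈⟨ factor-out′ (w n) (M k n) N K q P′ ⟩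
      (K ⊛ q) ⊛ (w n ⊛ (M k n ⊛ N ⊛ N ⊛ (N ⊛ ((one ⊖ (K ⊛ q) ⊛ N ⊛ N ⊛ q) ⊛ P′))))
        ≈⟨ ⊛-cong (mono-sucʳ k) (⊛-congˡ (w n) (⊛-cong (M-sucˡ k n) (⊛-congˡ N (⊛-congʳ P′ (⊕-congˡ one (⊝-cong (⊛-congʳ q (⊛-congʳ N (⊛-congʳ N (mono-sucʳ k)))))))))) ⟨
      mono (suc k) ⊛ tB (suc k) n ∎
      where
      N = mono n
      P′ = P n (suc k)

Aₖ-rec : FibRec Aₖ
Aₖ-rec k = ≈-trans (A≈B+B k) (⊕-cong (B≈A-suc k) (⊛-congˡ (mono (suc k)) (B≈A-suc (suc k))))

-- Comparison of the two solutions

euler : Series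
euler = poch -1ℤ 1 1

⊖mono≈factor : ∀ e → one ⊖ mono e ≈ factor -1ℤ e
⊖mono≈factor e = mk≈ λ n → cong (λ x → one n + x) (sym (ℤₚ.-1*i≡-i (mono e n)))

euler-agree : ∀ k → Agree k (qpoch k) euler
euler-agree k = agree-trans (≈⇒agree (prodTo-cong k λ j → ≈-trans (⊖mono≈factor (suc j)) (factor-cong -1ℤ (cong suc (sym (ℕₚ.*-identityˡ j))))))
  (agree-sym (∏-agree (tame-poch -1ℤ 1 1) k))

sumN-agree-head : ∀ k F → (∀ i → Agree k (F (suc i)) 𝟘) → Agree k (sumN F) (F 0)
sumN-agree-head k F v m m≤k = sumTo-vanish 0 m (λ i → F i m) z≤n λ { (suc i) _ → v i m m≤k }

Gₖ-agree : ∀ k → Agree k (Gₖ k) one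
Gₖ-agree k = agree-trans (sumN-agree-head k (gTerm k) λ i → vanish-⊛ (inv (qpoch (suc i)))
    (mono-agree (ℕₚ.+-mono-≤ (s≤s z≤n) (ℕₚ.m≤m*n k (suc i)))))
  (≈⇒agree (≈-trans (⊛-congʳ (inv one) (≈-trans (mono-cong (ℕₚ.*-zeroʳ k)) mono-0)) (⊛-inv one refl)))

-- The n-th term for n ≥ 1 is divisible by q^(2kn + n(5n+1)/2) and so starts beyond degree k; the
-- term n = 0 is (1 - q^(2k+2)) (q;q)_k.
Aₖ-agree : ∀ k → Agree k (Aₖ k) (qpoch k)
Aₖ-agree k = agree-trans (sumN-agree-head k (tA k) higher)
  (agree-trans (≈⇒agree (⊛-cong w0 (⊛-congʳ (Z ⊛ P 0 k) M0)))
  (agree-trans (≈⇒agree (≈-trans (R.*-identityˡ (one ⊛ (Z ⊛ P 0 k))) (R.*-identityˡ (Z ⊛ P 0 k))))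
  (agree-trans (agree-⊛ {g = P 0 k} Z-agree (λ _ _ → refl)) (≈⇒agree (R.*-identityˡ (qpoch k))))))
  where
  K = mono k
  N = mono 0
  Z = one ⊖ K ⊛ K ⊛ N ⊛ N ⊛ N ⊛ N ⊛ q ⊛ q
  w0 : w 0 ≈ one
  w0 = ≈-trans (mk≈ λ n → ℤₚ.*-identityˡ (mono 0 n)) mono-0
  M0 : M k 0 ≈ one
  M0 = ≈-trans (mono-cong (cong (2 ℕ.*_) (ℕₚ.*-zeroʳ k))) mono-0
  higher : ∀ i → Agree k (tA k (suc i)) 𝟘
  higher i = agree-trans (≈⇒agree (≈-sym (R.*-assoc (w (suc i)) (M k (suc i)) rest)))
    (vanish-⊛ rest (agree-trans (≈⇒agree (≈-trans (CL.scale (clinear-⊛ʳ (M k (suc i))) s (mono (pent (suc i)))) (·-cong s (mono-⊛ (pent (suc i)) (2 ℕ.* (k ℕ.* suc i))))))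
      (·mono-agree s (ℕₚ.+-mono-≤ (ℕₚ.≤-trans (s≤s z≤n) (n≤pent (suc i))) (ℕₚ.≤-trans (ℕₚ.m≤m*n k (suc i)) (ℕₚ.m≤n*m (k ℕ.* suc i) 2))))))
    where
    s = -1ℤ ^ suc i
    N′ = mono (suc i)
    rest = (one ⊖ K ⊛ K ⊛ N′ ⊛ N′ ⊛ N′ ⊛ N′ ⊛ q ⊛ q) ⊛ P (suc i) k
  Z-agree : Agree k Z one
  Z-agree m m≤k = trans (cong (λ x → one m - x) small) (ℤₚ.+-identityʳ (one m))
    where
    small : (K ⊛ K ⊛ N ⊛ N ⊛ N ⊛ N ⊛ q ⊛ q) m ≡ + 0
    small = trans (at (≈-trans (solve∙ 3 (λ K N q → K ∙ K ∙ N ∙ N ∙ N ∙ N ∙ q ∙ q ⊜ (K ∙ q) ∙ (K ∙ N ∙ N ∙ N ∙ N ∙ q)) ≈-refl K N q)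
        (⊛-congʳ (K ⊛ N ⊛ N ⊛ N ⊛ N ⊛ q) (≈-sym (mono-sucʳ k)))) m)
      (vanish-⊛ (K ⊛ N ⊛ N ⊛ N ⊛ N ⊛ q) (mono-agree (ℕₚ.n<1+n k)) m m≤k)

-- Both sides solve the recurrence and agree with (q;q)_∞ up to degree k. This behaviour as k grows
-- serves as the initial condition.
euler⊛Gₖ : ∀ k → euler ⊛ Gₖ k ≈ Aₖ k
euler⊛Gₖ = fibRec-unique (λ k → euler ⊛ Gₖ k) Aₖ
  (λ k → ≈-trans (⊛-congˡ euler (Gₖ-rec k)) (solve 4 (λ e a m b → e :* (a :+ m :* b) := e :* a :+ m :* (e :* b)) ≈-refl euler (Gₖ (suc k)) (mono (suc k)) (Gₖ (suc (suc k)))))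
  Aₖ-rec
  (λ k → agree-trans (agree-⊛ {f = euler} (λ _ _ → refl) (Gₖ-agree k))
    (agree-trans (≈⇒agree (R.*-identityʳ euler)) (agree-trans (agree-sym (euler-agree k)) (agree-sym (Aₖ-agree k)))))

double-pent-ℤ : ∀ n → + 2 * + pent n ≡ + 5 * (+ n * + n) + + n
double-pent-ℤ n = trans (sym (ℤₚ.pos-* 2 (pent n))) (trans (cong +_ (double-pent n))
  (trans (ℤₚ.pos-+ (5 ℕ.* (n ℕ.* n)) n) (cong (_+ + n) (trans (ℤₚ.pos-* 5 (n ℕ.* n)) (cong (+ 5 *_) (ℤₚ.pos-* n n))))))

-- The indices n and -1 - n are paired, which matches the one-sided Rogers-Selberg sums with the
-- two-sided theta series.
fold-halves : ∀ A B c t → (∀ n → t n ≈ thTerm A B c (+ n) ⊕ thTerm A B c -[1+ n ]) → sumN t ≈ th A B c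
fold-halves A B c t p = ≈-trans (sumN-cong p) (sumN-⊕ (λ n → thTerm A B c (+ n)) (λ n → thTerm A B c -[1+ n ]))

signed-pair : ∀ n a b → (-1ℤ ^ n) · mono a ⊕ (-1ℤ ^ suc n) · mono (a ℕ.+ b) ≈ ((-1ℤ ^ n) · mono a) ⊛ (one ⊖ mono b)
signed-pair n a b = ≈-sym (begin
  X ⊛ (one ⊖ mono b) ≈⟨ solve 2 (λ X b → X :* (con (+ 1) :- b) := X :- X :* b) ≈-refl X (mono b) ⟩
  X ⊖ X ⊛ mono b ≈⟨ ⊕-congˡ X (⊝-cong (≈-trans (CL.scale (clinear-⊛ʳ (mono b)) s (mono a)) (·-cong s (mono-⊛ a b)))) ⟩
  X ⊖ s · mono (a ℕ.+ b) ≈⟨ ⊕-congˡ X (mk≈ λ m → ZS.solve 2 (λ s x → -ᶻ (s *ᶻ x) =ᶻ ZS.con -1ℤ *ᶻ s *ᶻ x) refl s (mono (a ℕ.+ b) m)) ⟩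
  X ⊕ (-1ℤ * s) · mono (a ℕ.+ b) ∎)
  where
  s = -1ℤ ^ n
  X = s · mono a

pent-tri : ∀ n → 5 ℕ.* tri n ≡ pent n ℕ.+ 2 ℕ.* n
pent-tri n = ℤₚ.+-injective (double-injective (trans (cong (+ 2 *_) (ℤₚ.pos-* 5 (tri n)))
  (trans (ZS.solve 1 (λ t → #ᶻ 2 *ᶻ (#ᶻ 5 *ᶻ t) =ᶻ #ᶻ 5 *ᶻ (#ᶻ 2 *ᶻ t)) refl (+ tri n))
  (trans (cong (+ 5 *_) (double-tri-ℤ n))
  (trans (ZS.solve 1 (λ n → #ᶻ 5 *ᶻ (n *ᶻ n +ᶻ n) =ᶻ (#ᶻ 5 *ᶻ (n *ᶻ n) +ᶻ n) +ᶻ #ᶻ 4 *ᶻ n) refl (+ n))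
  (trans (cong (_+ + 4 * + n) (sym (double-pent-ℤ n)))
  (trans (ZS.solve 2 (λ p n → #ᶻ 2 *ᶻ p +ᶻ #ᶻ 4 *ᶻ n =ᶻ #ᶻ 2 *ᶻ (p +ᶻ #ᶻ 2 *ᶻ n)) refl (+ pent n) (+ n))
  (cong (+ 2 *_) (sym (trans (ℤₚ.pos-+ (pent n) (2 ℕ.* n)) (cong (λ x → + pent n + x) (ℤₚ.pos-* 2 n))))))))))))

-- At z = 1 the factors `M` and `P` are trivial, and the two parts of w n (1 - q^(4n+2)) are the
-- terms n and -1 - n of f(-q³, -q²).
A₀≈th : Aₖ 0 ≈ f⁻ 3 2
A₀≈th = fold-halves 3 2 -1ℤ (tA 0) λ n → ≈-sym (begin
  thTerm 3 2 -1ℤ (+ n) ⊕ thTerm 3 2 -1ℤ -[1+ n ] ≡⟨ cong₂ (λ a b → (-1ℤ ^ n) · mono a ⊕ (-1ℤ ^ suc n) · mono b) (e₊ n) (e₋ n) ⟩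
  (-1ℤ ^ n) · mono (pent n) ⊕ (-1ℤ ^ suc n) · mono (pent n ℕ.+ (4 ℕ.* n ℕ.+ 2)) ≈⟨ signed-pair n (pent n) (4 ℕ.* n ℕ.+ 2) ⟩
  w n ⊛ (one ⊖ mono (4 ℕ.* n ℕ.+ 2)) ≈⟨ ⊛-congˡ (w n) (≈-trans (⊕-congˡ one (⊝-cong (powers n))) (≈-sym (≈-trans (⊛-cong (mono-0)
     (R.*-identityʳ (Z n))) (R.*-identityˡ (Z n))))) ⟩
  tA 0 n ∎)
  where
  Z : ℕ → Series
  Z n = one ⊖ mono 0 ⊛ mono 0 ⊛ mono n ⊛ mono n ⊛ mono n ⊛ mono n ⊛ q ⊛ q
  powers : ∀ n → mono (4 ℕ.* n ℕ.+ 2) ≈ mono 0 ⊛ mono 0 ⊛ mono n ⊛ mono n ⊛ mono n ⊛ mono n ⊛ q ⊛ q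
  powers n = ≈-sym (≈-trans (((((((≈-refl {mono 0} ⊙ 0) ⊙ n) ⊙ n) ⊙ n) ⊙ n) ⊙ 1) ⊙ 1)
    (mono-cong (NS.solve 1 (λ n → n +ⁿ n +ⁿ n +ⁿ n +ⁿ #ⁿ 1 +ⁿ #ⁿ 1 =ⁿ #ⁿ 4 *ⁿ n +ⁿ #ⁿ 2) refl n)))
  e₊ : ∀ n → thExp 3 2 (+ n) ≡ pent n
  e₊ n = ℤₚ.+-injective (double-injective (trans (double-thExp 3 2 (+ n)) (trans
    (ZS.solve 1 (λ n → #ᶻ 3 *ᶻ (n *ᶻ n +ᶻ n) +ᶻ #ᶻ 2 *ᶻ (n *ᶻ n -ᶻ n) =ᶻ #ᶻ 5 *ᶻ (n *ᶻ n) +ᶻ n) refl (+ n))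
    (sym (double-pent-ℤ n)))))
  e₋ : ∀ n → thExp 3 2 -[1+ n ] ≡ pent n ℕ.+ (4 ℕ.* n ℕ.+ 2)
  e₋ n = trans (NS.solve 2 (λ n t → #ⁿ 3 *ⁿ t +ⁿ #ⁿ 2 *ⁿ ((#ⁿ 1 +ⁿ n) +ⁿ t) =ⁿ (#ⁿ 5 *ⁿ t) +ⁿ #ⁿ 2 *ⁿ n +ⁿ #ⁿ 2) refl n (tri n))
    (trans (cong (λ x → x ℕ.+ 2 ℕ.* n ℕ.+ 2) (pent-tri n)) (NS.solve 2 (λ p n → (p +ⁿ #ⁿ 2 *ⁿ n) +ⁿ #ⁿ 2 *ⁿ n +ⁿ #ⁿ 2 =ⁿ p +ⁿ (#ⁿ 4 *ⁿ n +ⁿ #ⁿ 2)) refl (pent n) n))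

rogers-ramanujan-G : euler ⊛ G ≈ f⁻ 3 2
rogers-ramanujan-G = ≈-trans (⊛-congˡ euler G≈G₀) (≈-trans (euler⊛Gₖ 0) A₀≈th)

-- For `H` the value at z = q is needed. It is read off as `Bₖ 0`, where `P` is trivial and the
-- pairing with f(-q⁴, -q) is immediate, whereas `Aₖ 1` still contains the factor 1 - q^(n+1).
B₀≈th : Bₖ 0 ≈ f⁻ 4 1
B₀≈th = fold-halves 4 1 -1ℤ (tB 0) λ n → ≈-sym (begin
  thTerm 4 1 -1ℤ (+ n) ⊕ thTerm 4 1 -1ℤ -[1+ n ] ≡⟨ cong₂ (λ a b → (-1ℤ ^ n) · mono a ⊕ (-1ℤ ^ suc n) · mono b) (e₊ n) (e₋ n) ⟩
  (-1ℤ ^ n) · mono (pent n ℕ.+ n) ⊕ (-1ℤ ^ suc n) · mono ((pent n ℕ.+ n) ℕ.+ (2 ℕ.* n ℕ.+ 1)) ≈⟨ signed-pair n (pent n ℕ.+ n) (2 ℕ.* n ℕ.+ 1) ⟩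
  ((-1ℤ ^ n) · mono (pent n ℕ.+ n)) ⊛ (one ⊖ mono (2 ℕ.* n ℕ.+ 1)) ≈⟨ ⊛-cong
     (≈-trans (·-cong (-1ℤ ^ n) (≈-sym (mono-⊛ (pent n) n))) (≈-sym (CL.scale (clinear-⊛ʳ (mono n)) (-1ℤ ^ n) (mono (pent n)))))
     (⊕-congˡ one (⊝-cong (powers n))) ⟩
  (w n ⊛ mono n) ⊛ Z n ≈⟨ R.*-assoc (w n) (mono n) (Z n) ⟩
  w n ⊛ (mono n ⊛ Z n) ≈⟨ ⊛-congˡ (w n) (≈-sym (≈-trans (⊛-cong (mono-0) (⊛-congˡ (mono n) (R.*-identityʳ (Z n)))) (R.*-identityˡ (mono n ⊛ Z n)))) ⟩
  tB 0 n ∎)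
  where
  Z : ℕ → Series
  Z n = one ⊖ mono 0 ⊛ mono n ⊛ mono n ⊛ q
  powers : ∀ n → mono (2 ℕ.* n ℕ.+ 1) ≈ mono 0 ⊛ mono n ⊛ mono n ⊛ q
  powers n = ≈-sym (≈-trans (((≈-refl {mono 0} ⊙ n) ⊙ n) ⊙ 1)
    (mono-cong (NS.solve 1 (λ n → n +ⁿ n +ⁿ #ⁿ 1 =ⁿ #ⁿ 2 *ⁿ n +ⁿ #ⁿ 1) refl n)))
  e₊ : ∀ n → thExp 4 1 (+ n) ≡ pent n ℕ.+ n
  e₊ n = ℤₚ.+-injective (double-injective (trans (double-thExp 4 1 (+ n)) (trans
    (ZS.solve 1 (λ n → #ᶻ 4 *ᶻ (n *ᶻ n +ᶻ n) +ᶻ #ᶻ 1 *ᶻ (n *ᶻ n -ᶻ n) =ᶻ (#ᶻ 5 *ᶻ (n *ᶻ n) +ᶻ n) +ᶻ #ᶻ 2 *ᶻ n) refl (+ n))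
    (trans (cong (_+ + 2 * + n) (sym (double-pent-ℤ n)))
    (trans (sym (ℤₚ.*-distribˡ-+ (+ 2) (+ pent n) (+ n))) (cong (+ 2 *_) (sym (ℤₚ.pos-+ (pent n) n))))))))
  e₋ : ∀ n → thExp 4 1 -[1+ n ] ≡ (pent n ℕ.+ n) ℕ.+ (2 ℕ.* n ℕ.+ 1)
  e₋ n = trans (NS.solve 2 (λ n t → #ⁿ 4 *ⁿ t +ⁿ #ⁿ 1 *ⁿ ((#ⁿ 1 +ⁿ n) +ⁿ t) =ⁿ (#ⁿ 5 *ⁿ t) +ⁿ n +ⁿ #ⁿ 1) refl n (tri n))
    (trans (cong (λ x → x ℕ.+ n ℕ.+ 1) (pent-tri n)) (NS.solve 2 (λ p n → (p +ⁿ #ⁿ 2 *ⁿ n) +ⁿ n +ⁿ #ⁿ 1 =ⁿ (p +ⁿ n) +ⁿ (#ⁿ 2 *ⁿ n +ⁿ #ⁿ 1)) refl (pent n) n))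

rogers-ramanujan-H : euler ⊛ H ≈ f⁻ 4 1
rogers-ramanujan-H = ≈-trans (⊛-congˡ euler H≈G₁) (≈-trans (euler⊛Gₖ 1) (≈-trans (≈-sym (B≈A-suc 0)) B₀≈th))

-- The Jacobi triple product

-- Σ_{i+j=n} F i j
diag : ℕ → (ℕ → ℕ → Series) → Series
diag zero F = F 0 0
diag (suc n) F = F (suc n) 0 ⊕ diag n (λ i j → F i (suc j))

diag-agree : ∀ {m} n {F G : ℕ → ℕ → Series} → (∀ i j → i ℕ.+ j ≡ n → Agree m (F i j) (G i j)) → Agree m (diag n F) (diag n G)
diag-agree zero p = p 0 0 refl
diag-agree (suc n) p k k≤m = cong₂ _+_ (p (suc n) 0 (ℕₚ.+-identityʳ (suc n)) k k≤m)
  (diag-agree n (λ i j e → p i (suc j) (trans (ℕₚ.+-suc i j) (cong suc e))) k k≤m)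

diag-cong : ∀ n {F G : ℕ → ℕ → Series} → (∀ i j → i ℕ.+ j ≡ n → F i j ≈ G i j) → diag n F ≈ diag n G
diag-cong n p = agree⇒≈ λ m → diag-agree n (λ i j e → ≈⇒agree (p i j e))

diag-⊛ : ∀ n (F : ℕ → ℕ → Series) f → diag n F ⊛ f ≈ diag n (λ i j → F i j ⊛ f)
diag-⊛ zero F f = ≈-refl
diag-⊛ (suc n) F f = ≈-trans (R.distribʳ f (F (suc n) 0) (diag n (λ i j → F i (suc j)))) (⊕-congˡ (F (suc n) 0 ⊛ f) (diag-⊛ n (λ i j → F i (suc j)) f))

diag-split-column : ∀ n (F X Y : ℕ → ℕ → Series) → (∀ i j → F (suc i) j ≈ X i j ⊕ Y (suc i) j) → (∀ j → F 0 j ≈ Y 0 j) →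
  diag (suc n) F ≈ diag n X ⊕ diag (suc n) Y
diag-split-column zero F X Y p r = ≈-trans (⊕-cong (p 0 0) (r 1)) (R.+-assoc (X 0 0) (Y 1 0) (Y 0 1))
diag-split-column (suc n) F X Y p r = ≈-trans
  (⊕-cong (p (suc n) 0) (diag-split-column n (λ i j → F i (suc j)) (λ i j → X i (suc j)) (λ i j → Y i (suc j)) (λ i j → p i (suc j)) (λ j → r (suc j))))
  (solve 4 (λ a b c d → (a :+ b) :+ (c :+ d) := (a :+ c) :+ (b :+ d)) ≈-refl (X (suc n) 0) (Y (suc (suc n)) 0)
    (diag n (λ i j → X i (suc j))) (diag (suc n) (λ i j → Y i (suc j))))

-- Pascal's rule along an antidiagonal: an inner entry receives one contribution from each of its
-- two predecessors, an end entry from its only one.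
diag-split : ∀ n (F X Y : ℕ → ℕ → Series) → (∀ i j → F (suc i) (suc j) ≈ X i (suc j) ⊕ Y (suc i) j) →
  (∀ i → F (suc i) 0 ≈ X i 0) → (∀ j → F 0 (suc j) ≈ Y 0 j) → diag (suc n) F ≈ diag n X ⊕ diag n Y
diag-split zero F X Y p r s = ⊕-cong (r 0) (s 0)
diag-split (suc n) F X Y p r s = ≈-trans
  (⊕-cong (r (suc n)) (diag-split-column n (λ i j → F i (suc j)) (λ i j → X i (suc j)) Y p s))
  (≈-sym (R.+-assoc (X (suc n) 0) (diag n (λ i j → X i (suc j))) (diag (suc n) Y)))

diag-list : ∀ {I : Set} n (F : I → Series) (f : ℕ → I) → diag n (λ i j → F (f j)) ≈ sumS (applyUpTo f (suc n)) F
diag-list zero F f = ≈-sym (R.+-identityʳ (F (f 0)))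
diag-list (suc n) F f = ⊕-congˡ (F (f 0)) (diag-list n F (λ j → f (suc j)))

module _ (D : ℕ) .{{_ : NonZero D}} where
  -- the Gaussian binomial coefficient [a+b choose a] at q^D
  binom : ℕ → ℕ → Series
  binom zero b = one
  binom (suc a) zero = one
  binom (suc a) (suc b) = binom a (suc b) ⊕ mono (D ℕ.* suc a) ⊛ binom (suc a) b

  qfac : ℕ → Series
  qfac n = prodTo n (λ r → factor -1ℤ (D ℕ.+ D ℕ.* r))

  qfac-suc : ∀ n → qfac (suc n) ≈ qfac n ⊛ (one ⊖ mono (D ℕ.* suc n))
  qfac-suc n = ⊛-congˡ (qfac n) (≈-trans (factor-cong -1ℤ (sym (ℕₚ.*-suc D n))) (≈-sym (⊖mono≈factor (D ℕ.* suc n))))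

  qfac-0 : ∀ n → qfac n 0 ≡ + 1
  qfac-0 n = trans (cong (λ k → prodTo k (λ r → factor -1ℤ (D ℕ.+ D ℕ.* r)) 0) (sym (ℕₚ.+-identityʳ n)))
    (prodTo-stable (tame-poch -1ℤ D D) 0 n 0 z≤n)

  mono-D : ∀ a b → mono (D ℕ.* suc (suc (a ℕ.+ b))) ≈ mono (D ℕ.* suc a) ⊛ mono (D ℕ.* suc b)
  mono-D a b = ≈-sym (≈-trans (mono-⊛ (D ℕ.* suc a) (D ℕ.* suc b)) (mono-cong
    (NS.solve 3 (λ D a b → D *ⁿ (#ⁿ 1 +ⁿ a) +ⁿ D *ⁿ (#ⁿ 1 +ⁿ b) =ⁿ D *ⁿ (#ⁿ 2 +ⁿ (a +ⁿ b))) refl D a b)))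

  qfac-top : ∀ a b → qfac (suc a ℕ.+ suc b) ≈ qfac (suc (a ℕ.+ b)) ⊛ (one ⊖ mono (D ℕ.* suc a) ⊛ mono (D ℕ.* suc b))
  qfac-top a b = begin
    qfac (suc a ℕ.+ suc b) ≡⟨ cong qfac (cong suc (ℕₚ.+-suc a b)) ⟩
    qfac (suc (suc (a ℕ.+ b))) ≈⟨ qfac-suc (suc (a ℕ.+ b)) ⟩
    qfac (suc (a ℕ.+ b)) ⊛ (one ⊖ mono (D ℕ.* suc (suc (a ℕ.+ b)))) ≈⟨ ⊛-congˡ (qfac (suc (a ℕ.+ b))) (⊕-congˡ one (⊝-cong (mono-D a b))) ⟩
    qfac (suc (a ℕ.+ b)) ⊛ (one ⊖ mono (D ℕ.* suc a) ⊛ mono (D ℕ.* suc b)) ∎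

  -- With x = q^(D(a+1)) and y = q^(D(b+1)), Pascal's rule reduces the induction to (1 - x) + x(1 -
  -- y) = 1 - xy, the top factor of the factorial of a + b + 2.
  qfac-binom : ∀ a b → qfac a ⊛ qfac b ⊛ binom a b ≈ qfac (a ℕ.+ b)
  qfac-binom zero b = ≈-trans (R.*-identityʳ (one ⊛ qfac b)) (R.*-identityˡ (qfac b))
  qfac-binom (suc a) zero = ≈-trans (R.*-identityʳ (qfac (suc a) ⊛ one)) (≈-trans (R.*-identityʳ (qfac (suc a)))
    (mk≈ λ n → cong (λ k → qfac k n) (sym (ℕₚ.+-identityʳ (suc a)))))
  qfac-binom (suc a) (suc b) = begin
    qfac (suc a) ⊛ qfac (suc b) ⊛ (B₁ ⊕ x ⊛ B₂)
      ≈⟨ solve 5 (λ u v x B C → u :* v :* (B :+ x :* C) := u :* v :* B :+ x :* (u :* v :* C)) ≈-refl (qfac (suc a)) (qfac (suc b)) x B₁ B₂ ⟩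
    qfac (suc a) ⊛ qfac (suc b) ⊛ B₁ ⊕ x ⊛ (qfac (suc a) ⊛ qfac (suc b) ⊛ B₂)
      ≈⟨ ⊕-cong (⊛-congʳ B₁ (⊛-congʳ (qfac (suc b)) (qfac-suc a))) (⊛-congˡ x (⊛-congʳ B₂ (⊛-congˡ (qfac (suc a)) (qfac-suc b)))) ⟩
    qfac a ⊛ (one ⊖ x) ⊛ qfac (suc b) ⊛ B₁ ⊕ x ⊛ (qfac (suc a) ⊛ (qfac b ⊛ (one ⊖ y)) ⊛ B₂)
      ≈⟨ solve 8 (λ u X v B x w V C → u :* X :* v :* B :+ x :* (w :* V :* C) := X :* (u :* v :* B) :+ x :* (w :* V :* C)) ≈-refl
           (qfac a) (one ⊖ x) (qfac (suc b)) B₁ x (qfac (suc a)) (qfac b ⊛ (one ⊖ y)) B₂ ⟩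
    (one ⊖ x) ⊛ (qfac a ⊛ qfac (suc b) ⊛ B₁) ⊕ x ⊛ (qfac (suc a) ⊛ (qfac b ⊛ (one ⊖ y)) ⊛ B₂)
      ≈⟨ ⊕-cong (⊛-congˡ (one ⊖ x) (≈-trans (qfac-binom a (suc b)) (mk≈ λ n → cong (λ k → qfac k n) (ℕₚ.+-suc a b))))
           (⊛-congˡ x (≈-trans (solve∙ 4 (λ w v y C → w ∙ (v ∙ y) ∙ C ⊜ y ∙ (w ∙ v ∙ C)) ≈-refl (qfac (suc a)) (qfac b) (one ⊖ y) B₂) (⊛-congˡ (one ⊖ y) (qfac-binom (suc a) b)))) ⟩
    (one ⊖ x) ⊛ Q ⊕ x ⊛ ((one ⊖ y) ⊛ Q)
      ≈⟨ solve 3 (λ x y Q → (con (+ 1) :- x) :* Q :+ x :* ((con (+ 1) :- y) :* Q) := Q :* (con (+ 1) :- x :* y)) ≈-refl x y Q ⟩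
    Q ⊛ (one ⊖ x ⊛ y) ≈⟨ qfac-top a b ⟨
    qfac (suc a ℕ.+ suc b) ∎
    where
    B₁ = binom a (suc b)
    B₂ = binom (suc a) b
    x = mono (D ℕ.* suc a)
    y = mono (D ℕ.* suc b)
    Q = qfac (suc (a ℕ.+ b))

  -- The second Pascal rule, read off the product formula.
  binom-pascal′ : ∀ a b → binom (suc a) (suc b) ≈ mono (D ℕ.* suc b) ⊛ binom a (suc b) ⊕ binom (suc a) b
  binom-pascal′ a b = ⊛-cancelˡ (qfac (suc a) ⊛ qfac (suc b)) nonzero (begin
    qfac (suc a) ⊛ qfac (suc b) ⊛ binom (suc a) (suc b) ≈⟨ qfac-binom (suc a) (suc b) ⟩
    qfac (suc a ℕ.+ suc b) ≈⟨ qfac-top a b ⟩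
    Q ⊛ (one ⊖ x ⊛ y)
      ≈⟨ solve 3 (λ x y Q → Q :* (con (+ 1) :- x :* y) := y :* ((con (+ 1) :- x) :* Q) :+ (con (+ 1) :- y) :* Q) ≈-refl x y Q ⟩
    y ⊛ ((one ⊖ x) ⊛ Q) ⊕ (one ⊖ y) ⊛ Q
      ≈⟨ ⊕-cong (⊛-congˡ y (⊛-congˡ (one ⊖ x) (≈-trans (qfac-binom a (suc b)) (mk≈ λ n → cong (λ k → qfac k n) (ℕₚ.+-suc a b))))) (⊛-congˡ (one ⊖ y) (qfac-binom (suc a) b)) ⟨
    y ⊛ ((one ⊖ x) ⊛ (qfac a ⊛ qfac (suc b) ⊛ B₁)) ⊕ (one ⊖ y) ⊛ (qfac (suc a) ⊛ qfac b ⊛ B₂)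
      ≈⟨ ⊕-cong (≈-trans (solve∙ 5 (λ y X u v B → y ∙ (X ∙ (u ∙ v ∙ B)) ⊜ (u ∙ X) ∙ v ∙ (y ∙ B)) ≈-refl y (one ⊖ x) (qfac a) (qfac (suc b)) B₁)
             (⊛-congʳ (y ⊛ B₁) (⊛-congʳ (qfac (suc b)) (≈-sym (qfac-suc a)))))
           (≈-trans (solve∙ 4 (λ Y u v B → Y ∙ (u ∙ v ∙ B) ⊜ u ∙ (v ∙ Y) ∙ B) ≈-refl (one ⊖ y) (qfac (suc a)) (qfac b) B₂)
             (⊛-congʳ B₂ (⊛-congˡ (qfac (suc a)) (≈-sym (qfac-suc b))))) ⟩
    qfac (suc a) ⊛ qfac (suc b) ⊛ (y ⊛ B₁) ⊕ qfac (suc a) ⊛ qfac (suc b) ⊛ B₂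
      ≈⟨ R.distribˡ (qfac (suc a) ⊛ qfac (suc b)) (y ⊛ B₁) B₂ ⟨
    qfac (suc a) ⊛ qfac (suc b) ⊛ (y ⊛ B₁ ⊕ B₂) ∎)
    where
    B₁ = binom a (suc b)
    B₂ = binom (suc a) b
    x = mono (D ℕ.* suc a)
    y = mono (D ℕ.* suc b)
    Q = qfac (suc (a ℕ.+ b))
    nonzero : qfac (suc a) 0 * qfac (suc b) 0 ≢ + 0
    nonzero e with trans (sym e) (cong₂ _*_ (qfac-0 (suc a)) (qfac-0 (suc b)))
    ... | ()

  E∞ : Series
  E∞ = poch -1ℤ D D

  qfac-agree : ∀ {m n} → m ℕ.≤ n → Agree m (qfac n) E∞
  qfac-agree m≤n = agree-mono m≤n (agree-sym (∏-agree (tame-poch -1ℤ D D) _))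

  -- Up to degree m, all of `qfac a`, `qfac b` and `qfac (a + b)` equal `E∞`, so the factorial
  -- formula reads `E∞` · `E∞` · binom = `E∞`; one factor `E∞` is then inverted.
  binom-limit : ∀ {m a b} → m ℕ.≤ a → m ℕ.≤ b → Agree m (binom a b ⊛ E∞) one
  binom-limit {m} {a} {b} m≤a m≤b = agree-trans (≈⇒agree rearrange) (agree-trans
    (agree-⊛ {f = inv E∞} (λ _ _ → refl) (agree-trans (agree-⊛ {g = binom a b} (agree-⊛ (agree-sym (qfac-agree m≤a)) (agree-sym (qfac-agree m≤b))) (λ _ _ → refl))
      (agree-trans (≈⇒agree (qfac-binom a b)) (qfac-agree (ℕₚ.≤-trans m≤a (ℕₚ.m≤m+n a b))))))
    (≈⇒agree (≈-trans (R.*-comm (inv E∞) E∞) inverse)))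
    where
    inverse : E∞ ⊛ inv E∞ ≈ one
    inverse = ⊛-inv E∞ (poch-0 -1ℤ D D)
    rearrange : binom a b ⊛ E∞ ≈ inv E∞ ⊛ (E∞ ⊛ E∞ ⊛ binom a b)
    rearrange = ≈-sym (≈-trans (solve∙ 3 (λ i e b → i ∙ (e ∙ e ∙ b) ⊜ (e ∙ i) ∙ (b ∙ e)) ≈-refl (inv E∞) E∞ (binom a b))
      (≈-trans (⊛-congʳ (binom a b ⊛ E∞) inverse) (R.*-identityˡ (binom a b ⊛ E∞))))

-- The finite triple product and its limit

module JacobiTriple (A B : ℕ) .{{nzA : NonZero A}} .{{nzB : NonZero B}} (c : ℤ) (cc : c * c ≡ + 1) where
  D = A ℕ.+ B

  instance
    nzD : NonZero D
    nzD = ℕ.>-nonZero (ℕₚ.≤-trans (ℕ.>-nonZero⁻¹ A) (ℕₚ.m≤m+n A B))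

  W : ℤ → Series
  W = thTerm A B c

  prodA prodB : ℕ → Series
  prodA n = prodTo n (λ i → factor c (A ℕ.+ D ℕ.* i))
  prodB n = prodTo n (λ i → factor c (B ℕ.+ D ℕ.* i))

  pos-lin : ∀ x y z → + (x ℕ.+ y ℕ.* z) ≡ + x + + y * + z
  pos-lin x y z = trans (ℤₚ.pos-+ x (y ℕ.* z)) (cong (λ t → + x + t) (ℤₚ.pos-* y z))

  exp-eq : ∀ k k′ x y → + 2 * + thExp A B k + + 2 * + x ≡ + 2 * + thExp A B k′ + + 2 * + y →
    thExp A B k ℕ.+ x ≡ thExp A B k′ ℕ.+ y
  exp-eq k k′ x y e = ℤₚ.+-injective (double-injective (trans (distr (thExp A B k) x) (trans e (sym (distr (thExp A B k′) y)))))
    where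
    distr : ∀ m n → + 2 * + (m ℕ.+ n) ≡ + 2 * + m + + 2 * + n
    distr m n = trans (cong (+ 2 *_) (ℤₚ.pos-+ m n)) (ℤₚ.*-distribˡ-+ (+ 2) (+ m) (+ n))

  pos-D : + D ≡ + A + + B
  pos-D = ℤₚ.pos-+ A B

  -- Passing from k to k + 1 raises the theta exponent by A + Dk, so of the new factor q^(A + Da)
  -- the power q^(D(a-k)) is left over; it is the weight in Pascal's rule.
  W-up : ∀ k a i → + i ≡ + a - k → W k ⊛ (c · mono (A ℕ.+ D ℕ.* a)) ≈ W (+ 1 + k) ⊛ mono (D ℕ.* i)
  W-up k a i e = ≈-trans (·mono-⊛ (pw c k) (thExp A B k) c (A ℕ.+ D ℕ.* a))
    (≈-trans (mk≈ λ n → cong₂ (λ s x → (s · mono x) n) (trans (ℤₚ.*-comm (pw c k) c) (sym (pw-suc c cc k))) exps)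
    (≈-sym (≈-trans (CL.scale (clinear-⊛ʳ (mono (D ℕ.* i))) (pw c (+ 1 + k)) (mono (thExp A B (+ 1 + k)))) (·-cong (pw c (+ 1 + k)) (mono-⊛ (thExp A B (+ 1 + k)) (D ℕ.* i))))))
    where
    exps : thExp A B k ℕ.+ (A ℕ.+ D ℕ.* a) ≡ thExp A B (+ 1 + k) ℕ.+ D ℕ.* i
    exps = exp-eq k (+ 1 + k) (A ℕ.+ D ℕ.* a) (D ℕ.* i) (trans
      (cong₂ (λ x y → x + + 2 * y) (double-thExp A B k) (trans (pos-lin A D a) (cong (λ d → + A + d * + a) pos-D)))
      (trans (ZS.solve 4 (λ A B k a → A *ᶻ (k *ᶻ k +ᶻ k) +ᶻ B *ᶻ (k *ᶻ k -ᶻ k) +ᶻ #ᶻ 2 *ᶻ (A +ᶻ (A +ᶻ B) *ᶻ a)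
          =ᶻ A *ᶻ ((#ᶻ 1 +ᶻ k) *ᶻ (#ᶻ 1 +ᶻ k) +ᶻ (#ᶻ 1 +ᶻ k)) +ᶻ B *ᶻ ((#ᶻ 1 +ᶻ k) *ᶻ (#ᶻ 1 +ᶻ k) -ᶻ (#ᶻ 1 +ᶻ k))
            +ᶻ #ᶻ 2 *ᶻ ((A +ᶻ B) *ᶻ (a -ᶻ k))) refl (+ A) (+ B) k (+ a))
      (sym (cong₂ (λ x y → x + + 2 * y) (double-thExp A B (+ 1 + k)) (trans (ℤₚ.pos-* D i) (cong₂ _*_ pos-D e))))))

  -- Here k drops by one and the theta exponent grows by B - Dk, leaving q^(D(b+k)), the weight in
  -- the second Pascal rule.
  W-down : ∀ k b j → + j ≡ + b + k → W k ⊛ (c · mono (B ℕ.+ D ℕ.* b)) ≈ W (k - + 1) ⊛ mono (D ℕ.* j)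
  W-down k b j e = ≈-trans (·mono-⊛ (pw c k) (thExp A B k) c (B ℕ.+ D ℕ.* b))
    (≈-trans (mk≈ λ n → cong₂ (λ s x → (s · mono x) n) sgn exps)
    (≈-sym (≈-trans (CL.scale (clinear-⊛ʳ (mono (D ℕ.* j))) (pw c (k - + 1)) (mono (thExp A B (k - + 1)))) (·-cong (pw c (k - + 1)) (mono-⊛ (thExp A B (k - + 1)) (D ℕ.* j))))))
    where
    sgn : pw c k * c ≡ pw c (k - + 1)
    sgn = sym (trans (pw-+ c cc k (- + 1)) (cong (pw c k *_) (ℤₚ.*-identityʳ c)))
    exps : thExp A B k ℕ.+ (B ℕ.+ D ℕ.* b) ≡ thExp A B (k - + 1) ℕ.+ D ℕ.* j
    exps = exp-eq k (k - + 1) (B ℕ.+ D ℕ.* b) (D ℕ.* j) (trans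
      (cong₂ (λ x y → x + + 2 * y) (double-thExp A B k) (trans (pos-lin B D b) (cong (λ d → + B + d * + b) pos-D)))
      (trans (ZS.solve 4 (λ A B k b → A *ᶻ (k *ᶻ k +ᶻ k) +ᶻ B *ᶻ (k *ᶻ k -ᶻ k) +ᶻ #ᶻ 2 *ᶻ (B +ᶻ (A +ᶻ B) *ᶻ b)
          =ᶻ A *ᶻ ((k -ᶻ #ᶻ 1) *ᶻ (k -ᶻ #ᶻ 1) +ᶻ (k -ᶻ #ᶻ 1)) +ᶻ B *ᶻ ((k -ᶻ #ᶻ 1) *ᶻ (k -ᶻ #ᶻ 1) -ᶻ (k -ᶻ #ᶻ 1))
            +ᶻ #ᶻ 2 *ᶻ ((A +ᶻ B) *ᶻ (b +ᶻ k))) refl (+ A) (+ B) k (+ b))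
      (sym (cong₂ (λ x y → x + + 2 * y) (double-thExp A B (k - + 1)) (trans (ℤₚ.pos-* D j) (cong₂ _*_ pos-D e))))))

  Term : ℕ → ℕ → ℕ → Series
  Term b i j = W (+ j - + b) ⊛ binom D i j

  -- The q-binomial theorem in its symmetric, finite form. A further factor of `prodA` corresponds
  -- to the defining Pascal rule and one of `prodB` to `binom-pascal′`; the recursion first removes
  -- all factors of `prodA`.
  finite : ∀ a b → prodA a ⊛ prodB b ≈ diag (a ℕ.+ b) (Term b)
  finite zero zero = ≈-trans (R.*-identityˡ one) (≈-sym (≈-trans (R.*-identityʳ (W (+ 0))) (≈-trans (mk≈ λ n → ℤₚ.*-identityˡ (mono (thExp A B (+ 0)) n))
    (≈-trans (mono-cong (cong₂ ℕ._+_ (ℕₚ.*-zeroʳ A) (ℕₚ.*-zeroʳ B))) mono-0))))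
  finite (suc a) b = begin
    (prodA a ⊛ factor c e) ⊛ prodB b ≈⟨ solve∙ 3 (λ x f y → (x ∙ f) ∙ y ⊜ (x ∙ y) ∙ f) ≈-refl (prodA a) (factor c e) (prodB b) ⟩
    (prodA a ⊛ prodB b) ⊛ factor c e ≈⟨ ⊛-congʳ (factor c e) (finite a b) ⟩
    diag n (Term b) ⊛ (one ⊕ c · mono e) ≈⟨ ≈-trans (R.distribˡ (diag n (Term b)) one (c · mono e)) (⊕-cong (R.*-identityʳ (diag n (Term b))) (diag-⊛ n (Term b) (c · mono e))) ⟩
    diag n (Term b) ⊕ diag n (λ i j → Term b i j ⊛ (c · mono e)) ≈⟨ ⊕-congˡ (diag n (Term b)) (diag-cong n λ i j eq →
        ≈-trans (solve∙ 3 (λ w b m → (w ∙ b) ∙ m ⊜ (w ∙ m) ∙ b) ≈-refl (W (+ j - + b)) (binom D i j) (c · mono e))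
        (≈-trans (⊛-congʳ (binom D i j) (W-up (+ j - + b) a i (index i j eq)))
        (≈-trans (R.*-assoc (W (+ 1 + (+ j - + b))) (mono (D ℕ.* i)) (binom D i j))
        (⊛-congʳ (mono (D ℕ.* i) ⊛ binom D i j) (mk≈ λ k → cong (λ z → W z k) (shiftℤ j)))))) ⟩
    diag n (Term b) ⊕ diag n (λ i j → W (+ suc j - + b) ⊛ (mono (D ℕ.* i) ⊛ binom D i j)) ≈⟨ diag-split n (Term b) (Term b) (λ i j → W (+ suc j - + b) ⊛ (mono (D ℕ.* i) ⊛ binom D i j))
        (λ i j → R.distribˡ (W (+ suc j - + b)) (binom D i (suc j)) (mono (D ℕ.* suc i) ⊛ binom D (suc i) j))
        (λ { zero → ≈-refl ; (suc i) → ≈-refl })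
        (λ j → ⊛-congˡ (W (+ suc j - + b)) (≈-sym (≈-trans (R.*-identityʳ (mono (D ℕ.* 0))) (≈-trans (mono-cong (ℕₚ.*-zeroʳ D)) mono-0)))) ⟨
    diag (suc n) (Term b) ∎
    where
    e = A ℕ.+ D ℕ.* a
    n = a ℕ.+ b
    index : ∀ i j → i ℕ.+ j ≡ n → + i ≡ + a - (+ j - + b)
    index i j eq = trans (ZS.solve 2 (λ i j → i =ᶻ (i +ᶻ j) -ᶻ j) refl (+ i) (+ j))
      (trans (cong (_- + j) (trans (sym (ℤₚ.pos-+ i j)) (trans (cong +_ eq) (ℤₚ.pos-+ a b))))
      (ZS.solve 3 (λ a b j → (a +ᶻ b) -ᶻ j =ᶻ a -ᶻ (j -ᶻ b)) refl (+ a) (+ b) (+ j)))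
    shiftℤ : ∀ j → + 1 + (+ j - + b) ≡ + suc j - + b
    shiftℤ j = ZS.solve 2 (λ j b → #ᶻ 1 +ᶻ (j -ᶻ b) =ᶻ (#ᶻ 1 +ᶻ j) -ᶻ b) refl (+ j) (+ b)
  finite zero (suc b) = begin
    one ⊛ (prodB b ⊛ factor c e) ≈⟨ R.*-assoc one (prodB b) (factor c e) ⟨
    (one ⊛ prodB b) ⊛ factor c e ≈⟨ ⊛-congʳ (factor c e) (finite zero b) ⟩
    diag b (Term b) ⊛ (one ⊕ c · mono e) ≈⟨ ≈-trans (R.distribˡ (diag b (Term b)) one (c · mono e))
        (≈-trans (⊕-cong (R.*-identityʳ (diag b (Term b))) (diag-⊛ b (Term b) (c · mono e))) (R.+-comm (diag b (Term b)) (diag b (λ i j → Term b i j ⊛ (c · mono e))))) ⟩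
    diag b (λ i j → Term b i j ⊛ (c · mono e)) ⊕ diag b (Term b) ≈⟨ ⊕-cong (diag-cong b λ i j eq →
        ≈-trans (solve∙ 3 (λ w b m → (w ∙ b) ∙ m ⊜ (w ∙ m) ∙ b) ≈-refl (W (+ j - + b)) (binom D i j) (c · mono e))
        (≈-trans (⊛-congʳ (binom D i j) (W-down (+ j - + b) b j (ZS.solve 2 (λ j b → j =ᶻ b +ᶻ (j -ᶻ b)) refl (+ j) (+ b))))
        (≈-trans (R.*-assoc (W (+ j - + b - + 1)) (mono (D ℕ.* j)) (binom D i j))
        (⊛-congʳ (mono (D ℕ.* j) ⊛ binom D i j) (mk≈ λ k → cong (λ z → W z k) (ZS.solve 2 (λ j b → j -ᶻ b -ᶻ #ᶻ 1 =ᶻ j -ᶻ (#ᶻ 1 +ᶻ b)) refl (+ j) (+ b)))))))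
        (diag-cong b λ i j eq → ⊛-congʳ (binom D i j) (mk≈ λ k → cong (λ z → W z k) (shiftℤ j))) ⟩
    diag b (λ i j → W (+ j - + suc b) ⊛ (mono (D ℕ.* j) ⊛ binom D i j)) ⊕ diag b (λ i j → W (+ suc j - + suc b) ⊛ binom D i j) ≈⟨ diag-split b (Term (suc b))
        (λ i j → W (+ j - + suc b) ⊛ (mono (D ℕ.* j) ⊛ binom D i j)) (λ i j → W (+ suc j - + suc b) ⊛ binom D i j)
        (λ i j → ≈-trans (⊛-congˡ (W (+ suc j - + suc b)) (binom-pascal′ D i j)) (R.distribˡ (W (+ suc j - + suc b)) (mono (D ℕ.* suc j) ⊛ binom D i (suc j)) (binom D (suc i) j)))
        (λ i → ⊛-congˡ (W (+ 0 - + suc b)) (≈-sym (≈-trans (⊛-cong (≈-trans (mono-cong (ℕₚ.*-zeroʳ D)) mono-0) (corner i)) (R.*-identityˡ one))))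
        (λ j → ≈-refl) ⟨
    diag (suc b) (Term (suc b)) ∎
    where
    e = B ℕ.+ D ℕ.* b
    corner : ∀ i → binom D i 0 ≈ one
    corner zero = ≈-refl
    corner (suc i) = ≈-refl
    shiftℤ : ∀ j → + j - + b ≡ + suc j - + suc b
    shiftℤ j = ZS.solve 2 (λ j b → j -ᶻ b =ᶻ (#ᶻ 1 +ᶻ j) -ᶻ (#ᶻ 1 +ᶻ b)) refl (+ j) (+ b)

  W-vanish : ∀ {m} z → m ℕ.< ∣ z ∣ → Agree m (W z) 𝟘
  W-vanish z m<z = ·mono-agree (pw c z) (ℕₚ.<-≤-trans m<z (∣∣≤thExp A B z))

  -- From i + j = 4m: if one index is below m, the other exceeds 3m, so |j - 2m| > m. Hence either
  -- the binomial has reached its limit or the theta term is negligible.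
  far : ∀ m i j → i ℕ.+ j ≡ (m ℕ.+ m) ℕ.+ (m ℕ.+ m) → (m ℕ.≤ i × m ℕ.≤ j) ⊎ m ℕ.< ∣ + j - + (m ℕ.+ m) ∣
  far m i j e with m ℕ.≤? i | m ℕ.≤? j
  ... | yes p | yes r = inj₁ (p , r)
  ... | _ | no r = inj₂ (subst (m ℕ.<_) (sym (trans (cong ∣_∣ (trans (ℤₚ.m-n≡m⊖n j (m ℕ.+ m)) (ℤₚ.⊖-< (ℕₚ.<-≤-trans j<m (ℕₚ.m≤m+n m m)))))
        (ℤₚ.∣-i∣≡∣i∣ (+ (m ℕ.+ m ℕ.∸ j)))))
      (ℕₚ.m+n≤o⇒m≤o∸n (suc m) (ℕₚ.≤-trans (ℕₚ.≤-reflexive (sym (ℕₚ.+-suc m j))) (ℕₚ.+-monoʳ-≤ m j<m))))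
    where j<m = ℕₚ.≰⇒> r
  ... | no p | yes _ = inj₂ (subst (m ℕ.<_) (sym (cong ∣_∣ (trans (ℤₚ.m-n≡m⊖n j (m ℕ.+ m)) (ℤₚ.⊖-≥ (ℕₚ.≤-trans (ℕₚ.m≤n+m (m ℕ.+ m) (suc m)) big)))))
      (ℕₚ.m+n≤o⇒m≤o∸n (suc m) big))
    where
    i<m = ℕₚ.≰⇒> p
    big : suc m ℕ.+ (m ℕ.+ m) ℕ.≤ j
    big = ℕₚ.+-cancelˡ-≤ i _ _ (ℕₚ.≤-trans (ℕₚ.≤-reflexive (ℕₚ.+-suc i (m ℕ.+ (m ℕ.+ m)))) (ℕₚ.≤-trans (ℕₚ.+-monoˡ-≤ (m ℕ.+ (m ℕ.+ m)) i<m)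
      (ℕₚ.≤-reflexive (trans (sym (ℕₚ.+-assoc m m (m ℕ.+ m))) (sym e)))))

  window-agree : ∀ m n → m ℕ.≤ n → Agree m (diag (n ℕ.+ n) (λ i j → W (+ j - + n))) (th A B c)
  window-agree m n m≤n k k≤m = trans (at (diag-list (n ℕ.+ n) W f) k) 
    (HasSum-window k (HasSum-th A B c) (Uniqueₚ.applyUpTo⁺₁ f (suc (n ℕ.+ n)) distinct) cov₁)
    where
    f : ℕ → ℤ
    f j = + j - + n
    distinct : ∀ {i j} → i ℕ.< j → j ℕ.< suc (n ℕ.+ n) → f i ≢ f j
    distinct {i} {j} i<j _ e = ℕₚ.<⇒≢ i<j (ℤₚ.+-injective (trans (undo i) (trans (cong (_+ + n) e) (sym (undo j)))))
      where
      undo : ∀ i → + i ≡ f i + + n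
      undo i = ZS.solve 2 (λ i n → i =ᶻ i -ᶻ n +ᶻ n) refl (+ i) (+ n)
    inside : ∀ z → ∣ z ∣ ℕ.≤ n → z ∈ applyUpTo f (suc (n ℕ.+ n))
    inside (+ x) x≤n = subst (_∈ applyUpTo f (suc (n ℕ.+ n)))
      (trans (cong (_- + n) (ℤₚ.pos-+ x n)) (ZS.solve 2 (λ x n → x +ᶻ n -ᶻ n =ᶻ x) refl (+ x) (+ n)))
      (∈-applyUpTo⁺ f (s≤s (ℕₚ.+-monoˡ-≤ n x≤n)))
    inside -[1+ x ] x<n = subst (_∈ applyUpTo f (suc (n ℕ.+ n)))
      (trans (cong (λ t → + (n ℕ.∸ suc x) - t) (trans (cong +_ (sym (ℕₚ.m∸n+n≡m x<n))) (ℤₚ.pos-+ (n ℕ.∸ suc x) (suc x))))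
        (ZS.solve 2 (λ a b → a -ᶻ (a +ᶻ b) =ᶻ -ᶻ b) refl (+ (n ℕ.∸ suc x)) (+ suc x)))
      (∈-applyUpTo⁺ f (s≤s (ℕₚ.≤-trans (ℕₚ.m∸n≤m n (suc x)) (ℕₚ.m≤m+n n n))))
    cov₁ : ∀ z → z ∈ applyUpTo f (suc (n ℕ.+ n)) ⊎ W z k ≡ + 0
    cov₁ z with ∣ z ∣ ℕ.≤? n
    ... | yes p = inj₁ (inside z p)
    ... | no p = inj₂ (W-vanish z (ℕₚ.≤-<-trans (ℕₚ.≤-trans k≤m m≤n) (ℕₚ.≰⇒> p)) k ℕₚ.≤-refl)

  triple : th A B c ≈ poch c A D ⊛ poch c B D ⊛ E∞ D
  -- With 2m factors of each kind every index of the diagonal falls under one of the two cases of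
  -- `far` at precision m.
  triple = agree⇒≈ λ m → let n = m ℕ.+ m; m≤n = ℕₚ.m≤m+n m m in agree-sym (agree-trans
    (agree-⊛ {g = E∞ D} (agree-mono m≤n (agree-⊛ (∏-agree (tame-poch c A D) n) (∏-agree (tame-poch c B D) n))) (λ _ _ → refl))
    (agree-trans (≈⇒agree (≈-trans (⊛-congʳ (E∞ D) (finite n n)) (diag-⊛ (n ℕ.+ n) (Term n) (E∞ D))))
    (agree-trans (diag-agree (n ℕ.+ n) (λ i j e → limit m i j e)) (window-agree m n m≤n))))
    where
    limit : ∀ m i j → i ℕ.+ j ≡ (m ℕ.+ m) ℕ.+ (m ℕ.+ m) → Agree m (Term (m ℕ.+ m) i j ⊛ E∞ D) (W (+ j - + (m ℕ.+ m)))
    limit m i j e with far m i j e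
    ... | inj₁ (m≤i , m≤j) = agree-trans (≈⇒agree (R.*-assoc w₀ (binom D i j) (E∞ D)))
      (agree-trans (agree-⊛ {f = w₀} (λ _ _ → refl) (binom-limit D m≤i m≤j)) (≈⇒agree (R.*-identityʳ w₀)))
      where w₀ = W (+ j - + (m ℕ.+ m))
    ... | inj₂ m<z = agree-trans (≈⇒agree (R.*-assoc w₀ (binom D i j) (E∞ D)))
      (agree-trans (vanish-⊛ (binom D i j ⊛ E∞ D) (W-vanish (+ j - + (m ℕ.+ m)) m<z)) (agree-sym (W-vanish (+ j - + (m ℕ.+ m)) m<z)))
      where w₀ = W (+ j - + (m ℕ.+ m))

jacobi-triple : ∀ A B .{{_ : NonZero A}} .{{_ : NonZero B}} c → c * c ≡ + 1 →
  th A B c ≈ poch c A (A ℕ.+ B) ⊛ poch c B (A ℕ.+ B) ⊛ poch -1ℤ (A ℕ.+ B) (A ℕ.+ B)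
jacobi-triple A B c cc = JacobiTriple.triple A B c cc

-- Product identities

-- m a d = (q^a; q^d)_∞ and p a d = (-q^a; q^d)_∞
m p : ℕ → ℕ → Series
m = poch -1ℤ
p = poch (+ 1)

poch-cong : ∀ c {a a′ d d′} → a ≡ a′ → d ≡ d′ → poch c a d ≈ poch c a′ d′
poch-cong c refl refl = ≈-refl

split₂ : ∀ c a d .{{_ : NonZero a}} .{{_ : NonZero d}} → poch c a d ≈ poch c a (2 ℕ.* d) ⊛ poch c (a ℕ.+ d) (2 ℕ.* d)
split₂ c a d = ≈-trans (poch-split c a d 1) (⊛-cong
  (≈-trans (R.*-identityˡ (poch c (a ℕ.+ d ℕ.* 0) (d ℕ.* 2)))
    (poch-cong c (trans (cong (a ℕ.+_) (ℕₚ.*-zeroʳ d)) (ℕₚ.+-identityʳ a)) (ℕₚ.*-comm d 2)))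
  (poch-cong c (cong (a ℕ.+_) (ℕₚ.*-identityʳ d)) (ℕₚ.*-comm d 2)))

split₅ : ∀ c a d .{{_ : NonZero a}} .{{_ : NonZero d}} → let e = 5 ℕ.* d in
  poch c a d ≈ poch c a e ⊛ poch c (a ℕ.+ d) e ⊛ poch c (a ℕ.+ 2 ℕ.* d) e ⊛ poch c (a ℕ.+ 3 ℕ.* d) e ⊛ poch c (a ℕ.+ 4 ℕ.* d) e
split₅ c a d = ≈-trans (poch-split c a d 4) (⊛-cong (⊛-cong (⊛-cong (⊛-cong
  (≈-trans (R.*-identityˡ (poch c (a ℕ.+ d ℕ.* 0) (d ℕ.* 5)))
    (poch-cong c (trans (cong (a ℕ.+_) (ℕₚ.*-zeroʳ d)) (ℕₚ.+-identityʳ a)) (ℕₚ.*-comm d 5)))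
  (poch-cong c (cong (a ℕ.+_) (ℕₚ.*-identityʳ d)) (ℕₚ.*-comm d 5)))
  (poch-cong c (cong (a ℕ.+_) (ℕₚ.*-comm d 2)) (ℕₚ.*-comm d 5)))
  (poch-cong c (cong (a ℕ.+_) (ℕₚ.*-comm d 3)) (ℕₚ.*-comm d 5)))
  (poch-cong c (cong (a ℕ.+_) (ℕₚ.*-comm d 4)) (ℕₚ.*-comm d 5)))

f₂ f₄ : Series
f₂ = m 2 2
f₄ = m 4 4

jacobi⁻ : ∀ A B .{{_ : NonZero A}} .{{_ : NonZero B}} → th A B -1ℤ ≈ m A (A ℕ.+ B) ⊛ m B (A ℕ.+ B) ⊛ m (A ℕ.+ B) (A ℕ.+ B)
jacobi⁻ A B = jacobi-triple A B -1ℤ refl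

jacobi⁺ : ∀ A B .{{_ : NonZero A}} .{{_ : NonZero B}} → th A B (+ 1) ≈ p A (A ℕ.+ B) ⊛ p B (A ℕ.+ B) ⊛ m (A ℕ.+ B) (A ℕ.+ B)
jacobi⁺ A B = jacobi-triple A B (+ 1) refl

euler-mod5 : euler ≈ m 1 5 ⊛ m 2 5 ⊛ m 3 5 ⊛ m 4 5 ⊛ m 5 5
euler-mod5 = split₅ -1ℤ 1 1

f₂-mod4 : f₂ ≈ m 2 4 ⊛ f₄
f₂-mod4 = split₂ -1ℤ 2 2

m24-mod20 : m 2 4 ≈ m 2 20 ⊛ m 6 20 ⊛ m 10 20 ⊛ m 14 20 ⊛ m 18 20
m24-mod20 = split₅ -1ℤ 2 4

-- Everything splits into residue classes modulo 20. The classes 6 and 14 of (q²;q⁴)_∞ are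
-- (q³;q¹⁰)(-q³;q¹⁰) and (q⁷;q¹⁰)(-q⁷;q¹⁰): the plus products build f(q⁷, q³), and the minus
-- products complete (q;q)_∞.
product-HG4 : f₂ ⊛ (f⁻ 4 1 ⊛ f⁻ 12 8) ≈ (euler ⊛ f₄) ⊛ f⁺ 7 3
product-HG4 = begin
  f₂ ⊛ (f⁻ 4 1 ⊛ f⁻ 12 8)
    ≈⟨ ⊛-cong (≈-trans f₂-mod4 (⊛-congʳ f₄ m24-mod20)) (⊛-cong (jacobi⁻ 4 1) (jacobi⁻ 12 8)) ⟩
  (m 2 20 ⊛ m 6 20 ⊛ m 10 20 ⊛ m 14 20 ⊛ m 18 20 ⊛ f₄) ⊛ (m 4 5 ⊛ m 1 5 ⊛ m 5 5 ⊛ (m 12 20 ⊛ m 8 20 ⊛ m 20 20))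
    ≈⟨ solve∙ 12 (λ a b c d e f g h i j k l → (a ∙ b ∙ c ∙ d ∙ e ∙ f) ∙ (g ∙ h ∙ i ∙ (j ∙ k ∙ l))
         ⊜ (h ∙ g ∙ i ∙ f) ∙ ((a ∙ j) ∙ (k ∙ e) ∙ (c ∙ l) ∙ d ∙ b)) ≈-refl
         (m 2 20) (m 6 20) (m 10 20) (m 14 20) (m 18 20) f₄ (m 4 5) (m 1 5) (m 5 5) (m 12 20) (m 8 20) (m 20 20) ⟩
  (m 1 5 ⊛ m 4 5 ⊛ m 5 5 ⊛ f₄) ⊛ ((m 2 20 ⊛ m 12 20) ⊛ (m 8 20 ⊛ m 18 20) ⊛ (m 10 20 ⊛ m 20 20) ⊛ m 14 20 ⊛ m 6 20)
    ≈⟨ ⊛-congˡ (m 1 5 ⊛ m 4 5 ⊛ m 5 5 ⊛ f₄) (⊛-cong (⊛-cong (⊛-cong (⊛-cong (split₂ -1ℤ 2 10) (split₂ -1ℤ 8 10)) (split₂ -1ℤ 10 10)) (poch-pair 7 10)) (poch-pair 3 10)) ⟨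
  (m 1 5 ⊛ m 4 5 ⊛ m 5 5 ⊛ f₄) ⊛ (m 2 10 ⊛ m 8 10 ⊛ m 10 10 ⊛ (p 7 10 ⊛ m 7 10) ⊛ (p 3 10 ⊛ m 3 10))
    ≈⟨ solve∙ 11 (λ a b c f d e g h i j k → (a ∙ b ∙ c ∙ f) ∙ (d ∙ e ∙ g ∙ (h ∙ i) ∙ (j ∙ k))
         ⊜ ((a ∙ (d ∙ i) ∙ (k ∙ e) ∙ b ∙ c) ∙ f) ∙ (h ∙ j ∙ g)) ≈-refl
         (m 1 5) (m 4 5) (m 5 5) f₄ (m 2 10) (m 8 10) (m 10 10) (p 7 10) (m 7 10) (p 3 10) (m 3 10) ⟩
  ((m 1 5 ⊛ (m 2 10 ⊛ m 7 10) ⊛ (m 3 10 ⊛ m 8 10) ⊛ m 4 5 ⊛ m 5 5) ⊛ f₄) ⊛ (p 7 10 ⊛ p 3 10 ⊛ m 10 10)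
    ≈⟨ ⊛-cong (⊛-congʳ f₄ (≈-trans euler-mod5 (⊛-congʳ (m 5 5) (⊛-congʳ (m 4 5) (⊛-cong (⊛-congˡ (m 1 5) (split₂ -1ℤ 2 5)) (split₂ -1ℤ 3 5)))))) (jacobi⁺ 7 3) ⟨
  (euler ⊛ f₄) ⊛ f⁺ 7 3 ∎

-- The same mechanism with the classes 2 and 18 modulo 20, which supply (-q;q¹⁰) and (-q⁹;q¹⁰).
product-GH4 : f₂ ⊛ (f⁻ 3 2 ⊛ f⁻ 16 4) ≈ (euler ⊛ f₄) ⊛ f⁺ 9 1
product-GH4 = begin
  f₂ ⊛ (f⁻ 3 2 ⊛ f⁻ 16 4)
    ≈⟨ ⊛-cong (≈-trans f₂-mod4 (⊛-congʳ f₄ m24-mod20)) (⊛-cong (jacobi⁻ 3 2) (jacobi⁻ 16 4)) ⟩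
  (m 2 20 ⊛ m 6 20 ⊛ m 10 20 ⊛ m 14 20 ⊛ m 18 20 ⊛ f₄) ⊛ (m 3 5 ⊛ m 2 5 ⊛ m 5 5 ⊛ (m 16 20 ⊛ m 4 20 ⊛ m 20 20))
    ≈⟨ solve∙ 12 (λ a b c d e f g h i j k l → (a ∙ b ∙ c ∙ d ∙ e ∙ f) ∙ (g ∙ h ∙ i ∙ (j ∙ k ∙ l))
         ⊜ (h ∙ g ∙ i ∙ f) ∙ ((k ∙ d) ∙ (b ∙ j) ∙ (c ∙ l) ∙ e ∙ a)) ≈-refl
         (m 2 20) (m 6 20) (m 10 20) (m 14 20) (m 18 20) f₄ (m 3 5) (m 2 5) (m 5 5) (m 16 20) (m 4 20) (m 20 20) ⟩
  (m 2 5 ⊛ m 3 5 ⊛ m 5 5 ⊛ f₄) ⊛ ((m 4 20 ⊛ m 14 20) ⊛ (m 6 20 ⊛ m 16 20) ⊛ (m 10 20 ⊛ m 20 20) ⊛ m 18 20 ⊛ m 2 20)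
    ≈⟨ ⊛-congˡ (m 2 5 ⊛ m 3 5 ⊛ m 5 5 ⊛ f₄) (⊛-cong (⊛-cong (⊛-cong (⊛-cong (split₂ -1ℤ 4 10) (split₂ -1ℤ 6 10)) (split₂ -1ℤ 10 10)) (poch-pair 9 10)) (poch-pair 1 10)) ⟨
  (m 2 5 ⊛ m 3 5 ⊛ m 5 5 ⊛ f₄) ⊛ (m 4 10 ⊛ m 6 10 ⊛ m 10 10 ⊛ (p 9 10 ⊛ m 9 10) ⊛ (p 1 10 ⊛ m 1 10))
    ≈⟨ solve∙ 11 (λ a b c f d e g h i j k → (a ∙ b ∙ c ∙ f) ∙ (d ∙ e ∙ g ∙ (h ∙ i) ∙ (j ∙ k))
         ⊜ (((k ∙ e) ∙ a ∙ b ∙ (d ∙ i) ∙ c) ∙ f) ∙ (h ∙ j ∙ g)) ≈-refl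
         (m 2 5) (m 3 5) (m 5 5) f₄ (m 4 10) (m 6 10) (m 10 10) (p 9 10) (m 9 10) (p 1 10) (m 1 10) ⟩
  (((m 1 10 ⊛ m 6 10) ⊛ m 2 5 ⊛ m 3 5 ⊛ (m 4 10 ⊛ m 9 10) ⊛ m 5 5) ⊛ f₄) ⊛ (p 9 10 ⊛ p 1 10 ⊛ m 10 10)
    ≈⟨ ⊛-cong (⊛-congʳ f₄ (≈-trans euler-mod5 (⊛-congʳ (m 5 5) (⊛-cong (⊛-congʳ (m 3 5) (⊛-congʳ (m 2 5) (split₂ -1ℤ 1 5))) (split₂ -1ℤ 4 5))))) (jacobi⁺ 9 1) ⟨
  (euler ⊛ f₄) ⊛ f⁺ 9 1 ∎

-- Modulo 10 the class a modulo 5 splits into an odd half and an even half. Under q ↦ -q the even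
-- half is fixed, hence squared, and the odd half meets its sign change in `poch-pair`.
alt-odd : ∀ a .{{_ : NonZero a}} .{{_ : NonZero (a ℕ.+ 5)}} → -1ℤ ^ a ≡ -1ℤ → -1ℤ ^ (a ℕ.+ 5) ≡ + 1 →
  m a 5 ⊛ alt (m a 5) ≈ m (2 ℕ.* a) 20 ⊛ (m (a ℕ.+ 5) 10 ⊛ m (a ℕ.+ 5) 10)
alt-odd a odd even = begin
  m a 5 ⊛ alt (m a 5) ≈⟨ ⊛-cong (split₂ -1ℤ a 5) (≈-trans (CL.≈-cong alt-clinear (split₂ -1ℤ a 5)) (≈-trans (alt-⊛ (m a 10) (m (a ℕ.+ 5) 10))
     (⊛-cong (≈-trans (alt-poch -1ℤ a 10 refl) (mk≈ λ n → cong (λ s → poch (s * -1ℤ) a 10 n) odd))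
             (≈-trans (alt-poch -1ℤ (a ℕ.+ 5) 10 refl) (mk≈ λ n → cong (λ s → poch (s * -1ℤ) (a ℕ.+ 5) 10 n) even))))) ⟩
  m a 10 ⊛ m (a ℕ.+ 5) 10 ⊛ (p a 10 ⊛ m (a ℕ.+ 5) 10)
    ≈⟨ solve∙ 3 (λ x y z → x ∙ y ∙ (z ∙ y) ⊜ (z ∙ x) ∙ (y ∙ y)) ≈-refl (m a 10) (m (a ℕ.+ 5) 10) (p a 10) ⟩
  (p a 10 ⊛ m a 10) ⊛ (m (a ℕ.+ 5) 10 ⊛ m (a ℕ.+ 5) 10) ≈⟨ ⊛-congʳ (m (a ℕ.+ 5) 10 ⊛ m (a ℕ.+ 5) 10) (poch-pair a 10) ⟩
  m (2 ℕ.* a) 20 ⊛ (m (a ℕ.+ 5) 10 ⊛ m (a ℕ.+ 5) 10) ∎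

alt-even : ∀ a .{{_ : NonZero a}} .{{_ : NonZero (a ℕ.+ 5)}} → -1ℤ ^ a ≡ + 1 → -1ℤ ^ (a ℕ.+ 5) ≡ -1ℤ →
  m a 5 ⊛ alt (m a 5) ≈ m (2 ℕ.* (a ℕ.+ 5)) 20 ⊛ (m a 10 ⊛ m a 10)
alt-even a even odd = begin
  m a 5 ⊛ alt (m a 5) ≈⟨ ⊛-cong (split₂ -1ℤ a 5) (≈-trans (CL.≈-cong alt-clinear (split₂ -1ℤ a 5)) (≈-trans (alt-⊛ (m a 10) (m (a ℕ.+ 5) 10))
     (⊛-cong (≈-trans (alt-poch -1ℤ a 10 refl) (mk≈ λ n → cong (λ s → poch (s * -1ℤ) a 10 n) even))
             (≈-trans (alt-poch -1ℤ (a ℕ.+ 5) 10 refl) (mk≈ λ n → cong (λ s → poch (s * -1ℤ) (a ℕ.+ 5) 10 n) odd))))) ⟩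
  m a 10 ⊛ m (a ℕ.+ 5) 10 ⊛ (m a 10 ⊛ p (a ℕ.+ 5) 10)
    ≈⟨ solve∙ 3 (λ x y z → x ∙ y ∙ (x ∙ z) ⊜ (z ∙ y) ∙ (x ∙ x)) ≈-refl (m a 10) (m (a ℕ.+ 5) 10) (p (a ℕ.+ 5) 10) ⟩
  (p (a ℕ.+ 5) 10 ⊛ m (a ℕ.+ 5) 10) ⊛ (m a 10 ⊛ m a 10) ≈⟨ ⊛-congʳ (m a 10 ⊛ m a 10) (poch-pair (a ℕ.+ 5) 10) ⟩
  m (2 ℕ.* (a ℕ.+ 5)) 20 ⊛ (m a 10 ⊛ m a 10) ∎

euler-alt : euler ⊛ alt euler ≈ m 2 4 ⊛ (f₂ ⊛ f₂)
euler-alt = begin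
  euler ⊛ alt euler ≈⟨ ⊛-cong (split₂ -1ℤ 1 1) (≈-trans (CL.≈-cong alt-clinear (split₂ -1ℤ 1 1)) (≈-trans (alt-⊛ (m 1 2) f₂)
     (⊛-cong (alt-poch -1ℤ 1 2 refl) (alt-poch -1ℤ 2 2 refl)))) ⟩
  m 1 2 ⊛ f₂ ⊛ (p 1 2 ⊛ f₂) ≈⟨ solve∙ 3 (λ x y z → x ∙ y ∙ (z ∙ y) ⊜ (z ∙ x) ∙ (y ∙ y)) ≈-refl (m 1 2) f₂ (p 1 2) ⟩
  (p 1 2 ⊛ m 1 2) ⊛ (f₂ ⊛ f₂) ≈⟨ ⊛-congʳ (f₂ ⊛ f₂) (poch-pair 1 2) ⟩
  m 2 4 ⊛ (f₂ ⊛ f₂) ∎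

f₂-mod10 : f₂ ≈ m 2 10 ⊛ m 4 10 ⊛ m 6 10 ⊛ m 8 10 ⊛ m 10 10
f₂-mod10 = split₅ -1ℤ 2 2

triple-alt : ∀ a b c → (a ⊛ b ⊛ c) ⊛ alt (a ⊛ b ⊛ c) ≈ (a ⊛ alt a) ⊛ (b ⊛ alt b) ⊛ (c ⊛ alt c)
triple-alt a b c = ≈-trans (⊛-congˡ (a ⊛ b ⊛ c) (≈-trans (alt-⊛ (a ⊛ b) c) (⊛-congʳ (alt c) (alt-⊛ a b))))
  (solve∙ 6 (λ a b c x y z → (a ∙ b ∙ c) ∙ (x ∙ y ∙ z) ⊜ (a ∙ x) ∙ (b ∙ y) ∙ (c ∙ z)) ≈-refl a b c (alt a) (alt b) (alt c))

-- After `alt-odd` and `alt-even` only even powers remain; the classes 8 and 12 modulo 20 then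
-- provide (-q⁴;q¹⁰) and (-q⁶;q¹⁰) through `poch-pair`.
product-GG⁻ : f₂ ⊛ (f⁻ 3 2 ⊛ alt (f⁻ 3 2)) ≈ (euler ⊛ alt euler) ⊛ f⁺ 6 4
product-GG⁻ = begin
  f₂ ⊛ (f⁻ 3 2 ⊛ alt (f⁻ 3 2))
    ≈⟨ ⊛-congˡ f₂ (≈-trans (⊛-cong (jacobi⁻ 3 2) (CL.≈-cong alt-clinear (jacobi⁻ 3 2))) (≈-trans (triple-alt (m 3 5) (m 2 5) (m 5 5))
         (⊛-cong (⊛-cong (alt-odd 3 refl refl) (alt-even 2 refl refl)) (alt-odd 5 refl refl)))) ⟩
  f₂ ⊛ (m 6 20 ⊛ (m 8 10 ⊛ m 8 10) ⊛ (m 14 20 ⊛ (m 2 10 ⊛ m 2 10)) ⊛ (m 10 20 ⊛ (m 10 10 ⊛ m 10 10)))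
    ≈⟨ solve∙ 7 (λ f a b c d e g → f ∙ (a ∙ (b ∙ b) ∙ (c ∙ (d ∙ d)) ∙ (e ∙ (g ∙ g))) ⊜ f ∙ (d ∙ b ∙ g ∙ g ∙ a ∙ c ∙ e ∙ (d ∙ b))) ≈-refl
         f₂ (m 6 20) (m 8 10) (m 14 20) (m 2 10) (m 10 20) (m 10 10) ⟩
  f₂ ⊛ (m 2 10 ⊛ m 8 10 ⊛ m 10 10 ⊛ m 10 10 ⊛ m 6 20 ⊛ m 14 20 ⊛ m 10 20 ⊛ (m 2 10 ⊛ m 8 10))
    ≈⟨ ⊛-congˡ f₂ (⊛-congˡ (m 2 10 ⊛ m 8 10 ⊛ m 10 10 ⊛ m 10 10 ⊛ m 6 20 ⊛ m 14 20 ⊛ m 10 20) (⊛-cong (split₂ -1ℤ 2 10) (split₂ -1ℤ 8 10))) ⟩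
  f₂ ⊛ (m 2 10 ⊛ m 8 10 ⊛ m 10 10 ⊛ m 10 10 ⊛ m 6 20 ⊛ m 14 20 ⊛ m 10 20 ⊛ ((m 2 20 ⊛ m 12 20) ⊛ (m 8 20 ⊛ m 18 20)))
    ≈⟨ solve∙ 11 (λ f a b c d e g h i j k → f ∙ (a ∙ b ∙ c ∙ c ∙ d ∙ e ∙ g ∙ ((h ∙ i) ∙ (j ∙ k)))
         ⊜ (h ∙ d ∙ g ∙ e ∙ k) ∙ f ∙ (a ∙ b ∙ c ∙ c ∙ j ∙ i)) ≈-refl
         f₂ (m 2 10) (m 8 10) (m 10 10) (m 6 20) (m 14 20) (m 10 20) (m 2 20) (m 12 20) (m 8 20) (m 18 20) ⟩
  (m 2 20 ⊛ m 6 20 ⊛ m 10 20 ⊛ m 14 20 ⊛ m 18 20) ⊛ f₂ ⊛ (m 2 10 ⊛ m 8 10 ⊛ m 10 10 ⊛ m 10 10 ⊛ m 8 20 ⊛ m 12 20)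
    ≈⟨ ⊛-cong (⊛-congʳ f₂ m24-mod20) (⊛-cong (⊛-congˡ (m 2 10 ⊛ m 8 10 ⊛ m 10 10 ⊛ m 10 10) (poch-pair 4 10)) (poch-pair 6 10)) ⟨
  m 2 4 ⊛ f₂ ⊛ (m 2 10 ⊛ m 8 10 ⊛ m 10 10 ⊛ m 10 10 ⊛ (p 4 10 ⊛ m 4 10) ⊛ (p 6 10 ⊛ m 6 10))
    ≈⟨ solve∙ 9 (λ x f a b c d e g h → x ∙ f ∙ (a ∙ b ∙ c ∙ c ∙ (d ∙ e) ∙ (g ∙ h)) ⊜ (x ∙ (f ∙ (a ∙ e ∙ h ∙ b ∙ c))) ∙ (g ∙ d ∙ c)) ≈-refl
         (m 2 4) f₂ (m 2 10) (m 8 10) (m 10 10) (p 4 10) (m 4 10) (p 6 10) (m 6 10) ⟩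
  (m 2 4 ⊛ (f₂ ⊛ (m 2 10 ⊛ m 4 10 ⊛ m 6 10 ⊛ m 8 10 ⊛ m 10 10))) ⊛ (p 6 10 ⊛ p 4 10 ⊛ m 10 10)
    ≈⟨ ⊛-cong (≈-trans euler-alt (⊛-congˡ (m 2 4) (⊛-congˡ f₂ f₂-mod10))) (jacobi⁺ 6 4) ⟨
  (euler ⊛ alt euler) ⊛ f⁺ 6 4 ∎

product-HH⁻ : f₂ ⊛ (f⁻ 4 1 ⊛ alt (f⁻ 4 1)) ≈ (euler ⊛ alt euler) ⊛ f⁺ 8 2
product-HH⁻ = begin
  f₂ ⊛ (f⁻ 4 1 ⊛ alt (f⁻ 4 1))
    ≈⟨ ⊛-congˡ f₂ (≈-trans (⊛-cong (jacobi⁻ 4 1) (CL.≈-cong alt-clinear (jacobi⁻ 4 1))) (≈-trans (triple-alt (m 4 5) (m 1 5) (m 5 5))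
         (⊛-cong (⊛-cong (alt-even 4 refl refl) (alt-odd 1 refl refl)) (alt-odd 5 refl refl)))) ⟩
  f₂ ⊛ (m 18 20 ⊛ (m 4 10 ⊛ m 4 10) ⊛ (m 2 20 ⊛ (m 6 10 ⊛ m 6 10)) ⊛ (m 10 20 ⊛ (m 10 10 ⊛ m 10 10)))
    ≈⟨ solve∙ 7 (λ f a b c d e g → f ∙ (a ∙ (b ∙ b) ∙ (c ∙ (d ∙ d)) ∙ (e ∙ (g ∙ g))) ⊜ f ∙ (b ∙ d ∙ g ∙ g ∙ a ∙ c ∙ e ∙ (b ∙ d))) ≈-refl
         f₂ (m 18 20) (m 4 10) (m 2 20) (m 6 10) (m 10 20) (m 10 10) ⟩
  f₂ ⊛ (m 4 10 ⊛ m 6 10 ⊛ m 10 10 ⊛ m 10 10 ⊛ m 18 20 ⊛ m 2 20 ⊛ m 10 20 ⊛ (m 4 10 ⊛ m 6 10))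
    ≈⟨ ⊛-congˡ f₂ (⊛-congˡ (m 4 10 ⊛ m 6 10 ⊛ m 10 10 ⊛ m 10 10 ⊛ m 18 20 ⊛ m 2 20 ⊛ m 10 20) (⊛-cong (split₂ -1ℤ 4 10) (split₂ -1ℤ 6 10))) ⟩
  f₂ ⊛ (m 4 10 ⊛ m 6 10 ⊛ m 10 10 ⊛ m 10 10 ⊛ m 18 20 ⊛ m 2 20 ⊛ m 10 20 ⊛ ((m 4 20 ⊛ m 14 20) ⊛ (m 6 20 ⊛ m 16 20)))
    ≈⟨ solve∙ 11 (λ f a b c d e g h i j k → f ∙ (a ∙ b ∙ c ∙ c ∙ d ∙ e ∙ g ∙ ((h ∙ i) ∙ (j ∙ k)))
         ⊜ (e ∙ j ∙ g ∙ i ∙ d) ∙ f ∙ (a ∙ b ∙ c ∙ c ∙ h ∙ k)) ≈-refl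
         f₂ (m 4 10) (m 6 10) (m 10 10) (m 18 20) (m 2 20) (m 10 20) (m 4 20) (m 14 20) (m 6 20) (m 16 20) ⟩
  (m 2 20 ⊛ m 6 20 ⊛ m 10 20 ⊛ m 14 20 ⊛ m 18 20) ⊛ f₂ ⊛ (m 4 10 ⊛ m 6 10 ⊛ m 10 10 ⊛ m 10 10 ⊛ m 4 20 ⊛ m 16 20)
    ≈⟨ ⊛-cong (⊛-congʳ f₂ m24-mod20) (⊛-cong (⊛-congˡ (m 4 10 ⊛ m 6 10 ⊛ m 10 10 ⊛ m 10 10) (poch-pair 2 10)) (poch-pair 8 10)) ⟨
  m 2 4 ⊛ f₂ ⊛ (m 4 10 ⊛ m 6 10 ⊛ m 10 10 ⊛ m 10 10 ⊛ (p 2 10 ⊛ m 2 10) ⊛ (p 8 10 ⊛ m 8 10))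
    ≈⟨ solve∙ 9 (λ x f a b c d e g h → x ∙ f ∙ (a ∙ b ∙ c ∙ c ∙ (d ∙ e) ∙ (g ∙ h)) ⊜ (x ∙ (f ∙ (e ∙ a ∙ b ∙ h ∙ c))) ∙ (g ∙ d ∙ c)) ≈-refl
         (m 2 4) f₂ (m 4 10) (m 6 10) (m 10 10) (p 2 10) (m 2 10) (p 8 10) (m 8 10) ⟩
  (m 2 4 ⊛ (f₂ ⊛ (m 2 10 ⊛ m 4 10 ⊛ m 6 10 ⊛ m 8 10 ⊛ m 10 10))) ⊛ (p 8 10 ⊛ p 2 10 ⊛ m 10 10)
    ≈⟨ ⊛-cong (≈-trans euler-alt (⊛-congˡ (m 2 4) (⊛-congˡ f₂ f₂-mod10))) (jacobi⁺ 8 2) ⟨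
  (euler ⊛ alt euler) ⊛ f⁺ 8 2 ∎

-- Ramanujan's `φ` and `ψ` as products

φ ψ : Series
φ = f⁺ 1 1
ψ = f⁺ 3 1

κ≈p12 : κ ≈ p 1 2
κ≈p12 = ∏-cong λ k → ⊕-congˡ one (mk≈ λ n → sym (ℤₚ.*-identityˡ (mono (suc (2 ℕ.* k)) n)))

product-φ : κ ⊛ κ ⊛ f₂ ≈ φ
product-φ = ≈-trans (⊛-congʳ f₂ (⊛-cong κ≈p12 κ≈p12)) (≈-sym (jacobi⁺ 1 1))

κm2≈m24 : κm2 ≈ m 2 4
κm2≈m24 = ≈-trans (CL.≈-cong (dil-clinear 2) (≈-trans (CL.≈-cong alt-clinear κ≈p12) (alt-poch (+ 1) 1 2 refl))) (dil-poch 2 -1ℤ 1 2)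

ψ-product : ψ ≈ p 1 2 ⊛ f₄
ψ-product = ≈-trans (jacobi⁺ 3 1) (⊛-congʳ f₄ (≈-trans (R.*-comm (p 3 4) (p 1 4)) (≈-sym (split₂ (+ 1) 1 2))))

ψ₂-product : f⁺ 6 2 ≈ p 2 4 ⊛ m 8 8
ψ₂-product = ≈-trans (jacobi⁺ 6 2) (⊛-congʳ (m 8 8) (≈-trans (R.*-comm (p 6 8) (p 2 8)) (≈-sym (split₂ (+ 1) 2 4))))

-- Turns the reciprocal 1/κ(-q²)² of the theorem into a theta function: multiplied by (q²;q²)_∞ it
-- is ψ(q²).
product-ψ₂ : κm2 ⊛ κm2 ⊛ f⁺ 6 2 ≈ f₂
product-ψ₂ = begin
  κm2 ⊛ κm2 ⊛ f⁺ 6 2 ≈⟨ ⊛-cong (⊛-cong κm2≈m24 κm2≈m24) ψ₂-product ⟩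
  m 2 4 ⊛ m 2 4 ⊛ (p 2 4 ⊛ m 8 8) ≈⟨ solve∙ 3 (λ a b c → a ∙ a ∙ (b ∙ c) ⊜ a ∙ ((b ∙ a) ∙ c)) ≈-refl (m 2 4) (p 2 4) (m 8 8) ⟩
  m 2 4 ⊛ ((p 2 4 ⊛ m 2 4) ⊛ m 8 8) ≈⟨ ⊛-congˡ (m 2 4) (≈-trans (⊛-congʳ (m 8 8) (poch-pair 2 4)) (≈-sym (split₂ -1ℤ 4 4))) ⟩
  m 2 4 ⊛ f₄ ≈⟨ f₂-mod4 ⟨
  f₂ ∎

-- Rogers' method delivers ψ(q)φ(-q²); this converts it into φ(q) once the factors (q;q)_∞(q⁴;q⁴)_∞
-- are cancelled.
product-ψφ : f₂ ⊛ (ψ ⊛ f⁻ 2 2) ≈ (euler ⊛ f₄) ⊛ φ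
product-ψφ = begin
  f₂ ⊛ (ψ ⊛ f⁻ 2 2) ≈⟨ ⊛-congˡ f₂ (⊛-cong ψ-product (jacobi⁻ 2 2)) ⟩
  f₂ ⊛ (p 1 2 ⊛ f₄ ⊛ (m 2 4 ⊛ m 2 4 ⊛ f₄)) ≈⟨ solve∙ 4 (λ f p g a → f ∙ (p ∙ g ∙ (a ∙ a ∙ g)) ⊜ (a ∙ g) ∙ (a ∙ p ∙ f ∙ g)) ≈-refl f₂ (p 1 2) f₄ (m 2 4) ⟩
  (m 2 4 ⊛ f₄) ⊛ (m 2 4 ⊛ p 1 2 ⊛ f₂ ⊛ f₄) ≈⟨ ⊛-cong f₂-mod4 (⊛-congʳ f₄ (⊛-congʳ f₂ (⊛-congʳ (p 1 2) (poch-pair 1 2)))) ⟨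
  f₂ ⊛ ((p 1 2 ⊛ m 1 2) ⊛ p 1 2 ⊛ f₂ ⊛ f₄) ≈⟨ solve∙ 4 (λ f p a g → f ∙ ((p ∙ a) ∙ p ∙ f ∙ g) ⊜ ((a ∙ f) ∙ g) ∙ (p ∙ p ∙ f)) ≈-refl f₂ (p 1 2) (m 1 2) f₄ ⟩
  ((m 1 2 ⊛ f₂) ⊛ f₄) ⊛ (p 1 2 ⊛ p 1 2 ⊛ f₂) ≈⟨ ⊛-cong (⊛-congʳ f₄ (split₂ -1ℤ 1 1)) (jacobi⁺ 1 1) ⟨
  (euler ⊛ f₄) ⊛ φ ∎

product-ψψ⁻ : f₂ ⊛ (ψ ⊛ alt ψ) ≈ (euler ⊛ alt euler) ⊛ f⁺ 6 2
product-ψψ⁻ = begin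
  f₂ ⊛ (ψ ⊛ alt ψ) ≈⟨ ⊛-congˡ f₂ (⊛-cong ψ-product (≈-trans (CL.≈-cong alt-clinear ψ-product) (≈-trans (alt-⊛ (p 1 2) f₄)
      (⊛-cong (alt-poch (+ 1) 1 2 refl) (alt-poch -1ℤ 4 4 refl))))) ⟩
  f₂ ⊛ (p 1 2 ⊛ f₄ ⊛ (m 1 2 ⊛ f₄)) ≈⟨ solve∙ 4 (λ f p g a → f ∙ (p ∙ g ∙ (a ∙ g)) ⊜ (p ∙ a) ∙ f ∙ g ∙ g) ≈-refl f₂ (p 1 2) f₄ (m 1 2) ⟩
  (p 1 2 ⊛ m 1 2) ⊛ f₂ ⊛ f₄ ⊛ f₄ ≈⟨ ⊛-cong (⊛-congʳ f₄ (⊛-congʳ f₂ (poch-pair 1 2))) (≈-trans (split₂ -1ℤ 4 4) (⊛-congʳ (m 8 8) (≈-sym (poch-pair 2 4)))) ⟩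
  m 2 4 ⊛ f₂ ⊛ f₄ ⊛ ((p 2 4 ⊛ m 2 4) ⊛ m 8 8) ≈⟨ solve∙ 5 (λ a f g p b → a ∙ f ∙ g ∙ ((p ∙ a) ∙ b) ⊜ (a ∙ (f ∙ (a ∙ g))) ∙ (p ∙ b)) ≈-refl (m 2 4) f₂ f₄ (p 2 4) (m 8 8) ⟩
  (m 2 4 ⊛ (f₂ ⊛ (m 2 4 ⊛ f₄))) ⊛ (p 2 4 ⊛ m 8 8) ≈⟨ ⊛-cong (≈-trans euler-alt (⊛-congˡ (m 2 4) (⊛-congˡ f₂ f₂-mod4))) ψ₂-product ⟨
  (euler ⊛ alt euler) ⊛ f⁺ 6 2 ∎

-- Binary theta series

split-mod5 : {F : ℤ × J → Series} → ∀ {S₀ S₁ S₂ S₃ S₄} →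
  HasSum (λ (k , j) → F (+ 5 * k + + 0 , j)) S₀ → HasSum (λ (k , j) → F (+ 5 * k + + 1 , j)) S₁ →
  HasSum (λ (k , j) → F (+ 5 * k + + 2 , j)) S₂ → HasSum (λ (k , j) → F (+ 5 * k + + 3 , j)) S₃ →
  HasSum (λ (k , j) → F (+ 5 * k + + 4 , j)) S₄ → HasSum F (S₀ ⊕ (S₁ ⊕ (S₂ ⊕ (S₃ ⊕ (S₄ ⊕ 𝟘)))))
split-mod5 {S₀ = S₀} {S₁} {S₂} {S₃} {S₄} h₀ h₁ h₂ h₃ h₄ = HasSum-mod 5
  {S = λ { Fin.zero → S₀ ; (Fin.suc Fin.zero) → S₁ ; (Fin.suc (Fin.suc Fin.zero)) → S₂ ; (Fin.suc (Fin.suc (Fin.suc Fin.zero))) → S₃ ; (Fin.suc (Fin.suc (Fin.suc (Fin.suc Fin.zero)))) → S₄ }}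
  λ { Fin.zero → h₀ ; (Fin.suc Fin.zero) → h₁ ; (Fin.suc (Fin.suc Fin.zero)) → h₂ ; (Fin.suc (Fin.suc (Fin.suc Fin.zero))) → h₃ ; (Fin.suc (Fin.suc (Fin.suc (Fin.suc Fin.zero)))) → h₄ }

split-mod4 : {F : ℤ × J → Series} → ∀ {S₀ S₁ S₂ S₃} →
  HasSum (λ (k , j) → F (+ 4 * k + + 0 , j)) S₀ → HasSum (λ (k , j) → F (+ 4 * k + + 1 , j)) S₁ →
  HasSum (λ (k , j) → F (+ 4 * k + + 2 , j)) S₂ → HasSum (λ (k , j) → F (+ 4 * k + + 3 , j)) S₃ →
  HasSum F (S₀ ⊕ (S₁ ⊕ (S₂ ⊕ (S₃ ⊕ 𝟘))))
split-mod4 {S₀ = S₀} {S₁} {S₂} {S₃} h₀ h₁ h₂ h₃ = HasSum-mod 4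
  {S = λ { Fin.zero → S₀ ; (Fin.suc Fin.zero) → S₁ ; (Fin.suc (Fin.suc Fin.zero)) → S₂ ; (Fin.suc (Fin.suc (Fin.suc Fin.zero))) → S₃ }}
  λ { Fin.zero → h₀ ; (Fin.suc Fin.zero) → h₁ ; (Fin.suc (Fin.suc Fin.zero)) → h₂ ; (Fin.suc (Fin.suc (Fin.suc Fin.zero))) → h₃ }

-- Σ_j u(j) q^{e(j)} = S with the exponent e(j) recorded through the integer polynomial d(j) = 2 e(j)
record Family (u : ℤ → ℤ) (d : ℤ → ℤ) (S : Series) : Set where
  constructor family
  field
    expo   : ℤ → ℕ
    sums   : Sums u expo S
    double : ∀ j → + 2 * + expo j ≡ d j

thD : ℕ → ℕ → ℤ → ℤ
thD A B j = + A * (j * j + j) + + B * (j * j - j)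

triD : ℕ → ℤ → ℤ
triD A j = + A * (j * j + j)

th-family : ∀ A B .{{_ : NonZero A}} .{{_ : NonZero B}} c → Family (pw c) (thD A B) (th A B c)
th-family A B c = family (thExp A B) (HasSum-th A B c) (double-thExp A B)

unsigned : ∀ {d S} → Family (pw (+ 1)) d S → Family (λ _ → + 1) d S
unsigned (family e s p) = family e (Sums-cong pw-1 (λ _ → refl) ≈-refl s) p

th⁺ : ∀ A B .{{_ : NonZero A}} .{{_ : NonZero B}} → Family (λ _ → + 1) (thD A B) (th A B (+ 1))
th⁺ A B = unsigned (th-family A B (+ 1))

tri-family : ∀ A .{{_ : NonZero A}} c → c * c ≡ + 1 → Family (pw c) (triD A) (th (3 ℕ.* A) A (+ 1) ⊕ c · th (3 ℕ.* A) A (+ 1))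
tri-family A c cc = family (λ j → A ℕ.* T j) (HasSum-tri A c cc) (double-AT A)

tri⁺ : ∀ A .{{_ : NonZero A}} → Family (λ _ → + 1) (triD A) (th (3 ℕ.* A) A (+ 1) ⊕ (+ 1) · th (3 ℕ.* A) A (+ 1))
tri⁺ A = unsigned (tri-family A (+ 1) refl)

-- An integer-valued form together with twice its value, which is polynomial even when triangular numbers occur.
record Form : Set where
  constructor form
  field
    value   : ℤ² → ℤ
    doubled : ℤ² → ℤ
    spec    : ∀ x → + 2 * value x ≡ doubled x
open Form

polynomial-form : (ℤ² → ℤ) → Form
polynomial-form Q = form Q (λ x → + 2 * Q x) (λ _ → refl)

lattice : (ℤ² → ℤ) → Form → ℤ² → Series
lattice s Q x = s x · mono ∣ value Q x ∣

-- A sum over ℤ² that becomes a product of two one-dimensional sums after a unimodular substitution.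
lattice-product : ∀ (s : ℤ² → ℤ) (Q : Form) (g : ℤ² → ℤ²) {u v d d′ S S′} → Family u d S → Family v d′ S′ →
  ∀ K a b c e x₀ y₀ δ → a * e - b * c ≡ δ → δ * δ ≡ + 1 →
  (∀ i j → u i * v j ≡ s (g (affine a b c e x₀ y₀ (i , j)))) →
  (∀ i j → doubled Q (g (affine a b c e x₀ y₀ (i , j))) ≡ + 2 * + K + (d i + d′ j)) →
  HasSum (λ x → lattice s Q (g x)) (mono K ⊛ (S ⊛ S′))
lattice-product s Q g {u} {v} (family e₁ s₁ p₁) (family e₂ s₂ p₂) K a b c e x₀ y₀ δ det δδ sign expo =
  HasSum-affine a b c e x₀ y₀ δ det δδ (HasSum-cong term ≈-refl (HasSum-clinear (clinear-⊛ˡ (mono K)) (HasSum-× s₁ s₂)))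
  where
  pt : ℤ → ℤ → ℤ²
  pt i j = g (affine a b c e x₀ y₀ (i , j))
  e-eq : ∀ i j → K ℕ.+ (e₁ i ℕ.+ e₂ j) ≡ ∣ value Q (pt i j) ∣
  e-eq i j = abs-double (trans (spec Q (pt i j)) (trans (expo i j) (trans (cong (λ z → + 2 * + K + z) (sym (cong₂ _+_ (p₁ i) (p₂ j))))
    (trans (ZS.solve 3 (λ k x y → #ᶻ 2 *ᶻ k +ᶻ (#ᶻ 2 *ᶻ x +ᶻ #ᶻ 2 *ᶻ y) =ᶻ #ᶻ 2 *ᶻ (k +ᶻ (x +ᶻ y))) refl (+ K) (+ e₁ i) (+ e₂ j))
    (cong (+ 2 *_) (sym (trans (ℤₚ.pos-+ K (e₁ i ℕ.+ e₂ j)) (cong (λ z → + K + z) (ℤₚ.pos-+ (e₁ i) (e₂ j))))))))))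
  term : ∀ ((i , j) : ℤ²) → mono K ⊛ ((u i · mono (e₁ i)) ⊛ (v j · mono (e₂ j))) ≈ lattice s Q (pt i j)
  term (i , j) = ≈-trans (⊛-congˡ (mono K) (·mono-⊛ (u i) (e₁ i) (v j) (e₂ j)))
    (≈-trans (CL.scale (clinear-⊛ˡ (mono K)) (u i * v j) (mono (e₁ i ℕ.+ e₂ j)))
    (≈-trans (·-cong (u i * v j) (mono-⊛ K (e₁ i ℕ.+ e₂ j)))
    (mk≈ λ n → cong₂ (λ x y → (x · mono y) n) (sign i j) (e-eq i j))))

-- The coset x ≡ r (mod d), in the coordinates left after the shear x ↦ x + c y or after exchanging x and y.
coset coset-swap : ℕ → ℕ → ℤ² → ℤ²
coset d r (k , y) = + d * k + + r , y
coset-swap d r (k , y) = y , + d * k + + r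

coset-shear : ℤ → ℕ → ℕ → ℤ² → ℤ²
coset-shear c d r (k , y) = + d * k + + r + c * y , y

-- Solver syntax for the exponents; the superscript marks the polynomial counterpart of a function on ℤ.
Poly : Set
Poly = ZS.Polynomial 2

affᴾ : ℤ → ℤ → ℤ → Poly → Poly → Poly
affᴾ a b e i j = ZS.con a *ᶻ i +ᶻ ZS.con b *ᶻ j +ᶻ ZS.con e

modᴾ : ℕ → ℕ → Poly → Poly
modᴾ d r x = #ᶻ d *ᶻ x +ᶻ #ᶻ r

shearᴾ : ℤ → Poly → Poly → Poly
shearᴾ c x y = x +ᶻ ZS.con c *ᶻ y

thᴾ : ℕ → ℕ → Poly → Poly
thᴾ A B j = #ᶻ A *ᶻ (j *ᶻ j +ᶻ j) +ᶻ #ᶻ B *ᶻ (j *ᶻ j -ᶻ j)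

triᴾ : ℕ → Poly → Poly
triᴾ A j = #ᶻ A *ᶻ (j *ᶻ j +ᶻ j)

infix 4 _≛_∔_∔_
_≛_∔_∔_ : Poly → ℕ → Poly → Poly → Poly × Poly
x ≛ K ∔ d ∔ d′ = x =ᶻ #ᶻ 2 *ᶻ #ᶻ K +ᶻ (d +ᶻ d′)

1ℤ² : ℤ² → ℤ
1ℤ² _ = + 1

-- Quadratic forms split into residue classes

sq-form : Form
sq-form = polynomial-form λ (x , y) → x * x + y * y

sq-formᴾ : Poly → Poly → Poly
sq-formᴾ x y = #ᶻ 2 *ᶻ (x *ᶻ x +ᶻ y *ᶻ y)

sq-form-φφ : HasSum (lattice 1ℤ² sq-form) (mono 0 ⊛ (f⁺ 1 1 ⊛ f⁺ 1 1))
sq-form-φφ = lattice-product 1ℤ² sq-form (λ x → x) (th⁺ 1 1) (th⁺ 1 1) 0 (+ 1) (+ 0) (+ 0) (+ 1) (+ 0) (+ 0) (+ 1) refl refl (λ i j → refl)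
      (ZS.solve 2 (λ i j → sq-formᴾ (affᴾ (+ 1) (+ 0) (+ 0) i j) (affᴾ (+ 0) (+ 1) (+ 0) i j) ≛ 0 ∔ thᴾ 1 1 i ∔ thᴾ 1 1 j) refl)

-- From 5(X² + Y²) = (X - 2Y)² + (2X + Y)². The shear makes X - 2Y the first coordinate; its residue
-- modulo 5 fixes that of 2X + Y, and within a class the two squares vary independently. The class 0
-- is φ(q⁵)², the other four coincide.
sq-form-mod5 : HasSum (lattice 1ℤ² sq-form)
  (mono 0 ⊛ (f⁺ 5 5 ⊛ f⁺ 5 5)
   ⊕ (mono 1 ⊛ (f⁺ 7 3 ⊛ f⁺ 9 1)
   ⊕ (mono 1 ⊛ (f⁺ 9 1 ⊛ f⁺ 7 3)
   ⊕ (mono 1 ⊛ (f⁺ 9 1 ⊛ f⁺ 7 3)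
   ⊕ (mono 1 ⊛ (f⁺ 7 3 ⊛ f⁺ 9 1) ⊕ 𝟘)))))
sq-form-mod5 = HasSum-shear (+ 2) (split-mod5
    (lattice-product 1ℤ² sq-form (coset-shear (+ 2) 5 0) (th⁺ 5 5) (th⁺ 5 5) 0 (+ 1) (+ 0) -[1+ 1 ] (+ 1) (+ 0) (+ 0) (+ 1) refl refl (λ i j → refl)
      (ZS.solve 2 (λ i j → sq-formᴾ (shearᴾ (+ 2) (modᴾ 5 0 (affᴾ (+ 1) (+ 0) (+ 0) i j)) (affᴾ -[1+ 1 ] (+ 1) (+ 0) i j)) (affᴾ -[1+ 1 ] (+ 1) (+ 0) i j) ≛ 0 ∔ thᴾ 5 5 i ∔ thᴾ 5 5 j) refl))
    (lattice-product 1ℤ² sq-form (coset-shear (+ 2) 5 1) (th⁺ 7 3) (th⁺ 9 1) 1 (+ 1) (+ 0) -[1+ 1 ] (+ 1) (+ 0) (+ 0) (+ 1) refl refl (λ i j → refl)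
      (ZS.solve 2 (λ i j → sq-formᴾ (shearᴾ (+ 2) (modᴾ 5 1 (affᴾ (+ 1) (+ 0) (+ 0) i j)) (affᴾ -[1+ 1 ] (+ 1) (+ 0) i j)) (affᴾ -[1+ 1 ] (+ 1) (+ 0) i j) ≛ 1 ∔ thᴾ 7 3 i ∔ thᴾ 9 1 j) refl))
    (lattice-product 1ℤ² sq-form (coset-shear (+ 2) 5 2) (th⁺ 9 1) (th⁺ 7 3) 1 (+ 1) (+ 0) -[1+ 1 ] -[1+ 0 ] (+ 0) -[1+ 0 ] -[1+ 0 ] refl refl (λ i j → refl)
      (ZS.solve 2 (λ i j → sq-formᴾ (shearᴾ (+ 2) (modᴾ 5 2 (affᴾ (+ 1) (+ 0) (+ 0) i j)) (affᴾ -[1+ 1 ] -[1+ 0 ] -[1+ 0 ] i j)) (affᴾ -[1+ 1 ] -[1+ 0 ] -[1+ 0 ] i j) ≛ 1 ∔ thᴾ 9 1 i ∔ thᴾ 7 3 j) refl))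
    (lattice-product 1ℤ² sq-form (coset-shear (+ 2) 5 3) (th⁺ 9 1) (th⁺ 7 3) 1 -[1+ 0 ] (+ 0) (+ 2) (+ 1) -[1+ 0 ] (+ 1) -[1+ 0 ] refl refl (λ i j → refl)
      (ZS.solve 2 (λ i j → sq-formᴾ (shearᴾ (+ 2) (modᴾ 5 3 (affᴾ -[1+ 0 ] (+ 0) -[1+ 0 ] i j)) (affᴾ (+ 2) (+ 1) (+ 1) i j)) (affᴾ (+ 2) (+ 1) (+ 1) i j) ≛ 1 ∔ thᴾ 9 1 i ∔ thᴾ 7 3 j) refl))
    (lattice-product 1ℤ² sq-form (coset-shear (+ 2) 5 4) (th⁺ 7 3) (th⁺ 9 1) 1 -[1+ 0 ] (+ 0) (+ 2) -[1+ 0 ] -[1+ 0 ] (+ 0) (+ 1) refl refl (λ i j → refl)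
      (ZS.solve 2 (λ i j → sq-formᴾ (shearᴾ (+ 2) (modᴾ 5 4 (affᴾ -[1+ 0 ] (+ 0) -[1+ 0 ] i j)) (affᴾ (+ 2) -[1+ 0 ] (+ 0) i j)) (affᴾ (+ 2) -[1+ 0 ] (+ 0) i j) ≛ 1 ∔ thᴾ 7 3 i ∔ thᴾ 9 1 j) refl)))

form-4-2-5 : Form
form-4-2-5 = polynomial-form λ (x , y) → + 4 * (x * x) + + 2 * (x * y) + + 5 * (y * y)

form-4-2-5ᴾ : Poly → Poly → Poly
form-4-2-5ᴾ x y = #ᶻ 2 *ᶻ (#ᶻ 4 *ᶻ (x *ᶻ x) +ᶻ #ᶻ 2 *ᶻ (x *ᶻ y) +ᶻ #ᶻ 5 *ᶻ (y *ᶻ y))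

-- Five times the form is 19x² + (x + 5y)². For x = 5i + r, up to a reflection, the second square is
-- that of 5j + r; the constant is 4r² for r = 1, 2, so that 4 and 16 are the weights of the
-- HH-terms in U(1,19,q) and U(1,19,q⁴).
form-4-2-5-mod5 : HasSum (lattice 1ℤ² form-4-2-5)
  (mono 0 ⊛ (f⁺ 95 95 ⊛ f⁺ 5 5)
   ⊕ (mono 4 ⊛ (f⁺ 133 57 ⊛ f⁺ 7 3)
   ⊕ (mono 16 ⊛ (f⁺ 171 19 ⊛ f⁺ 9 1)
   ⊕ (mono 16 ⊛ (f⁺ 171 19 ⊛ f⁺ 9 1)
   ⊕ (mono 4 ⊛ (f⁺ 133 57 ⊛ f⁺ 7 3) ⊕ 𝟘)))))
form-4-2-5-mod5 =  (split-mod5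
    (lattice-product 1ℤ² form-4-2-5 (coset 5 0) (th⁺ 95 95) (th⁺ 5 5) 0 (+ 1) (+ 0) -[1+ 0 ] (+ 1) (+ 0) (+ 0) (+ 1) refl refl (λ i j → refl)
      (ZS.solve 2 (λ i j → form-4-2-5ᴾ (modᴾ 5 0 (affᴾ (+ 1) (+ 0) (+ 0) i j)) (affᴾ -[1+ 0 ] (+ 1) (+ 0) i j) ≛ 0 ∔ thᴾ 95 95 i ∔ thᴾ 5 5 j) refl))
    (lattice-product 1ℤ² form-4-2-5 (coset 5 1) (th⁺ 133 57) (th⁺ 7 3) 4 (+ 1) (+ 0) -[1+ 0 ] (+ 1) (+ 0) (+ 0) (+ 1) refl refl (λ i j → refl)
      (ZS.solve 2 (λ i j → form-4-2-5ᴾ (modᴾ 5 1 (affᴾ (+ 1) (+ 0) (+ 0) i j)) (affᴾ -[1+ 0 ] (+ 1) (+ 0) i j) ≛ 4 ∔ thᴾ 133 57 i ∔ thᴾ 7 3 j) refl))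
    (lattice-product 1ℤ² form-4-2-5 (coset 5 2) (th⁺ 171 19) (th⁺ 9 1) 16 (+ 1) (+ 0) -[1+ 0 ] (+ 1) (+ 0) (+ 0) (+ 1) refl refl (λ i j → refl)
      (ZS.solve 2 (λ i j → form-4-2-5ᴾ (modᴾ 5 2 (affᴾ (+ 1) (+ 0) (+ 0) i j)) (affᴾ -[1+ 0 ] (+ 1) (+ 0) i j) ≛ 16 ∔ thᴾ 171 19 i ∔ thᴾ 9 1 j) refl))
    (lattice-product 1ℤ² form-4-2-5 (coset 5 3) (th⁺ 171 19) (th⁺ 9 1) 16 -[1+ 0 ] (+ 0) (+ 1) -[1+ 0 ] -[1+ 0 ] (+ 0) (+ 1) refl refl (λ i j → refl)
      (ZS.solve 2 (λ i j → form-4-2-5ᴾ (modᴾ 5 3 (affᴾ -[1+ 0 ] (+ 0) -[1+ 0 ] i j)) (affᴾ (+ 1) -[1+ 0 ] (+ 0) i j) ≛ 16 ∔ thᴾ 171 19 i ∔ thᴾ 9 1 j) refl))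
    (lattice-product 1ℤ² form-4-2-5 (coset 5 4) (th⁺ 133 57) (th⁺ 7 3) 4 -[1+ 0 ] (+ 0) (+ 1) -[1+ 0 ] -[1+ 0 ] (+ 0) (+ 1) refl refl (λ i j → refl)
      (ZS.solve 2 (λ i j → form-4-2-5ᴾ (modᴾ 5 4 (affᴾ -[1+ 0 ] (+ 0) -[1+ 0 ] i j)) (affᴾ (+ 1) -[1+ 0 ] (+ 0) i j) ≛ 4 ∔ thᴾ 133 57 i ∔ thᴾ 7 3 j) refl)))

-- Four times the form is 19y² + (4x + y)², now with classes of y. The class 2 leaves 19(2i+1)² +
-- (2j+1)², whence the triangular sums and the constant 20.
form-4-2-5-mod4 : HasSum (lattice 1ℤ² form-4-2-5)
  (mono 0 ⊛ (f⁺ 76 76 ⊛ f⁺ 4 4)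
   ⊕ (mono 5 ⊛ (f⁺ 114 38 ⊛ f⁺ 6 2)
   ⊕ (mono 20 ⊛ ((f⁺ 456 152 ⊕ (+ 1) · f⁺ 456 152) ⊛ (f⁺ 24 8 ⊕ (+ 1) · f⁺ 24 8))
   ⊕ (mono 5 ⊛ (f⁺ 114 38 ⊛ f⁺ 6 2) ⊕ 𝟘))))
form-4-2-5-mod4 = HasSum-swap (split-mod4
    (lattice-product 1ℤ² form-4-2-5 (coset-swap 4 0) (th⁺ 76 76) (th⁺ 4 4) 0 (+ 1) (+ 0) -[1+ 0 ] (+ 1) (+ 0) (+ 0) (+ 1) refl refl (λ i j → refl)
      (ZS.solve 2 (λ i j → form-4-2-5ᴾ (affᴾ -[1+ 0 ] (+ 1) (+ 0) i j) (modᴾ 4 0 (affᴾ (+ 1) (+ 0) (+ 0) i j)) ≛ 0 ∔ thᴾ 76 76 i ∔ thᴾ 4 4 j) refl))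
    (lattice-product 1ℤ² form-4-2-5 (coset-swap 4 1) (th⁺ 114 38) (th⁺ 6 2) 5 (+ 1) (+ 0) -[1+ 0 ] (+ 1) (+ 0) (+ 0) (+ 1) refl refl (λ i j → refl)
      (ZS.solve 2 (λ i j → form-4-2-5ᴾ (affᴾ -[1+ 0 ] (+ 1) (+ 0) i j) (modᴾ 4 1 (affᴾ (+ 1) (+ 0) (+ 0) i j)) ≛ 5 ∔ thᴾ 114 38 i ∔ thᴾ 6 2 j) refl))
    (lattice-product 1ℤ² form-4-2-5 (coset-swap 4 2) (tri⁺ 152) (tri⁺ 8) 20 (+ 1) (+ 0) -[1+ 0 ] (+ 1) (+ 0) (+ 0) (+ 1) refl refl (λ i j → refl)
      (ZS.solve 2 (λ i j → form-4-2-5ᴾ (affᴾ -[1+ 0 ] (+ 1) (+ 0) i j) (modᴾ 4 2 (affᴾ (+ 1) (+ 0) (+ 0) i j)) ≛ 20 ∔ triᴾ 152 i ∔ triᴾ 8 j) refl))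
    (lattice-product 1ℤ² form-4-2-5 (coset-swap 4 3) (th⁺ 114 38) (th⁺ 6 2) 5 -[1+ 0 ] (+ 0) (+ 1) -[1+ 0 ] -[1+ 0 ] (+ 0) (+ 1) refl refl (λ i j → refl)
      (ZS.solve 2 (λ i j → form-4-2-5ᴾ (affᴾ (+ 1) -[1+ 0 ] (+ 0) i j) (modᴾ 4 3 (affᴾ -[1+ 0 ] (+ 0) -[1+ 0 ] i j)) ≛ 5 ∔ thᴾ 114 38 i ∔ thᴾ 6 2 j) refl)))

-- n² + n y + 5 y² for odd n = 2 x + 1
odd-form : Form
odd-form = polynomial-form λ (x , y) → (+ 2 * x + + 1) * (+ 2 * x + + 1) + (+ 2 * x + + 1) * y + + 5 * (y * y)

odd-formᴾ : Poly → Poly → Poly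
odd-formᴾ x y = #ᶻ 2 *ᶻ (modᴾ 2 1 x *ᶻ modᴾ 2 1 x +ᶻ modᴾ 2 1 x *ᶻ y +ᶻ #ᶻ 5 *ᶻ (y *ᶻ y))

-- With n = 2x + 1, twenty times the form is 19n² + (n + 10y)², and x modulo 5 is n modulo 10. The
-- class n ≡ 5 yields triangular sums.
odd-form-mod5 : HasSum (lattice 1ℤ² odd-form)
  (mono 1 ⊛ (f⁺ 114 76 ⊛ f⁺ 6 4)
   ⊕ (mono 9 ⊛ (f⁺ 152 38 ⊛ f⁺ 8 2)
   ⊕ (mono 25 ⊛ ((f⁺ 570 190 ⊕ (+ 1) · f⁺ 570 190) ⊛ (f⁺ 30 10 ⊕ (+ 1) · f⁺ 30 10))
   ⊕ (mono 9 ⊛ (f⁺ 152 38 ⊛ f⁺ 8 2)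
   ⊕ (mono 1 ⊛ (f⁺ 114 76 ⊛ f⁺ 6 4) ⊕ 𝟘)))))
odd-form-mod5 =  (split-mod5
    (lattice-product 1ℤ² odd-form (coset 5 0) (th⁺ 114 76) (th⁺ 6 4) 1 (+ 1) (+ 0) -[1+ 0 ] (+ 1) (+ 0) (+ 0) (+ 1) refl refl (λ i j → refl)
      (ZS.solve 2 (λ i j → odd-formᴾ (modᴾ 5 0 (affᴾ (+ 1) (+ 0) (+ 0) i j)) (affᴾ -[1+ 0 ] (+ 1) (+ 0) i j) ≛ 1 ∔ thᴾ 114 76 i ∔ thᴾ 6 4 j) refl))
    (lattice-product 1ℤ² odd-form (coset 5 1) (th⁺ 152 38) (th⁺ 8 2) 9 (+ 1) (+ 0) -[1+ 0 ] (+ 1) (+ 0) (+ 0) (+ 1) refl refl (λ i j → refl)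
      (ZS.solve 2 (λ i j → odd-formᴾ (modᴾ 5 1 (affᴾ (+ 1) (+ 0) (+ 0) i j)) (affᴾ -[1+ 0 ] (+ 1) (+ 0) i j) ≛ 9 ∔ thᴾ 152 38 i ∔ thᴾ 8 2 j) refl))
    (lattice-product 1ℤ² odd-form (coset 5 2) (tri⁺ 190) (tri⁺ 10) 25 (+ 1) (+ 0) -[1+ 0 ] (+ 1) (+ 0) (+ 0) (+ 1) refl refl (λ i j → refl)
      (ZS.solve 2 (λ i j → odd-formᴾ (modᴾ 5 2 (affᴾ (+ 1) (+ 0) (+ 0) i j)) (affᴾ -[1+ 0 ] (+ 1) (+ 0) i j) ≛ 25 ∔ triᴾ 190 i ∔ triᴾ 10 j) refl))
    (lattice-product 1ℤ² odd-form (coset 5 3) (th⁺ 152 38) (th⁺ 8 2) 9 -[1+ 0 ] (+ 0) (+ 1) -[1+ 0 ] -[1+ 0 ] (+ 0) (+ 1) refl refl (λ i j → refl)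
      (ZS.solve 2 (λ i j → odd-formᴾ (modᴾ 5 3 (affᴾ -[1+ 0 ] (+ 0) -[1+ 0 ] i j)) (affᴾ (+ 1) -[1+ 0 ] (+ 0) i j) ≛ 9 ∔ thᴾ 152 38 i ∔ thᴾ 8 2 j) refl))
    (lattice-product 1ℤ² odd-form (coset 5 4) (th⁺ 114 76) (th⁺ 6 4) 1 -[1+ 0 ] (+ 0) (+ 1) -[1+ 0 ] -[1+ 0 ] (+ 0) (+ 1) refl refl (λ i j → refl)
      (ZS.solve 2 (λ i j → odd-formᴾ (modᴾ 5 4 (affᴾ -[1+ 0 ] (+ 0) -[1+ 0 ] i j)) (affᴾ (+ 1) -[1+ 0 ] (+ 0) i j) ≛ 1 ∔ thᴾ 114 76 i ∔ thᴾ 6 4 j) refl)))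

-- Four times the form is 19y² + (2n + y)². For even y the remaining square is odd in the class 0
-- and even in the class 2, because n is odd.
odd-form-mod4 : HasSum (lattice 1ℤ² odd-form)
  (mono 1 ⊛ (f⁺ 76 76 ⊛ (f⁺ 24 8 ⊕ (+ 1) · f⁺ 24 8))
   ⊕ (mono 5 ⊛ (f⁺ 114 38 ⊛ f⁺ 6 2)
   ⊕ (mono 19 ⊛ ((f⁺ 456 152 ⊕ (+ 1) · f⁺ 456 152) ⊛ f⁺ 4 4)
   ⊕ (mono 5 ⊛ (f⁺ 114 38 ⊛ f⁺ 6 2) ⊕ 𝟘))))
odd-form-mod4 = HasSum-swap (split-mod4
    (lattice-product 1ℤ² odd-form (coset-swap 4 0) (th⁺ 76 76) (tri⁺ 8) 1 (+ 1) (+ 0) -[1+ 0 ] (+ 1) (+ 0) (+ 0) (+ 1) refl refl (λ i j → refl)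
      (ZS.solve 2 (λ i j → odd-formᴾ (affᴾ -[1+ 0 ] (+ 1) (+ 0) i j) (modᴾ 4 0 (affᴾ (+ 1) (+ 0) (+ 0) i j)) ≛ 1 ∔ thᴾ 76 76 i ∔ triᴾ 8 j) refl))
    (lattice-product 1ℤ² odd-form (coset-swap 4 1) (th⁺ 114 38) (th⁺ 6 2) 5 (+ 1) (+ 0) -[1+ 0 ] -[1+ 0 ] (+ 0) -[1+ 0 ] -[1+ 0 ] refl refl (λ i j → refl)
      (ZS.solve 2 (λ i j → odd-formᴾ (affᴾ -[1+ 0 ] -[1+ 0 ] -[1+ 0 ] i j) (modᴾ 4 1 (affᴾ (+ 1) (+ 0) (+ 0) i j)) ≛ 5 ∔ thᴾ 114 38 i ∔ thᴾ 6 2 j) refl))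
    (lattice-product 1ℤ² odd-form (coset-swap 4 2) (tri⁺ 152) (th⁺ 4 4) 19 (+ 1) (+ 0) -[1+ 0 ] (+ 1) (+ 0) -[1+ 0 ] (+ 1) refl refl (λ i j → refl)
      (ZS.solve 2 (λ i j → odd-formᴾ (affᴾ -[1+ 0 ] (+ 1) -[1+ 0 ] i j) (modᴾ 4 2 (affᴾ (+ 1) (+ 0) (+ 0) i j)) ≛ 19 ∔ triᴾ 152 i ∔ thᴾ 4 4 j) refl))
    (lattice-product 1ℤ² odd-form (coset-swap 4 3) (th⁺ 114 38) (th⁺ 6 2) 5 -[1+ 0 ] (+ 0) (+ 1) (+ 1) -[1+ 0 ] (+ 0) -[1+ 0 ] refl refl (λ i j → refl)
      (ZS.solve 2 (λ i j → odd-formᴾ (affᴾ (+ 1) (+ 1) (+ 0) i j) (modᴾ 4 3 (affᴾ -[1+ 0 ] (+ 0) -[1+ 0 ] i j)) ≛ 5 ∔ thᴾ 114 38 i ∔ thᴾ 6 2 j) refl)))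

tri-form : Form
tri-form = form (λ (x , y) → + T x + + T y) (λ (x , y) → (x * x + x) + (y * y + y))
  λ (x , y) → trans (ℤₚ.*-distribˡ-+ (+ 2) (+ T x) (+ T y)) (cong₂ _+_ (double-T x) (double-T y))

tri-formᴾ : Poly → Poly → Poly
tri-formᴾ x y = (x *ᶻ x +ᶻ x) +ᶻ (y *ᶻ y +ᶻ y)

tri-form-ψψ : HasSum (lattice 1ℤ² tri-form) (mono 0 ⊛ ((f⁺ 3 1 ⊕ (+ 1) · f⁺ 3 1) ⊛ (f⁺ 3 1 ⊕ (+ 1) · f⁺ 3 1)))
tri-form-ψψ = lattice-product 1ℤ² tri-form (λ x → x) (tri⁺ 1) (tri⁺ 1) 0 (+ 1) (+ 0) (+ 0) (+ 1) (+ 0) (+ 0) (+ 1) refl refl (λ i j → refl)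
      (ZS.solve 2 (λ i j → tri-formᴾ (affᴾ (+ 1) (+ 0) (+ 0) i j) (affᴾ (+ 0) (+ 1) (+ 0) i j) ≛ 0 ∔ triᴾ 1 i ∔ triᴾ 1 j) refl)

-- With a = 2x+1 and b = 2y+1, 8(T x + T y) + 2 = a² + b² and 5(a² + b²) = (a + 2b)² + (2a - b)².
-- The shear makes x + 2y the first coordinate, and a + 2b = 2(x + 2y) + 3 is divisible by 5 in the
-- class 1, which gives the ψ(q⁵)² term.
tri-form-mod5 : HasSum (lattice 1ℤ² tri-form)
  (mono 0 ⊛ (f⁺ 3 2 ⊛ f⁺ 4 1)
   ⊕ (mono 1 ⊛ ((f⁺ 15 5 ⊕ (+ 1) · f⁺ 15 5) ⊛ (f⁺ 15 5 ⊕ (+ 1) · f⁺ 15 5))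
   ⊕ (mono 0 ⊛ (f⁺ 3 2 ⊛ f⁺ 4 1)
   ⊕ (mono 0 ⊛ (f⁺ 3 2 ⊛ f⁺ 4 1)
   ⊕ (mono 0 ⊛ (f⁺ 3 2 ⊛ f⁺ 4 1) ⊕ 𝟘)))))
tri-form-mod5 = HasSum-shear -[1+ 1 ] (split-mod5
    (lattice-product 1ℤ² tri-form (coset-shear -[1+ 1 ] 5 0) (th⁺ 3 2) (th⁺ 4 1) 0 (+ 0) (+ 1) -[1+ 0 ] (+ 2) (+ 0) (+ 0) (+ 1) refl refl (λ i j → refl)
      (ZS.solve 2 (λ i j → tri-formᴾ (shearᴾ -[1+ 1 ] (modᴾ 5 0 (affᴾ (+ 0) (+ 1) (+ 0) i j)) (affᴾ -[1+ 0 ] (+ 2) (+ 0) i j)) (affᴾ -[1+ 0 ] (+ 2) (+ 0) i j) ≛ 0 ∔ thᴾ 3 2 i ∔ thᴾ 4 1 j) refl))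
    (lattice-product 1ℤ² tri-form (coset-shear -[1+ 1 ] 5 1) (tri⁺ 5) (tri⁺ 5) 1 (+ 1) (+ 0) (+ 2) (+ 1) (+ 0) (+ 1) (+ 1) refl refl (λ i j → refl)
      (ZS.solve 2 (λ i j → tri-formᴾ (shearᴾ -[1+ 1 ] (modᴾ 5 1 (affᴾ (+ 1) (+ 0) (+ 0) i j)) (affᴾ (+ 2) (+ 1) (+ 1) i j)) (affᴾ (+ 2) (+ 1) (+ 1) i j) ≛ 1 ∔ triᴾ 5 i ∔ triᴾ 5 j) refl))
    (lattice-product 1ℤ² tri-form (coset-shear -[1+ 1 ] 5 2) (th⁺ 3 2) (th⁺ 4 1) 0 (+ 0) -[1+ 0 ] (+ 1) -[1+ 1 ] -[1+ 0 ] -[1+ 0 ] (+ 1) refl refl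
      (λ i j → refl)
      (ZS.solve 2 (λ i j → tri-formᴾ (shearᴾ -[1+ 1 ] (modᴾ 5 2 (affᴾ (+ 0) -[1+ 0 ] -[1+ 0 ] i j)) (affᴾ (+ 1) -[1+ 1 ] -[1+ 0 ] i j)) (affᴾ (+ 1) -[1+ 1 ] -[1+ 0 ] i j) ≛ 0 ∔ thᴾ 3 2 i ∔ thᴾ 4 1 j) refl))
    (lattice-product 1ℤ² tri-form (coset-shear -[1+ 1 ] 5 3) (th⁺ 3 2) (th⁺ 4 1) 0 -[1+ 0 ] (+ 0) -[1+ 1 ] -[1+ 0 ] -[1+ 0 ] -[1+ 0 ] (+ 1) refl refl
      (λ i j → refl)
      (ZS.solve 2 (λ i j → tri-formᴾ (shearᴾ -[1+ 1 ] (modᴾ 5 3 (affᴾ -[1+ 0 ] (+ 0) -[1+ 0 ] i j)) (affᴾ -[1+ 1 ] -[1+ 0 ] -[1+ 0 ] i j)) (affᴾ -[1+ 1 ] -[1+ 0 ] -[1+ 0 ] i j) ≛ 0 ∔ thᴾ 3 2 i ∔ thᴾ 4 1 j) refl))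
    (lattice-product 1ℤ² tri-form (coset-shear -[1+ 1 ] 5 4) (th⁺ 3 2) (th⁺ 4 1) 0 (+ 1) (+ 0) (+ 2) (+ 1) -[1+ 0 ] (+ 0) (+ 1) refl refl (λ i j → refl)
      (ZS.solve 2 (λ i j → tri-formᴾ (shearᴾ -[1+ 1 ] (modᴾ 5 4 (affᴾ (+ 1) (+ 0) -[1+ 0 ] i j)) (affᴾ (+ 2) (+ 1) (+ 0) i j)) (affᴾ (+ 2) (+ 1) (+ 0) i j) ≛ 0 ∔ thᴾ 3 2 i ∔ thᴾ 4 1 j) refl)))

-- Signed lattice sums

sgn : ℤ → ℤ
sgn = pw -1ℤ

sgn-+ : ∀ i j → sgn (i + j) ≡ sgn i * sgn j
sgn-+ = pw-+ -1ℤ refl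

-- The congruence x ≡ y modulo 2, stated in doubled form so that triangular numbers can be
-- eliminated before the solver is called.
sgn-parity : ∀ {x} y z → + 2 * x ≡ + 2 * (y + + 2 * z) → sgn x ≡ sgn y
sgn-parity y z e = trans (cong sgn (double-injective e)) (trans (sgn-+ y (+ 2 * z))
  (trans (cong (sgn y *_) (pw-double -1ℤ refl z)) (ℤₚ.*-identityʳ (sgn y))))

alt-family : ∀ {u v d S} (F : Family u d S) → (∀ j → (-1ℤ ^ Family.expo F j) * u j ≡ v j) → Family v d (alt S)
alt-family {u} (family e s p) q = family e (HasSum-cong (λ j → ≈-trans (alt-·mono (u j) (e j)) (mk≈ λ n → cong (λ x → (x · mono (e j)) n) (q j))) ≈-refl
  (HasSum-clinear alt-clinear s)) p

scale-family : ∀ c {u d S} → Family u d S → Family (λ j → c * u j) d (c · S)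
scale-family c {u} (family e s p) = family e (HasSum-cong (λ j → mk≈ λ n → sym (ℤₚ.*-assoc c (u j) (mono (e j) n))) ≈-refl (HasSum-clinear (·-clinear c) s)) p

sgn-T : ℤ → ℤ
sgn-T j = sgn (+ T j)

-- The hypothesis is the doubled congruence T b ≡ y + T t modulo 2. In its uses it comes from T(2s +
-- t) = T t + s + 2(s² + st) and T(-1 - b) = T b.
split-sign-T : ∀ b y t z → b * b + b ≡ + 2 * y + (t * t + t) + + 4 * z → sgn y * sgn-T t ≡ sgn-T b
split-sign-T b y t z e = sym (trans (sgn-parity {+ T b} (y + + T t) z (trans (double-T b) (trans e
  (trans (cong (λ x → + 2 * y + x + + 4 * z) (sym (double-T t)))
  (ZS.solve 3 (λ y t z → #ᶻ 2 *ᶻ y +ᶻ #ᶻ 2 *ᶻ t +ᶻ #ᶻ 4 *ᶻ z =ᶻ #ᶻ 2 *ᶻ (y +ᶻ t +ᶻ #ᶻ 2 *ᶻ z)) refl y (+ T t) z)))))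
  (sgn-+ y (+ T t)))

-- At -q the sign of the j-th term of f(-q⁴, -q) has exponent j + `thExp 4 1 j` = 5 T j, which is T
-- j modulo 2.
h⁻-family : Family sgn-T (thD 4 1) (alt (f⁻ 4 1))
h⁻-family = alt-family (th-family 4 1 -1ℤ) λ j → trans (sym (sgn-+ (+ thExp 4 1 j) j))
  (sgn-parity (+ T j) (j * j + j) (trans (ℤₚ.*-distribˡ-+ (+ 2) (+ thExp 4 1 j) j) (trans (cong (_+ + 2 * j) (double-thExp 4 1 j))
    (trans (ZS.solve 1 (λ j → (#ᶻ 4 *ᶻ (j *ᶻ j +ᶻ j) +ᶻ #ᶻ 1 *ᶻ (j *ᶻ j -ᶻ j)) +ᶻ #ᶻ 2 *ᶻ j
        =ᶻ (j *ᶻ j +ᶻ j) +ᶻ #ᶻ 2 *ᶻ (#ᶻ 2 *ᶻ (j *ᶻ j +ᶻ j))) refl j)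
    (sym (trans (ℤₚ.*-distribˡ-+ (+ 2) (+ T j) (+ 2 * (j * j + j))) (cong (λ t → t + + 2 * (+ 2 * (j * j + j))) (double-T j))))))))

-- Here j + `thExp 3 2 j` = T(-j) + 2(j² + j), so the sign is (-1)^(T(-j)).
g⁻-family : Family (λ j → sgn-T (- j)) (thD 3 2) (alt (f⁻ 3 2))
g⁻-family = alt-family (th-family 3 2 -1ℤ) λ j → trans (sym (sgn-+ (+ thExp 3 2 j) j))
  (sgn-parity (+ T (- j)) (j * j + j) (trans (ℤₚ.*-distribˡ-+ (+ 2) (+ thExp 3 2 j) j) (trans (cong (_+ + 2 * j) (double-thExp 3 2 j))
    (trans (ZS.solve 1 (λ j → (#ᶻ 3 *ᶻ (j *ᶻ j +ᶻ j) +ᶻ #ᶻ 2 *ᶻ (j *ᶻ j -ᶻ j)) +ᶻ #ᶻ 2 *ᶻ j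
        =ᶻ ((-ᶻ j) *ᶻ (-ᶻ j) +ᶻ (-ᶻ j)) +ᶻ #ᶻ 2 *ᶻ (#ᶻ 2 *ᶻ (j *ᶻ j +ᶻ j))) refl j)
    (sym (trans (ℤₚ.*-distribˡ-+ (+ 2) (+ T (- j)) (+ 2 * (j * j + j))) (cong (λ t → t + + 2 * (+ 2 * (j * j + j))) (double-T (- j)))))))))

ψ⁻-family : Family sgn-T (triD 1) (alt (f⁺ 3 1 ⊕ (+ 1) · f⁺ 3 1))
ψ⁻-family = alt-family (tri⁺ 1) λ j → trans (ℤₚ.*-identityʳ (-1ℤ ^ (1 ℕ.* T j))) (cong (-1ℤ ^_) (ℕₚ.*-identityˡ (T j)))

-- In the class a + 2b ≡ 1 (mod 5) the sum over one coordinate is Σ (-1)^i q^{5 i (i + 1) / 2} = 0.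
null-family : Family (λ j → -1ℤ * (sgn-T j * sgn j)) (triD 5) (-1ℤ · alt (f⁺ 15 5 ⊕ -1ℤ · f⁺ 15 5))
null-family = scale-family -1ℤ (alt-family (tri-family 5 -1ℤ refl) λ j → cong (_* sgn j) (-1^odd* 5 (T j) refl))

tri-sign : ℤ² → ℤ
tri-sign (x , y) = sgn-T y

-- The sign (-1)^(T y) changes the second ψ(q) into ψ(-q). In each class, since T(2s + t) ≡ s + T t
-- modulo 2, it separates into a bare sign, as in f(-q^A, -q^B), and a sign (-1)^(T t), which
-- amounts to q ↦ -q in the other factor. That factor belongs to `G` in the classes 0 and 2, and to
-- `H` in the classes 3 and 4.
tri-form-signed-mod5 : HasSum (lattice tri-sign tri-form)
  (mono 0 ⊛ (alt (f⁻ 3 2) ⊛ f⁻ 4 1)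
   ⊕ (mono 1 ⊛ ((f⁺ 15 5 ⊕ -1ℤ · f⁺ 15 5) ⊛ (-1ℤ · alt (f⁺ 15 5 ⊕ -1ℤ · f⁺ 15 5)))
   ⊕ (mono 0 ⊛ (alt (f⁻ 3 2) ⊛ f⁻ 4 1)
   ⊕ (mono 0 ⊛ (f⁻ 3 2 ⊛ alt (f⁻ 4 1))
   ⊕ (mono 0 ⊛ (f⁻ 3 2 ⊛ alt (f⁻ 4 1)) ⊕ 𝟘)))))
tri-form-signed-mod5 = HasSum-shear -[1+ 1 ] (split-mod5
    (lattice-product tri-sign tri-form (coset-shear -[1+ 1 ] 5 0) g⁻-family (th-family 4 1 -1ℤ) 0 (+ 0) (+ 1) -[1+ 0 ] (+ 2) (+ 0) (+ 0) (+ 1) refl refl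
      (λ i j → trans (ℤₚ.*-comm (sgn-T (- i)) (sgn j)) (split-sign-T (-[1+ 0 ] * i + (+ 2) * j + (+ 0)) (j) (- i) (j * j - i * j) (ZS.solve 2 (λ i j → (affᴾ -[1+ 0 ] (+ 2) (+ 0) i j) *ᶻ (affᴾ -[1+ 0 ] (+ 2) (+ 0) i j) +ᶻ (affᴾ -[1+ 0 ] (+ 2) (+ 0) i j) =ᶻ #ᶻ 2 *ᶻ j +ᶻ ((-ᶻ i) *ᶻ (-ᶻ i) +ᶻ (-ᶻ i)) +ᶻ #ᶻ 4 *ᶻ (j *ᶻ j -ᶻ i *ᶻ j)) refl i j)))
      (ZS.solve 2 (λ i j → tri-formᴾ (shearᴾ -[1+ 1 ] (modᴾ 5 0 (affᴾ (+ 0) (+ 1) (+ 0) i j)) (affᴾ -[1+ 0 ] (+ 2) (+ 0) i j)) (affᴾ -[1+ 0 ] (+ 2) (+ 0) i j) ≛ 0 ∔ thᴾ 3 2 i ∔ thᴾ 4 1 j) refl))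
    (lattice-product tri-sign tri-form (coset-shear -[1+ 1 ] 5 1) (tri-family 5 -1ℤ refl) null-family 1 (+ 1) (+ 0) (+ 2) (+ 1) (+ 0) (+ 1) (+ 1) refl refl
      -- T(2i + j + 1) ≡ i + j + 1 + T j modulo 2; the dependence on i is the bare sign (-1)^i that
      -- makes the sum over i vanish.
      (λ i j → trans (trans (ZS.solve 3 (λ a t b → a *ᶻ (ZS.con -1ℤ *ᶻ (t *ᶻ b)) =ᶻ ((a *ᶻ b) *ᶻ ZS.con -1ℤ) *ᶻ t) refl (sgn i) (sgn-T j) (sgn j)) (cong (_* sgn-T j) (sym (trans (sgn-+ (i + j) (+ 1)) (cong (_* -1ℤ) (sgn-+ i j)))))) (split-sign-T ((+ 2) * i + (+ 1) * j + (+ 1)) (i + j + + 1) (j) (i * i + i * j + i) (ZS.solve 2 (λ i j → (affᴾ (+ 2) (+ 1) (+ 1) i j) *ᶻ (affᴾ (+ 2) (+ 1) (+ 1) i j) +ᶻ (affᴾ (+ 2) (+ 1) (+ 1) i j) =ᶻ #ᶻ 2 *ᶻ (i +ᶻ j +ᶻ #ᶻ 1) +ᶻ (j *ᶻ j +ᶻ j) +ᶻ #ᶻ 4 *ᶻ (i *ᶻ i +ᶻ i *ᶻ j +ᶻ i)) refl i j)))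
      (ZS.solve 2 (λ i j → tri-formᴾ (shearᴾ -[1+ 1 ] (modᴾ 5 1 (affᴾ (+ 1) (+ 0) (+ 0) i j)) (affᴾ (+ 2) (+ 1) (+ 1) i j)) (affᴾ (+ 2) (+ 1) (+ 1) i j) ≛ 1 ∔ triᴾ 5 i ∔ triᴾ 5 j) refl))
    (lattice-product tri-sign tri-form (coset-shear -[1+ 1 ] 5 2) g⁻-family (th-family 4 1 -1ℤ) 0 (+ 0) -[1+ 0 ] (+ 1) -[1+ 1 ] -[1+ 0 ] -[1+ 0 ] (+ 1) refl refl
      (λ i j → trans (ℤₚ.*-comm (sgn-T (- i)) (sgn j)) (split-sign-T ((+ 1) * i + -[1+ 1 ] * j + -[1+ 0 ]) (j) (- i) (j * j - i * j) (ZS.solve 2 (λ i j → (affᴾ (+ 1) -[1+ 1 ] -[1+ 0 ] i j) *ᶻ (affᴾ (+ 1) -[1+ 1 ] -[1+ 0 ] i j) +ᶻ (affᴾ (+ 1) -[1+ 1 ] -[1+ 0 ] i j) =ᶻ #ᶻ 2 *ᶻ j +ᶻ ((-ᶻ i) *ᶻ (-ᶻ i) +ᶻ (-ᶻ i)) +ᶻ #ᶻ 4 *ᶻ (j *ᶻ j -ᶻ i *ᶻ j)) refl i j)))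
      (ZS.solve 2 (λ i j → tri-formᴾ (shearᴾ -[1+ 1 ] (modᴾ 5 2 (affᴾ (+ 0) -[1+ 0 ] -[1+ 0 ] i j)) (affᴾ (+ 1) -[1+ 1 ] -[1+ 0 ] i j)) (affᴾ (+ 1) -[1+ 1 ] -[1+ 0 ] i j) ≛ 0 ∔ thᴾ 3 2 i ∔ thᴾ 4 1 j) refl))
    (lattice-product tri-sign tri-form (coset-shear -[1+ 1 ] 5 3) (th-family 3 2 -1ℤ) h⁻-family 0 -[1+ 0 ] (+ 0) -[1+ 1 ] -[1+ 0 ] -[1+ 0 ] -[1+ 0 ] (+ 1) refl refl
      (λ i j → split-sign-T (-[1+ 1 ] * i + -[1+ 0 ] * j + -[1+ 0 ]) (i) (j) (i * j + i * i) (ZS.solve 2 (λ i j → (affᴾ -[1+ 1 ] -[1+ 0 ] -[1+ 0 ] i j) *ᶻ (affᴾ -[1+ 1 ] -[1+ 0 ] -[1+ 0 ] i j) +ᶻ (affᴾ -[1+ 1 ] -[1+ 0 ] -[1+ 0 ] i j) =ᶻ #ᶻ 2 *ᶻ i +ᶻ (j *ᶻ j +ᶻ j) +ᶻ #ᶻ 4 *ᶻ (i *ᶻ j +ᶻ i *ᶻ i)) refl i j))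
      (ZS.solve 2 (λ i j → tri-formᴾ (shearᴾ -[1+ 1 ] (modᴾ 5 3 (affᴾ -[1+ 0 ] (+ 0) -[1+ 0 ] i j)) (affᴾ -[1+ 1 ] -[1+ 0 ] -[1+ 0 ] i j)) (affᴾ -[1+ 1 ] -[1+ 0 ] -[1+ 0 ] i j) ≛ 0 ∔ thᴾ 3 2 i ∔ thᴾ 4 1 j) refl))
    (lattice-product tri-sign tri-form (coset-shear -[1+ 1 ] 5 4) (th-family 3 2 -1ℤ) h⁻-family 0 (+ 1) (+ 0) (+ 2) (+ 1) -[1+ 0 ] (+ 0) (+ 1) refl refl
      (λ i j → split-sign-T ((+ 2) * i + (+ 1) * j + (+ 0)) (i) (j) (i * j + i * i) (ZS.solve 2 (λ i j → (affᴾ (+ 2) (+ 1) (+ 0) i j) *ᶻ (affᴾ (+ 2) (+ 1) (+ 0) i j) +ᶻ (affᴾ (+ 2) (+ 1) (+ 0) i j) =ᶻ #ᶻ 2 *ᶻ i +ᶻ (j *ᶻ j +ᶻ j) +ᶻ #ᶻ 4 *ᶻ (i *ᶻ j +ᶻ i *ᶻ i)) refl i j))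
      (ZS.solve 2 (λ i j → tri-formᴾ (shearᴾ -[1+ 1 ] (modᴾ 5 4 (affᴾ (+ 1) (+ 0) -[1+ 0 ] i j)) (affᴾ (+ 2) (+ 1) (+ 0) i j)) (affᴾ (+ 2) (+ 1) (+ 0) i j) ≛ 0 ∔ thᴾ 3 2 i ∔ thᴾ 4 1 j) refl)))

tri-form-ψψ⁻ : HasSum (lattice tri-sign tri-form) (mono 0 ⊛ ((f⁺ 3 1 ⊕ (+ 1) · f⁺ 3 1) ⊛ alt (f⁺ 3 1 ⊕ (+ 1) · f⁺ 3 1)))
tri-form-ψψ⁻ = lattice-product tri-sign tri-form (λ x → x) (tri⁺ 1) ψ⁻-family 0 (+ 1) (+ 0) (+ 0) (+ 1) (+ 0) (+ 0) (+ 1) refl refl (λ i j → trans (ℤₚ.*-identityˡ (sgn-T j)) (cong sgn-T (ZS.solve 2 (λ i j → j =ᶻ (affᴾ (+ 0) (+ 1) (+ 0) i j)) refl i j)))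
      (ZS.solve 2 (λ i j → tri-formᴾ (affᴾ (+ 1) (+ 0) (+ 0) i j) (affᴾ (+ 0) (+ 1) (+ 0) i j) ≛ 0 ∔ triᴾ 1 i ∔ triᴾ 1 j) refl)

mixed-form : Form
mixed-form = form (λ (x , y) → + T x + + 2 * (y * y)) (λ (x , y) → (x * x + x) + + 4 * (y * y))
  λ (x , y) → trans (ZS.solve 2 (λ t y → #ᶻ 2 *ᶻ (t +ᶻ #ᶻ 2 *ᶻ (y *ᶻ y)) =ᶻ #ᶻ 2 *ᶻ t +ᶻ #ᶻ 4 *ᶻ (y *ᶻ y)) refl (+ T x) y)
    (cong (λ t → t + + 4 * (y * y)) (double-T x))

mixed-formᴾ : Poly → Poly → Poly
mixed-formᴾ x y = (x *ᶻ x +ᶻ x) +ᶻ #ᶻ 4 *ᶻ (y *ᶻ y)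

mixed-sign : ℤ² → ℤ
mixed-sign (x , y) = sgn y

sgn-diff : ∀ {z} s t → z ≡ t - s → sgn s * sgn t ≡ sgn z
sgn-diff s t e = sym (trans (cong sgn e) (trans (sgn-+ t (- s)) (trans (cong (sgn t *_) (pw-neg -1ℤ refl s)) (ℤₚ.*-comm (sgn t) (sgn s)))))

-- Rogers' method. With a = 2x+1, eight times the value plus 1 is a² + 16y², and 5(a² + 16y²) = (a -
-- 8y)² + (2a + 4y)². The shear makes x + y the first coordinate; in the class 2 both squares are
-- divisible by 25 and the signed triangular sums cancel.
mixed-form-mod5 : HasSum (lattice mixed-sign mixed-form)
  (mono 0 ⊛ (f⁻ 3 2 ⊛ f⁻ 12 8)
   ⊕ (mono 1 ⊛ (f⁻ 4 1 ⊛ f⁻ 16 4)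
   ⊕ (mono 3 ⊛ ((f⁺ 15 5 ⊕ -1ℤ · f⁺ 15 5) ⊛ (f⁺ 60 20 ⊕ -1ℤ · f⁺ 60 20))
   ⊕ (mono 1 ⊛ (f⁻ 4 1 ⊛ f⁻ 16 4)
   ⊕ (mono 0 ⊛ (f⁻ 3 2 ⊛ f⁻ 12 8) ⊕ 𝟘)))))
mixed-form-mod5 = HasSum-shear -[1+ 0 ] (split-mod5
    (lattice-product mixed-sign mixed-form (coset-shear -[1+ 0 ] 5 0) (th-family 3 2 -1ℤ) (th-family 12 8 -1ℤ) 0 (+ 0) (+ 1) -[1+ 0 ] (+ 1) (+ 0) (+ 0) (+ 1) refl refl
      (λ i j → sgn-diff i j (ZS.solve 2 (λ i j → (affᴾ -[1+ 0 ] (+ 1) (+ 0) i j) =ᶻ j -ᶻ i) refl i j))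
      (ZS.solve 2 (λ i j → mixed-formᴾ (shearᴾ -[1+ 0 ] (modᴾ 5 0 (affᴾ (+ 0) (+ 1) (+ 0) i j)) (affᴾ -[1+ 0 ] (+ 1) (+ 0) i j)) (affᴾ -[1+ 0 ] (+ 1) (+ 0) i j) ≛ 0 ∔ thᴾ 3 2 i ∔ thᴾ 12 8 j) refl))
    (lattice-product mixed-sign mixed-form (coset-shear -[1+ 0 ] 5 1) (th-family 4 1 -1ℤ) (th-family 16 4 -1ℤ) 1 (+ 0) (+ 1) -[1+ 0 ] (+ 1) (+ 0) (+ 0) (+ 1) refl refl
      (λ i j → sgn-diff i j (ZS.solve 2 (λ i j → (affᴾ -[1+ 0 ] (+ 1) (+ 0) i j) =ᶻ j -ᶻ i) refl i j))
      (ZS.solve 2 (λ i j → mixed-formᴾ (shearᴾ -[1+ 0 ] (modᴾ 5 1 (affᴾ (+ 0) (+ 1) (+ 0) i j)) (affᴾ -[1+ 0 ] (+ 1) (+ 0) i j)) (affᴾ -[1+ 0 ] (+ 1) (+ 0) i j) ≛ 1 ∔ thᴾ 4 1 i ∔ thᴾ 16 4 j) refl))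
    (lattice-product mixed-sign mixed-form (coset-shear -[1+ 0 ] 5 2) (tri-family 5 -1ℤ refl) (tri-family 20 -1ℤ refl) 3 (+ 0) (+ 1) -[1+ 0 ] (+ 1) (+ 0) (+ 0) (+ 1) refl refl
      (λ i j → sgn-diff i j (ZS.solve 2 (λ i j → (affᴾ -[1+ 0 ] (+ 1) (+ 0) i j) =ᶻ j -ᶻ i) refl i j))
      (ZS.solve 2 (λ i j → mixed-formᴾ (shearᴾ -[1+ 0 ] (modᴾ 5 2 (affᴾ (+ 0) (+ 1) (+ 0) i j)) (affᴾ -[1+ 0 ] (+ 1) (+ 0) i j)) (affᴾ -[1+ 0 ] (+ 1) (+ 0) i j) ≛ 3 ∔ triᴾ 5 i ∔ triᴾ 20 j) refl))
    (lattice-product mixed-sign mixed-form (coset-shear -[1+ 0 ] 5 3) (th-family 4 1 -1ℤ) (th-family 16 4 -1ℤ) 1 (+ 0) -[1+ 0 ] (+ 1) -[1+ 0 ] -[1+ 0 ] (+ 0) (+ 1) refl refl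
      (λ i j → trans (ℤₚ.*-comm (sgn i) (sgn j)) (sgn-diff j i (ZS.solve 2 (λ i j → (affᴾ (+ 1) -[1+ 0 ] (+ 0) i j) =ᶻ i -ᶻ j) refl i j)))
      (ZS.solve 2 (λ i j → mixed-formᴾ (shearᴾ -[1+ 0 ] (modᴾ 5 3 (affᴾ (+ 0) -[1+ 0 ] -[1+ 0 ] i j)) (affᴾ (+ 1) -[1+ 0 ] (+ 0) i j)) (affᴾ (+ 1) -[1+ 0 ] (+ 0) i j) ≛ 1 ∔ thᴾ 4 1 i ∔ thᴾ 16 4 j) refl))
    (lattice-product mixed-sign mixed-form (coset-shear -[1+ 0 ] 5 4) (th-family 3 2 -1ℤ) (th-family 12 8 -1ℤ) 0 (+ 0) -[1+ 0 ] (+ 1) -[1+ 0 ] -[1+ 0 ] (+ 0) (+ 1) refl refl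
      (λ i j → trans (ℤₚ.*-comm (sgn i) (sgn j)) (sgn-diff j i (ZS.solve 2 (λ i j → (affᴾ (+ 1) -[1+ 0 ] (+ 0) i j) =ᶻ i -ᶻ j) refl i j)))
      (ZS.solve 2 (λ i j → mixed-formᴾ (shearᴾ -[1+ 0 ] (modᴾ 5 4 (affᴾ (+ 0) -[1+ 0 ] -[1+ 0 ] i j)) (affᴾ (+ 1) -[1+ 0 ] (+ 0) i j)) (affᴾ (+ 1) -[1+ 0 ] (+ 0) i j) ≛ 0 ∔ thᴾ 3 2 i ∔ thᴾ 12 8 j) refl)))

mixed-form-ψφ : HasSum (lattice mixed-sign mixed-form) (mono 0 ⊛ ((f⁺ 3 1 ⊕ (+ 1) · f⁺ 3 1) ⊛ f⁻ 2 2))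
mixed-form-ψφ = lattice-product mixed-sign mixed-form (λ x → x) (tri⁺ 1) (th-family 2 2 -1ℤ) 0 (+ 1) (+ 0) (+ 0) (+ 1) (+ 0) (+ 0) (+ 1) refl refl (λ i j → trans (ℤₚ.*-identityˡ (sgn j)) (cong sgn (ZS.solve 2 (λ i j → j =ᶻ (affᴾ (+ 0) (+ 1) (+ 0) i j)) refl i j)))
      (ZS.solve 2 (λ i j → mixed-formᴾ (affᴾ (+ 1) (+ 0) (+ 0) i j) (affᴾ (+ 0) (+ 1) (+ 0) i j) ≛ 0 ∔ triᴾ 1 i ∔ thᴾ 2 2 j) refl)

-- Theta function evaluations of the products of G and H

two four : Series
two = const (+ 2)
four = const (+ 4)

twice : ∀ f → f ⊕ (+ 1) · f ≈ two ⊛ f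
twice f = ≈-trans (⊕-congˡ f (·≈const (+ 1) f)) (solve 1 (λ f → f :+ con (+ 1) :* f := con (+ 2) :* f) ≈-refl f)

cancelled : ∀ f → f ⊕ -1ℤ · f ≈ 𝟘
cancelled f = mk≈ λ n → trans (cong (λ x → f n + x) (ℤₚ.-1*i≡-i (f n))) (ℤₚ.+-inverseʳ (f n))

𝟘≈const : 𝟘 ≈ const (+ 0)
𝟘≈const = mk≈ λ { zero → refl ; (suc n) → refl }

mono0-⊛ : ∀ f → mono 0 ⊛ f ≈ f
mono0-⊛ f = ≈-trans (⊛-congʳ f mono-0) (R.*-identityˡ f)

two-cancel : ∀ {f g} → two ⊛ f ≈ two ⊛ g → f ≈ g
two-cancel = ⊛-cancelˡ two (λ ())

five-terms : ∀ {a b c d e x} → a ⊕ (b ⊕ (c ⊕ (d ⊕ (e ⊕ 𝟘)))) ≈ x → ∀ {A B C D E} → a ≈ A → b ≈ B → c ≈ C → d ≈ D → e ≈ E →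
  A ⊕ B ⊕ C ⊕ D ⊕ E ≈ x
five-terms {a} {b} {c} {d} {e} p {A} {B} {C} {D} {E} pa pb pc pd pe = ≈-trans (≈-sym (begin
  a ⊕ (b ⊕ (c ⊕ (d ⊕ (e ⊕ 𝟘)))) ≈⟨ ⊕-cong pa (⊕-cong pb (⊕-cong pc (⊕-cong pd (⊕-cong pe 𝟘≈const)))) ⟩
  A ⊕ (B ⊕ (C ⊕ (D ⊕ (E ⊕ const (+ 0))))) ≈⟨ solve 5 (λ a b c d e → a :+ (b :+ (c :+ (d :+ (e :+ con (+ 0))))) := a :+ b :+ c :+ d :+ e) ≈-refl A B C D E ⟩
  A ⊕ B ⊕ C ⊕ D ⊕ E ∎)) p

four-terms : ∀ {a b c d x} → a ⊕ (b ⊕ (c ⊕ (d ⊕ 𝟘))) ≈ x → ∀ {A B C D} → a ≈ A → b ≈ B → c ≈ C → d ≈ D →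
  A ⊕ B ⊕ C ⊕ D ≈ x
four-terms {a} {b} {c} {d} p {A} {B} {C} {D} pa pb pc pd = ≈-trans (≈-sym (begin
  a ⊕ (b ⊕ (c ⊕ (d ⊕ 𝟘))) ≈⟨ ⊕-cong pa (⊕-cong pb (⊕-cong pc (⊕-cong pd 𝟘≈const))) ⟩
  A ⊕ (B ⊕ (C ⊕ (D ⊕ const (+ 0)))) ≈⟨ solve 4 (λ a b c d → a :+ (b :+ (c :+ (d :+ con (+ 0)))) := a :+ b :+ c :+ d) ≈-refl A B C D ⟩
  A ⊕ B ⊕ C ⊕ D ∎)) p

g h g₄ h₄ : Series
g = f⁻ 3 2
h = f⁻ 4 1
g₄ = f⁻ 12 8
h₄ = f⁻ 16 4

-- The classes 0, 4 and 1, 3 of the mixed form agree in pairs and the class 2 is zero; on the other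
-- side ψ occurs doubled because T is invariant under j ↦ -1 - j.
rogers-α : g ⊛ g₄ ⊕ q ⊛ (h ⊛ h₄) ≈ ψ ⊛ f⁻ 2 2
rogers-α = two-cancel (begin
  two ⊛ (g ⊛ g₄ ⊕ q ⊛ (h ⊛ h₄)) ≈⟨ collect (g ⊛ g₄) (q ⊛ (h ⊛ h₄)) ⟩
  g ⊛ g₄ ⊕ q ⊛ (h ⊛ h₄) ⊕ const (+ 0) ⊕ q ⊛ (h ⊛ h₄) ⊕ g ⊛ g₄
    ≈⟨ five-terms (HasSum-unique mixed-form-mod5 mixed-form-ψφ) (mono0-⊛ (g ⊛ g₄)) ≈-refl
         (≈-trans (⊛-congˡ (mono 3) (≈-trans (⊛-congʳ (f⁺ 60 20 ⊕ -1ℤ · f⁺ 60 20) (cancelled (f⁺ 15 5))) (R.zeroˡ (f⁺ 60 20 ⊕ -1ℤ · f⁺ 60 20))))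
           (≈-trans (R.zeroʳ (mono 3)) 𝟘≈const))
         ≈-refl (mono0-⊛ (g ⊛ g₄)) ⟩
  mono 0 ⊛ ((ψ ⊕ (+ 1) · ψ) ⊛ f⁻ 2 2) ≈⟨ ≈-trans (mono0-⊛ ((ψ ⊕ (+ 1) · ψ) ⊛ f⁻ 2 2)) (⊛-congʳ (f⁻ 2 2) (twice ψ)) ⟩
  two ⊛ ψ ⊛ f⁻ 2 2 ≈⟨ R.*-assoc two ψ (f⁻ 2 2) ⟩
  two ⊛ (ψ ⊛ f⁻ 2 2) ∎)
  where
  collect : ∀ a b → two ⊛ (a ⊕ b) ≈ a ⊕ b ⊕ const (+ 0) ⊕ b ⊕ a
  collect = solve 2 (λ a b → con (+ 2) :* (a :+ b) := a :+ b :+ con (+ 0) :+ b :+ a) ≈-refl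

rogers-γ : g ⊛ alt h ⊕ alt g ⊛ h ≈ two ⊛ (ψ ⊛ alt ψ)
rogers-γ = two-cancel (begin
  two ⊛ (g ⊛ alt h ⊕ alt g ⊛ h) ≈⟨ collect (g ⊛ alt h) (alt g ⊛ h) ⟩
  alt g ⊛ h ⊕ const (+ 0) ⊕ alt g ⊛ h ⊕ g ⊛ alt h ⊕ g ⊛ alt h
    ≈⟨ five-terms (HasSum-unique tri-form-signed-mod5 tri-form-ψψ⁻) (mono0-⊛ (alt g ⊛ h))
         (≈-trans (⊛-congˡ (mono 1) (≈-trans (⊛-congʳ N (cancelled (f⁺ 15 5))) (R.zeroˡ N))) (≈-trans (R.zeroʳ (mono 1)) 𝟘≈const))
         (mono0-⊛ (alt g ⊛ h)) (mono0-⊛ (g ⊛ alt h)) (mono0-⊛ (g ⊛ alt h)) ⟩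
  mono 0 ⊛ ((ψ ⊕ (+ 1) · ψ) ⊛ alt (ψ ⊕ (+ 1) · ψ)) ≈⟨ ≈-trans (mono0-⊛ ((ψ ⊕ (+ 1) · ψ) ⊛ alt (ψ ⊕ (+ 1) · ψ))) (⊛-cong (twice ψ)
       (≈-trans (CL.add alt-clinear ψ ((+ 1) · ψ)) (≈-trans (⊕-congˡ (alt ψ) (CL.scale alt-clinear (+ 1) ψ)) (twice (alt ψ))))) ⟩
  (two ⊛ ψ) ⊛ (two ⊛ alt ψ) ≈⟨ regroup two ψ (alt ψ) ⟩
  two ⊛ (two ⊛ (ψ ⊛ alt ψ)) ∎)
  where
  N = -1ℤ · alt (f⁺ 15 5 ⊕ -1ℤ · f⁺ 15 5)
  collect : ∀ a b → two ⊛ (a ⊕ b) ≈ b ⊕ const (+ 0) ⊕ b ⊕ a ⊕ a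
  collect = solve 2 (λ a b → con (+ 2) :* (a :+ b) := b :+ con (+ 0) :+ b :+ a :+ a) ≈-refl
  regroup : ∀ t x y → (t ⊛ x) ⊛ (t ⊛ y) ≈ t ⊛ (t ⊛ (x ⊛ y))
  regroup = solve∙ 3 (λ t x y → (t ∙ x) ∙ (t ∙ y) ⊜ t ∙ (t ∙ (x ∙ y))) ≈-refl

φ₅ : Series
φ₅ = f⁺ 5 5

-- It identifies the discriminant needed later: with α + β = φ(q) and αβ = q f(q⁷, q³) f(q⁹, q), (α
-- - β)² must be φ(q⁵)².
φ-square : φ ⊛ φ ≈ φ₅ ⊛ φ₅ ⊕ four ⊛ (q ⊛ (f⁺ 7 3 ⊛ f⁺ 9 1))
φ-square = ≈-sym (≈-trans (collect (φ₅ ⊛ φ₅) q (f⁺ 7 3) (f⁺ 9 1))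
  (≈-trans (five-terms (HasSum-unique sq-form-mod5 sq-form-φφ) (mono0-⊛ (φ₅ ⊛ φ₅)) ≈-refl ≈-refl ≈-refl ≈-refl) (mono0-⊛ (φ ⊛ φ))))
  where
  collect : ∀ a q x y → a ⊕ four ⊛ (q ⊛ (x ⊛ y)) ≈ a ⊕ q ⊛ (x ⊛ y) ⊕ q ⊛ (y ⊛ x) ⊕ q ⊛ (y ⊛ x) ⊕ q ⊛ (x ⊛ y)
  collect = solve 4 (λ a q x y → a :+ con (+ 4) :* (q :* (x :* y)) := a :+ q :* (x :* y) :+ q :* (y :* x) :+ q :* (y :* x) :+ q :* (x :* y)) ≈-refl

-- The counterpart for γ and δ, to be used with q replaced by q².
ψ-square : ψ ⊛ ψ ≈ f⁺ 3 2 ⊛ f⁺ 4 1 ⊕ q ⊛ (f⁺ 15 5 ⊛ f⁺ 15 5)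
ψ-square = two-cancel (two-cancel (≈-sym (begin
  two ⊛ (two ⊛ (x ⊕ q ⊛ (y ⊛ y))) ≈⟨ collect x q y ⟩
  x ⊕ q ⊛ ((two ⊛ y) ⊛ (two ⊛ y)) ⊕ x ⊕ x ⊕ x
    ≈⟨ five-terms (HasSum-unique tri-form-mod5 tri-form-ψψ) (mono0-⊛ x) (⊛-congˡ q (⊛-cong (twice y) (twice y))) (mono0-⊛ x) (mono0-⊛ x) (mono0-⊛ x) ⟩
  mono 0 ⊛ ((ψ ⊕ (+ 1) · ψ) ⊛ (ψ ⊕ (+ 1) · ψ)) ≈⟨ ≈-trans (mono0-⊛ ((ψ ⊕ (+ 1) · ψ) ⊛ (ψ ⊕ (+ 1) · ψ))) (⊛-cong (twice ψ) (twice ψ)) ⟩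
  (two ⊛ ψ) ⊛ (two ⊛ ψ) ≈⟨ regroup two ψ ⟩
  two ⊛ (two ⊛ (ψ ⊛ ψ)) ∎)))
  where
  x = f⁺ 3 2 ⊛ f⁺ 4 1
  y = f⁺ 15 5
  collect : ∀ x q y → two ⊛ (two ⊛ (x ⊕ q ⊛ (y ⊛ y))) ≈ x ⊕ q ⊛ ((two ⊛ y) ⊛ (two ⊛ y)) ⊕ x ⊕ x ⊕ x
  collect = solve 3 (λ x q y → con (+ 2) :* (con (+ 2) :* (x :+ q :* (y :* y))) := x :+ q :* ((con (+ 2) :* y) :* (con (+ 2) :* y)) :+ x :+ x :+ x) ≈-refl
  regroup : ∀ t x → (t ⊛ x) ⊛ (t ⊛ x) ≈ t ⊛ (t ⊛ (x ⊛ x))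
  regroup = solve∙ 2 (λ t x → (t ∙ x) ∙ (t ∙ x) ⊜ t ∙ (t ∙ (x ∙ x))) ≈-refl

-- From theta functions back to products of `G` and `H`

G₄ H₄ G⁻ H⁻ : Series
G₄ = dil 4 G
H₄ = dil 4 H
G⁻ = alt G
H⁻ = alt H

f₄⊛G₄ : f₄ ⊛ G₄ ≈ g₄
f₄⊛G₄ = ≈-trans (⊛-congʳ G₄ (≈-sym (dil-poch 4 -1ℤ 1 1))) (≈-trans (≈-sym (dil-⊛ 4 euler G)) (≈-trans (CL.≈-cong (dil-clinear 4) rogers-ramanujan-G) (dil-th 4 3 2 -1ℤ)))

f₄⊛H₄ : f₄ ⊛ H₄ ≈ h₄
f₄⊛H₄ = ≈-trans (⊛-congʳ H₄ (≈-sym (dil-poch 4 -1ℤ 1 1))) (≈-trans (≈-sym (dil-⊛ 4 euler H)) (≈-trans (CL.≈-cong (dil-clinear 4) rogers-ramanujan-H) (dil-th 4 4 1 -1ℤ)))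

euler⁻⊛G⁻ : alt euler ⊛ G⁻ ≈ alt g
euler⁻⊛G⁻ = ≈-trans (≈-sym (alt-⊛ euler G)) (CL.≈-cong alt-clinear rogers-ramanujan-G)

euler⁻⊛H⁻ : alt euler ⊛ H⁻ ≈ alt h
euler⁻⊛H⁻ = ≈-trans (≈-sym (alt-⊛ euler H)) (CL.≈-cong alt-clinear rogers-ramanujan-H)

regroup-pair : ∀ e f x y X Y d → e ⊛ x ≈ X → f ⊛ y ≈ Y → (e ⊛ f) ⊛ (d ⊛ (x ⊛ y)) ≈ d ⊛ (X ⊛ Y)
regroup-pair e f x y X Y d p r = ≈-trans (solve∙ 5 (λ e f d x y → (e ∙ f) ∙ (d ∙ (x ∙ y)) ⊜ d ∙ ((e ∙ x) ∙ (f ∙ y))) ≈-refl e f d x y)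
  (⊛-congˡ d (⊛-cong p r))

euler-0 : euler 0 ≡ + 1
euler-0 = poch-0 -1ℤ 1 1

cancel-ef₄ : ∀ {f g} → (euler ⊛ f₄) ⊛ f ≈ (euler ⊛ f₄) ⊛ g → f ≈ g
cancel-ef₄ = ⊛-cancelˡ (euler ⊛ f₄) (unit≢0 (cong₂ _*_ euler-0 (poch-0 -1ℤ 4 4)))

cancel-ee⁻ : ∀ {f g} → (euler ⊛ alt euler) ⊛ f ≈ (euler ⊛ alt euler) ⊛ g → f ≈ g
cancel-ee⁻ = ⊛-cancelˡ (euler ⊛ alt euler) (unit≢0 (cong₂ (λ x y → x * (+ 1 * y)) euler-0 euler-0))

-- The factor q in β is what makes α + β = φ(q) and α - β = φ(q⁵); for the other pair γ + δ = 2ψ(q²)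
-- and γ - δ = 2q ψ(q¹⁰).
α β γ δ : Series
α = f₂ ⊛ (G ⊛ G₄)
β = q ⊛ (f₂ ⊛ (H ⊛ H₄))
γ = f₂ ⊛ (G ⊛ H⁻)
δ = f₂ ⊛ (H ⊛ G⁻)

HG₄ : f₂ ⊛ (H ⊛ G₄) ≈ f⁺ 7 3
HG₄ = cancel-ef₄ (≈-trans (regroup-pair euler f₄ H G₄ h g₄ f₂ rogers-ramanujan-H f₄⊛G₄) product-HG4)

GH₄ : f₂ ⊛ (G ⊛ H₄) ≈ f⁺ 9 1
GH₄ = cancel-ef₄ (≈-trans (regroup-pair euler f₄ G H₄ g h₄ f₂ rogers-ramanujan-G f₄⊛H₄) product-GH4)

GG⁻ : f₂ ⊛ (G ⊛ G⁻) ≈ f⁺ 6 4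
GG⁻ = cancel-ee⁻ (≈-trans (regroup-pair euler (alt euler) G G⁻ g (alt g) f₂ rogers-ramanujan-G euler⁻⊛G⁻) product-GG⁻)

HH⁻ : f₂ ⊛ (H ⊛ H⁻) ≈ f⁺ 8 2
HH⁻ = cancel-ee⁻ (≈-trans (regroup-pair euler (alt euler) H H⁻ h (alt h) f₂ rogers-ramanujan-H euler⁻⊛H⁻) product-HH⁻)

α+β : α ⊕ β ≈ φ
α+β = cancel-ef₄ (begin
  (euler ⊛ f₄) ⊛ (α ⊕ β) ≈⟨ expand (euler ⊛ f₄) α q (f₂ ⊛ (H ⊛ H₄)) ⟩
  (euler ⊛ f₄) ⊛ α ⊕ q ⊛ ((euler ⊛ f₄) ⊛ (f₂ ⊛ (H ⊛ H₄))) ≈⟨ ⊕-cong (regroup-pair euler f₄ G G₄ g g₄ f₂ rogers-ramanujan-G f₄⊛G₄)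
      (⊛-congˡ q (regroup-pair euler f₄ H H₄ h h₄ f₂ rogers-ramanujan-H f₄⊛H₄)) ⟩
  f₂ ⊛ (g ⊛ g₄) ⊕ q ⊛ (f₂ ⊛ (h ⊛ h₄)) ≈⟨ expand f₂ (g ⊛ g₄) q (h ⊛ h₄) ⟨
  f₂ ⊛ (g ⊛ g₄ ⊕ q ⊛ (h ⊛ h₄)) ≈⟨ ⊛-congˡ f₂ rogers-α ⟩
  f₂ ⊛ (ψ ⊛ f⁻ 2 2) ≈⟨ product-ψφ ⟩
  (euler ⊛ f₄) ⊛ φ ∎)
  where
  expand : ∀ e a q b → e ⊛ (a ⊕ q ⊛ b) ≈ e ⊛ a ⊕ q ⊛ (e ⊛ b)
  expand = solve 4 (λ e a q b → e :* (a :+ q :* b) := e :* a :+ q :* (e :* b)) ≈-refl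

ψ₂ ψ₁₀ : Series
ψ₂ = f⁺ 6 2
ψ₁₀ = f⁺ 30 10

γ+δ : γ ⊕ δ ≈ two ⊛ ψ₂
γ+δ = cancel-ee⁻ (begin
  (euler ⊛ alt euler) ⊛ (γ ⊕ δ) ≈⟨ R.distribˡ (euler ⊛ alt euler) γ δ ⟩
  (euler ⊛ alt euler) ⊛ γ ⊕ (euler ⊛ alt euler) ⊛ δ ≈⟨ ⊕-cong (regroup-pair euler (alt euler) G H⁻ g (alt h) f₂ rogers-ramanujan-G euler⁻⊛H⁻)
      (≈-trans (regroup-pair euler (alt euler) H G⁻ h (alt g) f₂ rogers-ramanujan-H euler⁻⊛G⁻) (⊛-congˡ f₂ (R.*-comm h (alt g)))) ⟩
  f₂ ⊛ (g ⊛ alt h) ⊕ f₂ ⊛ (alt g ⊛ h) ≈⟨ R.distribˡ f₂ (g ⊛ alt h) (alt g ⊛ h) ⟨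
  f₂ ⊛ (g ⊛ alt h ⊕ alt g ⊛ h) ≈⟨ ⊛-congˡ f₂ rogers-γ ⟩
  f₂ ⊛ (two ⊛ (ψ ⊛ alt ψ)) ≈⟨ swap f₂ two (ψ ⊛ alt ψ) ⟩
  two ⊛ (f₂ ⊛ (ψ ⊛ alt ψ)) ≈⟨ ⊛-congˡ two product-ψψ⁻ ⟩
  two ⊛ ((euler ⊛ alt euler) ⊛ ψ₂) ≈⟨ swap two (euler ⊛ alt euler) ψ₂ ⟩
  (euler ⊛ alt euler) ⊛ (two ⊛ ψ₂) ∎)
  where
  swap : ∀ a b c → a ⊛ (b ⊛ c) ≈ b ⊛ (a ⊛ c)
  swap = solve∙ 3 (λ a b c → a ∙ (b ∙ c) ⊜ b ∙ (a ∙ c)) ≈-refl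

-- If (x + y)² = z² + 4 x y then x - y = ± z; the sign is fixed by a coefficient of x - y + z.
difference-of-squares : ∀ x y s z w → x ⊕ y ≈ s → x ⊛ y ≈ w → s ⊛ s ≈ z ⊛ z ⊕ four ⊛ w → (x ⊖ y ⊕ z) ⊛ (x ⊖ y ⊖ z) ≈ 𝟘
difference-of-squares x y s z w p r t = begin
  (x ⊖ y ⊕ z) ⊛ (x ⊖ y ⊖ z) ≈⟨ solve 3 (λ x y z → (x :- y :+ z) :* (x :- y :- z) := (x :+ y) :* (x :+ y) :- (z :* z :+ con (+ 4) :* (x :* y))) ≈-refl x y z ⟩
  (x ⊕ y) ⊛ (x ⊕ y) ⊖ (z ⊛ z ⊕ four ⊛ (x ⊛ y)) ≈⟨ ⊕-cong (⊛-cong p p) (⊝-cong (⊕-congˡ (z ⊛ z) (⊛-congˡ four r))) ⟩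
  s ⊛ s ⊖ (z ⊛ z ⊕ four ⊛ w) ≈⟨ ⊕-congʳ (⊝ (z ⊛ z ⊕ four ⊛ w)) t ⟩
  (z ⊛ z ⊕ four ⊛ w) ⊖ (z ⊛ z ⊕ four ⊛ w) ≈⟨ R.-‿inverseʳ (z ⊛ z ⊕ four ⊛ w) ⟩
  𝟘 ∎

-- αβ is q times the product of `HG₄` and `GH₄`. The other square root is excluded by the constant
-- term of α - β + φ(q⁵), which is 1 - 0 + 1 = 2.
α-β : α ⊖ β ≈ φ₅
α-β = ⊖≈𝟘⇒≈ (annihilator (α ⊖ β ⊕ φ₅) (α ⊖ β ⊖ φ₅) (λ e → case (trans (sym e) lead))
  (difference-of-squares α β φ φ₅ (q ⊛ (f⁺ 7 3 ⊛ f⁺ 9 1)) α+β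
    (≈-trans (solve∙ 6 (λ f q G G₄ H H₄ → (f ∙ (G ∙ G₄)) ∙ (q ∙ (f ∙ (H ∙ H₄))) ⊜ q ∙ ((f ∙ (H ∙ G₄)) ∙ (f ∙ (G ∙ H₄)))) ≈-refl f₂ q G G₄ H H₄)
      (⊛-congˡ q (⊛-cong HG₄ GH₄)))
    φ-square))
  where
  lead : (α ⊖ β ⊕ φ₅) 0 ≡ + 2
  lead = cong (λ x → x * + 1 - + 0 + + 1) (poch-0 -1ℤ 2 2)
  case : + 0 ≢ + 2
  case ()

-- Dividing f by q reduces to `annihilator`. This version is needed because γ and δ have the same
-- constant term.
annihilator₁ : ∀ f g → f 0 ≡ + 0 → f 1 ≢ + 0 → f ⊛ g ≈ 𝟘 → g ≈ 𝟘
annihilator₁ f g f0 f1 p = annihilator (tail f) g f1 (mk≈ λ n → trans (sym (trans (⊛-sucˡ f g n)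
  (trans (cong (λ x → x * g (suc n) + (tail f ⊛ g) n) f0) (ℤₚ.+-identityˡ ((tail f ⊛ g) n))))) (at p (suc n)))

ψ₂-square : ψ₂ ⊛ ψ₂ ≈ f⁺ 6 4 ⊛ f⁺ 8 2 ⊕ mono 2 ⊛ (ψ₁₀ ⊛ ψ₁₀)
ψ₂-square = begin
  ψ₂ ⊛ ψ₂ ≈⟨ ⊛-cong (dil-th 2 3 1 (+ 1)) (dil-th 2 3 1 (+ 1)) ⟨
  dil 2 ψ ⊛ dil 2 ψ ≈⟨ dil-⊛ 2 ψ ψ ⟨
  dil 2 (ψ ⊛ ψ) ≈⟨ CL.≈-cong (dil-clinear 2) ψ-square ⟩
  dil 2 (f⁺ 3 2 ⊛ f⁺ 4 1 ⊕ q ⊛ (f⁺ 15 5 ⊛ f⁺ 15 5)) ≈⟨ CL.add (dil-clinear 2) (f⁺ 3 2 ⊛ f⁺ 4 1) (q ⊛ (f⁺ 15 5 ⊛ f⁺ 15 5)) ⟩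
  dil 2 (f⁺ 3 2 ⊛ f⁺ 4 1) ⊕ dil 2 (q ⊛ (f⁺ 15 5 ⊛ f⁺ 15 5)) ≈⟨ ⊕-cong
    (≈-trans (dil-⊛ 2 (f⁺ 3 2) (f⁺ 4 1)) (⊛-cong (dil-th 2 3 2 (+ 1)) (dil-th 2 4 1 (+ 1))))
    (≈-trans (dil-⊛ 2 q (f⁺ 15 5 ⊛ f⁺ 15 5)) (⊛-cong (dil-mono 2 1)
      (≈-trans (dil-⊛ 2 (f⁺ 15 5) (f⁺ 15 5)) (⊛-cong (dil-th 2 15 5 (+ 1)) (dil-th 2 15 5 (+ 1)))))) ⟩
  f⁺ 6 4 ⊛ f⁺ 8 2 ⊕ mono 2 ⊛ (ψ₁₀ ⊛ ψ₁₀) ∎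

γ-δ : γ ⊖ δ ≈ two ⊛ (q ⊛ ψ₁₀)
-- By evaluation, γ - δ + z has constant term 1 - 1 + 0 and its coefficient of q is 1 + 1 + 2 = 4.
γ-δ = ⊖≈𝟘⇒≈ (annihilator₁ (γ ⊖ δ ⊕ z) (γ ⊖ δ ⊖ z) refl (λ ())
  (difference-of-squares γ δ (two ⊛ ψ₂) z (f⁺ 6 4 ⊛ f⁺ 8 2) γ+δ
    (≈-trans (solve∙ 5 (λ f G G⁻ H H⁻ → (f ∙ (G ∙ H⁻)) ∙ (f ∙ (H ∙ G⁻)) ⊜ (f ∙ (G ∙ G⁻)) ∙ (f ∙ (H ∙ H⁻))) ≈-refl f₂ G G⁻ H H⁻) (⊛-cong GG⁻ HH⁻))
    (≈-trans (solve 1 (λ p → (con (+ 2) :* p) :* (con (+ 2) :* p) := con (+ 4) :* (p :* p)) ≈-refl ψ₂)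
    (≈-trans (⊛-congˡ four (≈-trans ψ₂-square (⊕-congˡ ab (⊛-congʳ (ψ₁₀ ⊛ ψ₁₀) (≈-sym (mono-⊛ 1 1))))))
      (solve 3 (λ x q p → con (+ 4) :* (x :+ (q :* q) :* (p :* p)) := (con (+ 2) :* (q :* p)) :* (con (+ 2) :* (q :* p)) :+ con (+ 4) :* x) ≈-refl ab q ψ₁₀)))))
  where
  z = two ⊛ (q ⊛ ψ₁₀)
  ab = f⁺ 6 4 ⊛ f⁺ 8 2

-- The two identities

-- φ(q⁴) and 2ψ(q⁸): E and q O are the even and odd parts of φ(q), from the even and odd squares.
E O : Series
E = f⁺ 4 4
O = two ⊛ f⁺ 24 8

φ-parity : φ ≈ E ⊕ q ⊛ O
φ-parity = ≈-trans (HasSum-unique (HasSum-th 1 1 (+ 1)) (HasSum-mod₁ 2 {S = λ { Fin.zero → E ; (Fin.suc Fin.zero) → q ⊛ O₈ }} λ where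
    Fin.zero → Sums-cong (λ k → trans (pw-1 k) (sym (pw-1 (+ 2 * k + + 0)))) even ≈-refl (HasSum-th 4 4 (+ 1))
    (Fin.suc Fin.zero) → HasSum-cong odd ≈-refl (HasSum-clinear (clinear-⊛ˡ q) (HasSum-tri 8 (+ 1) refl))))
  (⊕-congˡ E (≈-trans (R.+-identityʳ (q ⊛ O₈)) (⊛-congˡ q (twice (f⁺ 24 8)))))
  where
  O₈ = f⁺ 24 8 ⊕ (+ 1) · f⁺ 24 8
  even : ∀ k → thExp 4 4 k ≡ thExp 1 1 (+ 2 * k + + 0)
  even k = ℤₚ.+-injective (double-injective (trans (double-thExp 4 4 k) (trans
    (ZS.solve 1 (λ k → #ᶻ 4 *ᶻ (k *ᶻ k +ᶻ k) +ᶻ #ᶻ 4 *ᶻ (k *ᶻ k -ᶻ k)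
      =ᶻ let j = #ᶻ 2 *ᶻ k +ᶻ #ᶻ 0 in #ᶻ 1 *ᶻ (j *ᶻ j +ᶻ j) +ᶻ #ᶻ 1 *ᶻ (j *ᶻ j -ᶻ j)) refl k)
    (sym (double-thExp 1 1 (+ 2 * k + + 0))))))
  odd-exp : ∀ k → 1 ℕ.+ 8 ℕ.* T k ≡ thExp 1 1 (+ 2 * k + + 1)
  odd-exp k = ℤₚ.+-injective (double-injective (trans
    (trans (cong (+ 2 *_) (ℤₚ.pos-+ 1 (8 ℕ.* T k))) (ℤₚ.*-distribˡ-+ (+ 2) (+ 1) (+ (8 ℕ.* T k))))
    (trans (cong (λ x → + 2 * + 1 + x) (double-AT 8 k)) (trans
    (ZS.solve 1 (λ k → #ᶻ 2 *ᶻ #ᶻ 1 +ᶻ #ᶻ 8 *ᶻ (k *ᶻ k +ᶻ k)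
      =ᶻ let j = #ᶻ 2 *ᶻ k +ᶻ #ᶻ 1 in #ᶻ 1 *ᶻ (j *ᶻ j +ᶻ j) +ᶻ #ᶻ 1 *ᶻ (j *ᶻ j -ᶻ j)) refl k)
    (sym (double-thExp 1 1 (+ 2 * k + + 1)))))))
  odd : ∀ k → q ⊛ (pw (+ 1) k · mono (8 ℕ.* T k)) ≈ thTerm 1 1 (+ 1) (+ 2 * k + + 1)
  odd k = ≈-trans (CL.scale (clinear-⊛ˡ q) (pw (+ 1) k) (mono (8 ℕ.* T k))) (≈-trans (·-cong (pw (+ 1) k) (mono-⊛ 1 (8 ℕ.* T k)))
    (mk≈ λ n → cong₂ (λ x e → (x · mono e) n) (trans (pw-1 k) (sym (pw-1 (+ 2 * k + + 1)))) (odd-exp k)))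

alt-dilated : ∀ k .{{_ : NonZero k}} {f g} → -1ℤ ^ k ≡ + 1 → dil k f ≈ g → alt g ≈ g
alt-dilated k {f} {g} even r = ≈-trans (CL.≈-cong alt-clinear (≈-sym r)) (≈-trans (alt-dil-even k even f) r)

φ⁻-parity : alt φ ≈ E ⊖ q ⊛ O
φ⁻-parity = begin
  alt φ ≈⟨ CL.≈-cong alt-clinear φ-parity ⟩
  alt (E ⊕ q ⊛ O) ≈⟨ CL.add alt-clinear E (q ⊛ O) ⟩
  alt E ⊕ alt (q ⊛ O) ≈⟨ ⊕-cong (alt-dilated 4 refl (dil-th 4 1 1 (+ 1))) (≈-trans (alt-⊛ q O) (⊛-cong (alt-mono 1)
      (≈-trans (alt-⊛ two (f⁺ 24 8)) (⊛-cong alt-two (alt-dilated 8 refl (dil-th 8 3 1 (+ 1))))))) ⟩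
  E ⊕ ((-1ℤ ^ 1) · q) ⊛ O ≈⟨ ⊕-congˡ E (⊛-congʳ O (·≈const (-1ℤ ^ 1) q)) ⟩
  E ⊕ (const -1ℤ ⊛ q) ⊛ O ≈⟨ sign E q O ⟩
  E ⊖ q ⊛ O ∎
  where
  alt-two : alt two ≈ two
  alt-two = mk≈ λ { zero → refl ; (suc n) → ℤₚ.*-zeroʳ (-1ℤ ^ suc n) }
  sign : ∀ e q o → e ⊕ (const -1ℤ ⊛ q) ⊛ o ≈ e ⊖ q ⊛ o
  sign = solve 3 (λ e q o → e :+ (con -1ℤ :* q) :* o := e :- q :* o) ≈-refl

-- The superscript of f ′ is the substitution q ↦ Q = q^19.
infix 9 _′
_′ : Series → Series
f ′ = dil 19 f

′-cong : ∀ {f g} → f ≈ g → f ′ ≈ g ′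
′-cong = CL.≈-cong (dil-clinear 19)

′-⊛ : ∀ f g → (f ⊛ g) ′ ≈ f ′ ⊛ g ′
′-⊛ = dil-⊛ 19

′-⊕ : ∀ f g → (f ⊕ g) ′ ≈ f ′ ⊕ g ′
′-⊕ = CL.add (dil-clinear 19)

′-⊖ : ∀ f g → (f ⊖ g) ′ ≈ f ′ ⊖ g ′
′-⊖ f g = ≈-trans (′-⊕ f (⊝ g)) (⊕-congˡ (f ′) (≈-trans (′-cong (neg g)) (≈-trans (CL.scale (dil-clinear 19) -1ℤ g) (≈-sym (neg (g ′))))))
  where
  neg : ∀ f → ⊝ f ≈ -1ℤ · f
  neg f = mk≈ λ n → sym (ℤₚ.-1*i≡-i (f n))

′-two : two ′ ≈ two
′-two = ≈-trans (′-cong (mk≈ λ { zero → refl ; (suc n) → refl })) (≈-trans (CL.scale (dil-clinear 19) (+ 2) one)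
  (≈-trans (·-cong (+ 2) (dil-one 19)) (mk≈ λ { zero → refl ; (suc n) → refl })))

′-⊛₃ : ∀ f g h → (f ⊛ (g ⊛ h)) ′ ≈ f ′ ⊛ (g ′ ⊛ h ′)
′-⊛₃ f g h = ≈-trans (′-⊛ f (g ⊛ h)) (⊛-congˡ (f ′) (′-⊛ g h))

pair-product : ∀ f x y {s} → f ⊛ (x ⊛ y) ≈ s → (f ⊛ f ′) ⊛ ((x ⊛ x ′) ⊛ (y ⊛ y ′)) ≈ s ⊛ s ′
pair-product f x y {s} r = ≈-trans
  (solve∙ 6 (λ f f′ x x′ y y′ → (f ∙ f′) ∙ ((x ∙ x′) ∙ (y ∙ y′)) ⊜ (f ∙ (x ∙ y)) ∙ (f′ ∙ (x′ ∙ y′))) ≈-refl f (f ′) x (x ′) y (y ′))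
  (⊛-cong r (≈-trans (≈-sym (′-⊛₃ f x y)) (′-cong r)))

U-expanded : U1-19 ≈ G ⊛ G ′ ⊕ mono 4 ⊛ (H ⊛ H ′)
U-expanded = ⊕-congˡ (G ⊛ G ′) (shift≈⊛ 4 (H ⊛ H ′))

U₄-expanded : dil 4 U1-19 ≈ G₄ ⊛ G₄ ′ ⊕ mono 16 ⊛ (H₄ ⊛ H₄ ′)
U₄-expanded = begin
  dil 4 U1-19 ≈⟨ CL.≈-cong (dil-clinear 4) U-expanded ⟩
  dil 4 (G ⊛ G ′ ⊕ mono 4 ⊛ (H ⊛ H ′)) ≈⟨ CL.add (dil-clinear 4) (G ⊛ G ′) (mono 4 ⊛ (H ⊛ H ′)) ⟩
  dil 4 (G ⊛ G ′) ⊕ dil 4 (mono 4 ⊛ (H ⊛ H ′)) ≈⟨ ⊕-cong (pair G)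
     (≈-trans (dil-⊛ 4 (mono 4) (H ⊛ H ′)) (⊛-cong (dil-mono 4 4) (pair H))) ⟩
  G₄ ⊛ G₄ ′ ⊕ mono 16 ⊛ (H₄ ⊛ H₄ ′) ∎
  where
  pair : ∀ f → dil 4 (f ⊛ f ′) ≈ dil 4 f ⊛ (dil 4 f) ′
  pair f = ≈-trans (dil-⊛ 4 f (f ′)) (⊛-congˡ (dil 4 f) (dil-comm 4 19 f))

U⁻-expanded : alt U1-19 ≈ G⁻ ⊛ G⁻ ′ ⊕ mono 4 ⊛ (H⁻ ⊛ H⁻ ′)
U⁻-expanded = begin
  alt U1-19 ≈⟨ CL.≈-cong alt-clinear U-expanded ⟩
  alt (G ⊛ G ′ ⊕ mono 4 ⊛ (H ⊛ H ′)) ≈⟨ CL.add alt-clinear (G ⊛ G ′) (mono 4 ⊛ (H ⊛ H ′)) ⟩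
  alt (G ⊛ G ′) ⊕ alt (mono 4 ⊛ (H ⊛ H ′)) ≈⟨ ⊕-cong (pair G)
     (≈-trans (alt-⊛ (mono 4) (H ⊛ H ′)) (⊛-cong (≈-trans (alt-mono 4) (mk≈ λ n → ℤₚ.*-identityˡ (mono 4 n))) (pair H))) ⟩
  G⁻ ⊛ G⁻ ′ ⊕ mono 4 ⊛ (H⁻ ⊛ H⁻ ′) ∎
  where
  pair : ∀ f → alt (f ⊛ f ′) ≈ alt f ⊛ (alt f) ′
  pair f = ≈-trans (alt-⊛ f (f ′)) (⊛-congˡ (alt f) (alt-dil 19 refl f))

-- Both sides multiplied by (q²;q²)_∞ (Q²;Q²)_∞

F : Series
F = f₂ ⊛ f₂ ′

expand-product : ∀ F X Y Z W a b → F ⊛ ((X ⊕ a ⊛ Y) ⊛ (Z ⊕ b ⊛ W)) ≈ F ⊛ (X ⊛ Z) ⊕ (a ⊛ b) ⊛ (F ⊛ (Y ⊛ W)) ⊕ b ⊛ (F ⊛ (X ⊛ W)) ⊕ a ⊛ (F ⊛ (Y ⊛ Z))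
expand-product = solve 7 (λ F X Y Z W a b → F :* ((X :+ a :* Y) :* (Z :+ b :* W))
  := F :* (X :* Z) :+ (a :* b) :* (F :* (Y :* W)) :+ b :* (F :* (X :* W)) :+ a :* (F :* (Y :* Z))) ≈-refl

η θ : Series
η = f⁺ 7 3
θ = f⁺ 9 1

-- Only x + y and x - y will have simple theta evaluations; this expresses the wanted combination
-- through them.
polarize : ∀ x y → two ⊛ (x ⊛ x ′ ⊕ y ⊛ y ′) ≈ (x ⊕ y) ⊛ (x ⊕ y) ′ ⊕ (x ⊖ y) ⊛ (x ⊖ y) ′
polarize x y = ≈-trans (solve 4 (λ x x′ y y′ → con (+ 2) :* (x :* x′ :+ y :* y′) := (x :+ y) :* (x′ :+ y′) :+ (x :- y) :* (x′ :- y′)) ≈-refl x (x ′) y (y ′))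
  (⊕-cong (⊛-congˡ (x ⊕ y) (≈-sym (′-⊕ x y))) (⊛-congˡ (x ⊖ y) (≈-sym (′-⊖ x y))))

square-cong : ∀ {x y} → x ≈ y → x ⊛ x ′ ≈ y ⊛ y ′
square-cong r = ⊛-cong r (′-cong r)

-- The two mixed products of `G` and `H` are single theta functions. The other two fit together
-- because q⁴ · q¹⁶ = q · q¹⁹, precisely the weight contained in β times β at Q.
FUU₄ : F ⊛ (U1-19 ⊛ dil 4 U1-19) ≈ (α ⊛ α ′ ⊕ β ⊛ β ′) ⊕ mono 16 ⊛ (θ ⊛ θ ′) ⊕ mono 4 ⊛ (η ⊛ η ′)
FUU₄ = begin
  F ⊛ (U1-19 ⊛ dil 4 U1-19) ≈⟨ ⊛-congˡ F (⊛-cong U-expanded U₄-expanded) ⟩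
  F ⊛ ((G ⊛ G ′ ⊕ mono 4 ⊛ (H ⊛ H ′)) ⊛ (G₄ ⊛ G₄ ′ ⊕ mono 16 ⊛ (H₄ ⊛ H₄ ′))) ≈⟨ expand-product F (G ⊛ G ′) (H ⊛ H ′) (G₄ ⊛ G₄ ′) (H₄ ⊛ H₄ ′) (mono 4) (mono 16) ⟩
  F ⊛ ((G ⊛ G ′) ⊛ (G₄ ⊛ G₄ ′)) ⊕ (mono 4 ⊛ mono 16) ⊛ (F ⊛ ((H ⊛ H ′) ⊛ (H₄ ⊛ H₄ ′)))
    ⊕ mono 16 ⊛ (F ⊛ ((G ⊛ G ′) ⊛ (H₄ ⊛ H₄ ′))) ⊕ mono 4 ⊛ (F ⊛ ((H ⊛ H ′) ⊛ (G₄ ⊛ G₄ ′)))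
    ≈⟨ ⊕-cong (⊕-cong (⊕-cong (pair-product f₂ G G₄ ≈-refl) ββ′)
         (⊛-congˡ (mono 16) (pair-product f₂ G H₄ GH₄))) (⊛-congˡ (mono 4) (pair-product f₂ H G₄ HG₄)) ⟩
  (α ⊛ α ′ ⊕ β ⊛ β ′) ⊕ mono 16 ⊛ (θ ⊛ θ ′) ⊕ mono 4 ⊛ (η ⊛ η ′) ∎
  where
  b = f₂ ⊛ (H ⊛ H₄)
  ββ′ : (mono 4 ⊛ mono 16) ⊛ (F ⊛ ((H ⊛ H ′) ⊛ (H₄ ⊛ H₄ ′))) ≈ β ⊛ β ′
  ββ′ = ≈-trans (⊛-cong (≈-trans (mono-⊛ 4 16) (≈-sym (mono-⊛ 1 19))) (pair-product f₂ H H₄ {b} ≈-refl))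
    (≈-trans (solve∙ 4 (λ q q′ b b′ → (q ∙ q′) ∙ (b ∙ b′) ⊜ (q ∙ b) ∙ (q′ ∙ b′)) ≈-refl q (mono 19) b (b ′))
    (⊛-congˡ β (≈-sym (≈-trans (′-⊛ q b) (⊛-congʳ (b ′) (dil-mono 19 1))))))

-- Here the roles are exchanged: the GG- and HH-products are single theta functions, and the mixed
-- ones, both of weight q⁴, give γ and δ.
FUU⁻ : F ⊛ (U1-19 ⊛ alt U1-19) ≈ f⁺ 6 4 ⊛ f⁺ 6 4 ′ ⊕ mono 8 ⊛ (f⁺ 8 2 ⊛ f⁺ 8 2 ′) ⊕ mono 4 ⊛ (γ ⊛ γ ′ ⊕ δ ⊛ δ ′)
FUU⁻ = begin
  F ⊛ (U1-19 ⊛ alt U1-19) ≈⟨ ⊛-congˡ F (⊛-cong U-expanded U⁻-expanded) ⟩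
  F ⊛ ((G ⊛ G ′ ⊕ mono 4 ⊛ (H ⊛ H ′)) ⊛ (G⁻ ⊛ G⁻ ′ ⊕ mono 4 ⊛ (H⁻ ⊛ H⁻ ′))) ≈⟨ expand-product F (G ⊛ G ′) (H ⊛ H ′) (G⁻ ⊛ G⁻ ′) (H⁻ ⊛ H⁻ ′) (mono 4) (mono 4) ⟩
  F ⊛ ((G ⊛ G ′) ⊛ (G⁻ ⊛ G⁻ ′)) ⊕ (mono 4 ⊛ mono 4) ⊛ (F ⊛ ((H ⊛ H ′) ⊛ (H⁻ ⊛ H⁻ ′)))
    ⊕ mono 4 ⊛ (F ⊛ ((G ⊛ G ′) ⊛ (H⁻ ⊛ H⁻ ′))) ⊕ mono 4 ⊛ (F ⊛ ((H ⊛ H ′) ⊛ (G⁻ ⊛ G⁻ ′)))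
    ≈⟨ ⊕-cong (⊕-cong (⊕-cong (pair-product f₂ G G⁻ GG⁻) (⊛-cong (mono-⊛ 4 4) (pair-product f₂ H H⁻ HH⁻)))
         (⊛-congˡ (mono 4) (pair-product f₂ G H⁻ ≈-refl))) (⊛-congˡ (mono 4) (pair-product f₂ H G⁻ ≈-refl)) ⟩
  a ⊕ b ⊕ mono 4 ⊛ (γ ⊛ γ ′) ⊕ mono 4 ⊛ (δ ⊛ δ ′) ≈⟨ collect a b (mono 4) (γ ⊛ γ ′) (δ ⊛ δ ′) ⟩
  a ⊕ b ⊕ mono 4 ⊛ (γ ⊛ γ ′ ⊕ δ ⊛ δ ′) ∎
  where
  a = f⁺ 6 4 ⊛ f⁺ 6 4 ′
  b = mono 8 ⊛ (f⁺ 8 2 ⊛ f⁺ 8 2 ′)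
  collect : ∀ a b m x y → a ⊕ b ⊕ m ⊛ x ⊕ m ⊛ y ≈ a ⊕ b ⊕ m ⊛ (x ⊕ y)
  collect = solve 5 (λ a b m x y → a :+ b :+ m :* x :+ m :* y := a :+ b :+ m :* (x :+ y)) ≈-refl

Fκκ : F ⊛ κκ ≈ φ ⊛ φ ′
Fκκ = ≈-trans (solve∙ 4 (λ f f′ k k′ → (f ∙ f′) ∙ (k ∙ k ∙ k′ ∙ k′) ⊜ (k ∙ k ∙ f) ∙ (k′ ∙ k′ ∙ f′)) ≈-refl f₂ (f₂ ′) κ (κ ′))
  (⊛-cong product-φ (≈-trans (≈-sym (≈-trans (′-⊛ (κ ⊛ κ) f₂) (⊛-congʳ (f₂ ′) (′-⊛ κ κ)))) (′-cong product-φ)))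

product-φ⁻ : alt κ ⊛ alt κ ⊛ f₂ ≈ alt φ
product-φ⁻ = ≈-trans (⊛-cong (≈-sym (alt-⊛ κ κ)) (≈-sym (alt-poch -1ℤ 2 2 refl))) (≈-trans (≈-sym (alt-⊛ (κ ⊛ κ) f₂)) (CL.≈-cong alt-clinear product-φ))

Fκκ⁻ : F ⊛ κκ⁻ ≈ alt φ ⊛ (alt φ) ′
Fκκ⁻ = ≈-trans (solve∙ 4 (λ f f′ k k′ → (f ∙ f′) ∙ (k ∙ k ∙ k′ ∙ k′) ⊜ (k ∙ k ∙ f) ∙ (k′ ∙ k′ ∙ f′)) ≈-refl f₂ (f₂ ′) (alt κ) ((alt κ) ′))
  (⊛-cong product-φ⁻ (≈-trans (≈-sym (≈-trans (′-⊛ (alt κ ⊛ alt κ) f₂) (⊛-congʳ (f₂ ′) (′-⊛ (alt κ) (alt κ))))) (′-cong product-φ⁻)))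

-- By `product-ψ₂`, F is `κκ2` times ψ(q²)ψ(Q²), so the inverse cancels without any knowledge of its
-- coefficients.
Fκκ2 : F ⊛ inv κκ2 ≈ ψ₂ ⊛ ψ₂ ′
Fκκ2 = begin
  F ⊛ inv κκ2 ≈⟨ ⊛-congʳ (inv κκ2) (⊛-cong product-ψ₂ (≈-trans (≈-sym (≈-trans (′-⊛ (κm2 ⊛ κm2) ψ₂) (⊛-congʳ (ψ₂ ′) (′-⊛ κm2 κm2)))) (′-cong product-ψ₂))) ⟨
  (κm2 ⊛ κm2 ⊛ ψ₂) ⊛ (κm2 ′ ⊛ κm2 ′ ⊛ ψ₂ ′) ⊛ inv κκ2
    ≈⟨ solve∙ 5 (λ k k′ p p′ i → (k ∙ k ∙ p) ∙ (k′ ∙ k′ ∙ p′) ∙ i ⊜ ((k ∙ k ∙ k′ ∙ k′) ∙ i) ∙ (p ∙ p′)) ≈-refl κm2 (κm2 ′) ψ₂ (ψ₂ ′) (inv κκ2) ⟩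
  (κκ2 ⊛ inv κκ2) ⊛ (ψ₂ ⊛ ψ₂ ′) ≈⟨ ≈-trans (⊛-congʳ (ψ₂ ⊛ ψ₂ ′) (⊛-inv κκ2 refl)) (R.*-identityˡ (ψ₂ ⊛ ψ₂ ′)) ⟩
  ψ₂ ⊛ ψ₂ ′ ∎

φ′-parity : φ ′ ≈ E ′ ⊕ mono 19 ⊛ O ′
φ′-parity = ≈-trans (′-cong φ-parity) (≈-trans (′-⊕ E (q ⊛ O)) (⊕-congˡ (E ′) (≈-trans (′-⊛ q O) (⊛-congʳ (O ′) (dil-mono 19 1)))))

φ⁻′-parity : (alt φ) ′ ≈ E ′ ⊖ mono 19 ⊛ O ′
φ⁻′-parity = ≈-trans (′-cong φ⁻-parity) (≈-trans (′-⊖ E (q ⊛ O)) (⊕-congˡ (E ′) (⊝-cong (≈-trans (′-⊛ q O) (⊛-congʳ (O ′) (dil-mono 19 1))))))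

-- The even-even and odd-odd products survive, with q · Q = q²⁰; they are the classes 0 and 2 modulo
-- 4 of the form 4x² + 2xy + 5y².
φφ-sum : φ ⊛ φ ′ ⊕ alt φ ⊛ (alt φ) ′ ≈ two ⊛ (E ⊛ E ′ ⊕ mono 20 ⊛ (O ⊛ O ′))
φφ-sum = ≈-trans (⊕-cong (⊛-cong φ-parity φ′-parity) (⊛-cong φ⁻-parity φ⁻′-parity))
  (≈-trans (solve 6 (λ e e′ q q′ o o′ → (e :+ q :* o) :* (e′ :+ q′ :* o′) :+ (e :- q :* o) :* (e′ :- q′ :* o′) := con (+ 2) :* (e :* e′ :+ (q :* q′) :* (o :* o′))) ≈-refl E (E ′) q (mono 19) O (O ′))
  (⊛-congˡ two (⊕-congˡ (E ⊛ E ′) (⊛-congʳ (O ⊛ O ′) (mono-⊛ 1 19)))))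

-- The mixed products survive; they are the classes 0 and 2 modulo 4 of the odd form.
φφ-difference : φ ⊛ φ ′ ⊖ alt φ ⊛ (alt φ) ′ ≈ two ⊛ (q ⊛ (E ′ ⊛ O) ⊕ mono 19 ⊛ (O ′ ⊛ E))
φφ-difference = ≈-trans (⊕-cong (⊛-cong φ-parity φ′-parity) (⊝-cong (⊛-cong φ⁻-parity φ⁻′-parity)))
  (solve 6 (λ e e′ q q′ o o′ → (e :+ q :* o) :* (e′ :+ q′ :* o′) :- (e :- q :* o) :* (e′ :- q′ :* o′) := con (+ 2) :* (q :* (e′ :* o) :+ q′ :* (o′ :* e))) ≈-refl E (E ′) q (mono 19) O (O ′))

-- The two lattice identities

th′ : ∀ A B .{{_ : NonZero A}} .{{_ : NonZero B}} → th (19 ℕ.* A) (19 ℕ.* B) (+ 1) ≈ th A B (+ 1) ′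
th′ A B = ≈-sym (dil-th 19 A B (+ 1))

th-pair : ∀ A B .{{_ : NonZero A}} .{{_ : NonZero B}} → th (19 ℕ.* A) (19 ℕ.* B) (+ 1) ⊛ th A B (+ 1) ≈ th A B (+ 1) ⊛ th A B (+ 1) ′
th-pair A B = ≈-trans (⊛-congʳ (th A B (+ 1)) (th′ A B)) (R.*-comm (th A B (+ 1) ′) (th A B (+ 1)))

twice′ : ∀ A B .{{_ : NonZero A}} .{{_ : NonZero B}} → th (19 ℕ.* A) (19 ℕ.* B) (+ 1) ⊕ (+ 1) · th (19 ℕ.* A) (19 ℕ.* B) (+ 1) ≈ (two ⊛ th A B (+ 1)) ′
twice′ A B = ≈-trans (twice (th (19 ℕ.* A) (19 ℕ.* B) (+ 1))) (≈-trans (⊛-cong (≈-sym ′-two) (th′ A B)) (≈-sym (′-⊛ two (th A B (+ 1)))))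

-- Opposite residue classes give equal contributions, 1 with 4 and 2 with 3 modulo 5, 1 with 3
-- modulo 4; hence the coefficients 2.
form-4-2-5-identity : φ₅ ⊛ φ₅ ′ ⊕ two ⊛ (mono 4 ⊛ (η ⊛ η ′)) ⊕ two ⊛ (mono 16 ⊛ (θ ⊛ θ ′))
  ≈ (E ⊛ E ′ ⊕ mono 20 ⊛ (O ⊛ O ′)) ⊕ two ⊛ (mono 5 ⊛ (ψ₂ ⊛ ψ₂ ′))
form-4-2-5-identity = begin
  φ₅ ⊛ φ₅ ′ ⊕ two ⊛ x ⊕ two ⊛ y ≈⟨ collect₅ (φ₅ ⊛ φ₅ ′) x y ⟩
  φ₅ ⊛ φ₅ ′ ⊕ x ⊕ y ⊕ y ⊕ x
    ≈⟨ five-terms (HasSum-unique form-4-2-5-mod5 form-4-2-5-mod4) (≈-trans (mono0-⊛ (f⁺ 95 95 ⊛ φ₅)) (th-pair 5 5))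
         (⊛-congˡ (mono 4) (th-pair 7 3)) (⊛-congˡ (mono 16) (th-pair 9 1)) (⊛-congˡ (mono 16) (th-pair 9 1)) (⊛-congˡ (mono 4) (th-pair 7 3)) ⟩
  _ ≈⟨ four-terms ≈-refl (≈-trans (mono0-⊛ (f⁺ 76 76 ⊛ E)) (th-pair 4 4)) (⊛-congˡ (mono 5) (th-pair 6 2))
         (⊛-congˡ (mono 20) (≈-trans (⊛-cong (twice′ 24 8) (twice (f⁺ 24 8))) (R.*-comm (O ′) O))) (⊛-congˡ (mono 5) (th-pair 6 2)) ⟨
  E ⊛ E ′ ⊕ z ⊕ mono 20 ⊛ (O ⊛ O ′) ⊕ z ≈⟨ collect₄ (E ⊛ E ′) z (mono 20 ⊛ (O ⊛ O ′)) ⟩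
  (E ⊛ E ′ ⊕ mono 20 ⊛ (O ⊛ O ′)) ⊕ two ⊛ z ∎
  where
  x = mono 4 ⊛ (η ⊛ η ′)
  y = mono 16 ⊛ (θ ⊛ θ ′)
  z = mono 5 ⊛ (ψ₂ ⊛ ψ₂ ′)
  collect₅ : ∀ a x y → a ⊕ two ⊛ x ⊕ two ⊛ y ≈ a ⊕ x ⊕ y ⊕ y ⊕ x
  collect₅ = solve 3 (λ a x y → a :+ con (+ 2) :* x :+ con (+ 2) :* y := a :+ x :+ y :+ y :+ x) ≈-refl
  collect₄ : ∀ a z b → a ⊕ z ⊕ b ⊕ z ≈ (a ⊕ b) ⊕ two ⊛ z
  collect₄ = solve 3 (λ a z b → a :+ z :+ b :+ z := (a :+ b) :+ con (+ 2) :* z) ≈-refl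

-- Modulo 5 the reflection n ↦ -n pairs the classes 0 with 4 and 1 with 3 of x; the class 2 is its
-- own mirror image and contributes 4 through two doubled ψ.
odd-form-identity : two ⊛ (q ⊛ (f⁺ 6 4 ⊛ f⁺ 6 4 ′)) ⊕ two ⊛ (mono 9 ⊛ (f⁺ 8 2 ⊛ f⁺ 8 2 ′)) ⊕ four ⊛ (mono 25 ⊛ (ψ₁₀ ⊛ ψ₁₀ ′))
  ≈ (q ⊛ (E ′ ⊛ O) ⊕ mono 19 ⊛ (O ′ ⊛ E)) ⊕ two ⊛ (mono 5 ⊛ (ψ₂ ⊛ ψ₂ ′))
odd-form-identity = begin
  two ⊛ x ⊕ two ⊛ y ⊕ four ⊛ (mono 25 ⊛ (ψ₁₀ ⊛ ψ₁₀ ′)) ≈⟨ collect₅ x y (mono 25) ψ₁₀ (ψ₁₀ ′) ⟩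
  x ⊕ y ⊕ mono 25 ⊛ ((two ⊛ ψ₁₀ ′) ⊛ (two ⊛ ψ₁₀)) ⊕ y ⊕ x
    ≈⟨ five-terms (HasSum-unique odd-form-mod5 odd-form-mod4) (⊛-congˡ q (th-pair 6 4)) (⊛-congˡ (mono 9) (th-pair 8 2))
         (⊛-congˡ (mono 25) (⊛-cong (≈-trans (twice′ 30 10) (≈-trans (′-⊛ two ψ₁₀) (⊛-congʳ (ψ₁₀ ′) ′-two))) (twice ψ₁₀))) (⊛-congˡ (mono 9) (th-pair 8 2)) (⊛-congˡ q (th-pair 6 4)) ⟩
  _ ≈⟨ four-terms ≈-refl (⊛-congˡ q (⊛-cong (th′ 4 4) (twice (f⁺ 24 8)))) (⊛-congˡ (mono 5) (th-pair 6 2))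
         (⊛-congˡ (mono 19) (⊛-congʳ E (twice′ 24 8))) (⊛-congˡ (mono 5) (th-pair 6 2)) ⟨
  q ⊛ (E ′ ⊛ O) ⊕ z ⊕ mono 19 ⊛ (O ′ ⊛ E) ⊕ z ≈⟨ collect₄ (q ⊛ (E ′ ⊛ O)) z (mono 19 ⊛ (O ′ ⊛ E)) ⟩
  (q ⊛ (E ′ ⊛ O) ⊕ mono 19 ⊛ (O ′ ⊛ E)) ⊕ two ⊛ z ∎
  where
  x = q ⊛ (f⁺ 6 4 ⊛ f⁺ 6 4 ′)
  y = mono 9 ⊛ (f⁺ 8 2 ⊛ f⁺ 8 2 ′)
  z = mono 5 ⊛ (ψ₂ ⊛ ψ₂ ′)
  collect₅ : ∀ x y m p p′ → two ⊛ x ⊕ two ⊛ y ⊕ four ⊛ (m ⊛ (p ⊛ p′)) ≈ x ⊕ y ⊕ m ⊛ ((two ⊛ p′) ⊛ (two ⊛ p)) ⊕ y ⊕ x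
  collect₅ = solve 5 (λ x y m p p′ → con (+ 2) :* x :+ con (+ 2) :* y :+ con (+ 4) :* (m :* (p :* p′)) := x :+ y :+ m :* ((con (+ 2) :* p′) :* (con (+ 2) :* p)) :+ y :+ x) ≈-refl
  collect₄ : ∀ a z b → a ⊕ z ⊕ b ⊕ z ≈ (a ⊕ b) ⊕ two ⊛ z
  collect₄ = solve 3 (λ a z b → a :+ z :+ b :+ z := (a :+ b) :+ con (+ 2) :* z) ≈-refl

αα+ββ : two ⊛ (α ⊛ α ′ ⊕ β ⊛ β ′) ≈ φ ⊛ φ ′ ⊕ φ₅ ⊛ φ₅ ′
αα+ββ = ≈-trans (polarize α β) (⊕-cong (square-cong α+β) (square-cong α-β))

γγ+δδ : γ ⊛ γ ′ ⊕ δ ⊛ δ ′ ≈ two ⊛ (ψ₂ ⊛ ψ₂ ′ ⊕ mono 20 ⊛ (ψ₁₀ ⊛ ψ₁₀ ′))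
γγ+δδ = two-cancel (begin
  two ⊛ (γ ⊛ γ ′ ⊕ δ ⊛ δ ′) ≈⟨ ≈-trans (polarize γ δ) (⊕-cong (square-cong γ+δ) (square-cong γ-δ)) ⟩
  (two ⊛ ψ₂) ⊛ (two ⊛ ψ₂) ′ ⊕ (two ⊛ (q ⊛ ψ₁₀)) ⊛ (two ⊛ (q ⊛ ψ₁₀)) ′ ≈⟨ ⊕-cong
      (⊛-congˡ (two ⊛ ψ₂) (≈-trans (′-⊛ two ψ₂) (⊛-congʳ (ψ₂ ′) ′-two)))
      (⊛-congˡ (two ⊛ (q ⊛ ψ₁₀)) (≈-trans (′-⊛₃ two q ψ₁₀) (⊛-cong ′-two (⊛-congʳ (ψ₁₀ ′) (dil-mono 19 1))))) ⟩
  (two ⊛ ψ₂) ⊛ (two ⊛ ψ₂ ′) ⊕ (two ⊛ (q ⊛ ψ₁₀)) ⊛ (two ⊛ (mono 19 ⊛ ψ₁₀ ′)) ≈⟨ collect ψ₂ (ψ₂ ′) q (mono 19) ψ₁₀ (ψ₁₀ ′) ⟩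
  two ⊛ (two ⊛ (ψ₂ ⊛ ψ₂ ′ ⊕ (q ⊛ mono 19) ⊛ (ψ₁₀ ⊛ ψ₁₀ ′))) ≈⟨ ⊛-congˡ two (⊛-congˡ two (⊕-congˡ (ψ₂ ⊛ ψ₂ ′) (⊛-congʳ (ψ₁₀ ⊛ ψ₁₀ ′) (mono-⊛ 1 19)))) ⟩
  two ⊛ (two ⊛ (ψ₂ ⊛ ψ₂ ′ ⊕ mono 20 ⊛ (ψ₁₀ ⊛ ψ₁₀ ′))) ∎)
  where
  collect : ∀ p p′ q q′ r r′ → (two ⊛ p) ⊛ (two ⊛ p′) ⊕ (two ⊛ (q ⊛ r)) ⊛ (two ⊛ (q′ ⊛ r′)) ≈ two ⊛ (two ⊛ (p ⊛ p′ ⊕ (q ⊛ q′) ⊛ (r ⊛ r′)))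
  collect = solve 6 (λ p p′ q q′ r r′ → (con (+ 2) :* p) :* (con (+ 2) :* p′) :+ (con (+ 2) :* (q :* r)) :* (con (+ 2) :* (q′ :* r′)) := con (+ 2) :* (con (+ 2) :* (p :* p′ :+ (q :* q′) :* (r :* r′)))) ≈-refl

cancel-F : ∀ {f g} → F ⊛ f ≈ F ⊛ g → f ≈ g
cancel-F = ⊛-cancelˡ F (unit≢0 (cong₂ _*_ (poch-0 -1ℤ 2 2) (poch-0 -1ℤ 2 2)))

-- Elimination of V = φ(q⁵)φ(Q⁵) and of the lattice remainder R. The coefficient 3 is 2 from the
-- polarized αα + ββ and 1 from P + P⁻ = 2R.
combine₁ : ∀ A P P⁻ V x y z R → two ⊛ A ≈ P ⊕ V → V ⊕ two ⊛ x ⊕ two ⊛ y ≈ R ⊕ two ⊛ z → P ⊕ P⁻ ≈ two ⊛ R →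
  four ⊛ (A ⊕ y ⊕ x) ≈ const (+ 3) ⊛ P ⊕ P⁻ ⊕ four ⊛ z
combine₁ A P P⁻ V x y z R h₁ h₂ h₃ = begin
  four ⊛ (A ⊕ y ⊕ x) ≈⟨ solve 3 (λ A y x → con (+ 4) :* (A :+ y :+ x) := con (+ 2) :* (con (+ 2) :* A) :+ con (+ 4) :* y :+ con (+ 4) :* x) ≈-refl A y x ⟩
  two ⊛ (two ⊛ A) ⊕ four ⊛ y ⊕ four ⊛ x ≈⟨ ⊕-congʳ (four ⊛ x) (⊕-congʳ (four ⊛ y) (⊛-congˡ two h₁)) ⟩
  two ⊛ (P ⊕ V) ⊕ four ⊛ y ⊕ four ⊛ x ≈⟨ solve 4 (λ P V y x → con (+ 2) :* (P :+ V) :+ con (+ 4) :* y :+ con (+ 4) :* x := con (+ 2) :* P :+ con (+ 2) :* (V :+ con (+ 2) :* x :+ con (+ 2) :* y)) ≈-refl P V y x ⟩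
  two ⊛ P ⊕ two ⊛ (V ⊕ two ⊛ x ⊕ two ⊛ y) ≈⟨ ⊕-congˡ (two ⊛ P) (⊛-congˡ two h₂) ⟩
  two ⊛ P ⊕ two ⊛ (R ⊕ two ⊛ z) ≈⟨ solve 3 (λ P R z → con (+ 2) :* P :+ con (+ 2) :* (R :+ con (+ 2) :* z) := con (+ 2) :* P :+ con (+ 2) :* R :+ con (+ 4) :* z) ≈-refl P R z ⟩
  two ⊛ P ⊕ two ⊛ R ⊕ four ⊛ z ≈⟨ ⊕-congʳ (four ⊛ z) (⊕-congˡ (two ⊛ P) h₃) ⟨
  two ⊛ P ⊕ (P ⊕ P⁻) ⊕ four ⊛ z ≈⟨ solve 3 (λ P Q z → con (+ 2) :* P :+ (P :+ Q) :+ con (+ 4) :* z := con (+ 3) :* P :+ Q :+ con (+ 4) :* z) ≈-refl P P⁻ z ⟩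
  const (+ 3) ⊛ P ⊕ P⁻ ⊕ four ⊛ z ∎

-- The ψ(q¹⁰)ψ(Q¹⁰) term t is absorbed by the lattice identity. The coefficient 12 is 8 from the γ,
-- δ terms and 4 from the classes 1 and 3 modulo 4.
combine₂ : ∀ P P⁻ x y z t R → two ⊛ x ⊕ two ⊛ y ⊕ four ⊛ t ≈ R ⊕ two ⊛ z → P ⊖ P⁻ ≈ two ⊛ R →
  four ⊛ (x ⊕ y ⊕ two ⊛ (z ⊕ t)) ≈ P ⊖ P⁻ ⊕ const (+ 12) ⊛ z
combine₂ P P⁻ x y z t R h₁ h₂ = begin
  four ⊛ (x ⊕ y ⊕ two ⊛ (z ⊕ t)) ≈⟨ solve 4 (λ x y z t → con (+ 4) :* (x :+ y :+ con (+ 2) :* (z :+ t)) := con (+ 2) :* (con (+ 2) :* x :+ con (+ 2) :* y :+ con (+ 4) :* t) :+ con (+ 8) :* z) ≈-refl x y z t ⟩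
  two ⊛ (two ⊛ x ⊕ two ⊛ y ⊕ four ⊛ t) ⊕ const (+ 8) ⊛ z ≈⟨ ⊕-congʳ (const (+ 8) ⊛ z) (⊛-congˡ two h₁) ⟩
  two ⊛ (R ⊕ two ⊛ z) ⊕ const (+ 8) ⊛ z ≈⟨ solve 2 (λ R z → con (+ 2) :* (R :+ con (+ 2) :* z) :+ con (+ 8) :* z := con (+ 2) :* R :+ con (+ 12) :* z) ≈-refl R z ⟩
  two ⊛ R ⊕ const (+ 12) ⊛ z ≈⟨ ⊕-congʳ (const (+ 12) ⊛ z) h₂ ⟨
  P ⊖ P⁻ ⊕ const (+ 12) ⊛ z ∎

F-shift-inv : F ⊛ shift 5 (inv κκ2) ≈ mono 5 ⊛ (ψ₂ ⊛ ψ₂ ′)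
F-shift-inv = ≈-trans (⊛-congˡ F (shift≈⊛ 5 (inv κκ2))) (≈-trans (solve∙ 3 (λ F m i → F ∙ (m ∙ i) ⊜ m ∙ (F ∙ i)) ≈-refl F (mono 5) (inv κκ2)) (⊛-congˡ (mono 5) Fκκ2))

⊛-· : ∀ f c g → f ⊛ (c · g) ≈ const c ⊛ (f ⊛ g)
⊛-· f c g = ≈-trans (CL.scale (clinear-⊛ˡ f) c g) (·≈const c (f ⊛ g))

first-identity : (+ 4) · (U1-19 ⊛ dil 4 U1-19) ≈ (+ 3) · κκ ⊕ κκ⁻ ⊕ (+ 4) · shift 5 (inv κκ2)
first-identity = cancel-F (begin
  F ⊛ ((+ 4) · X) ≈⟨ ⊛-· F (+ 4) X ⟩
  four ⊛ (F ⊛ X) ≈⟨ ⊛-congˡ four FUU₄ ⟩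
  four ⊛ ((α ⊛ α ′ ⊕ β ⊛ β ′) ⊕ mono 16 ⊛ (θ ⊛ θ ′) ⊕ mono 4 ⊛ (η ⊛ η ′))
    ≈⟨ combine₁ (α ⊛ α ′ ⊕ β ⊛ β ′) (φ ⊛ φ ′) (alt φ ⊛ (alt φ) ′) (φ₅ ⊛ φ₅ ′) (mono 4 ⊛ (η ⊛ η ′)) (mono 16 ⊛ (θ ⊛ θ ′))
         (mono 5 ⊛ (ψ₂ ⊛ ψ₂ ′)) (E ⊛ E ′ ⊕ mono 20 ⊛ (O ⊛ O ′)) αα+ββ form-4-2-5-identity φφ-sum ⟩
  const (+ 3) ⊛ (φ ⊛ φ ′) ⊕ alt φ ⊛ (alt φ) ′ ⊕ four ⊛ (mono 5 ⊛ (ψ₂ ⊛ ψ₂ ′))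
    ≈⟨ ⊕-cong (⊕-cong (≈-trans (⊛-· F (+ 3) κκ) (⊛-congˡ (const (+ 3)) Fκκ)) Fκκ⁻) (≈-trans (⊛-· F (+ 4) (shift 5 (inv κκ2))) (⊛-congˡ four F-shift-inv)) ⟨
  F ⊛ ((+ 3) · κκ) ⊕ F ⊛ κκ⁻ ⊕ F ⊛ ((+ 4) · shift 5 (inv κκ2)) ≈⟨ distrib F ((+ 3) · κκ) κκ⁻ ((+ 4) · shift 5 (inv κκ2)) ⟨
  F ⊛ ((+ 3) · κκ ⊕ κκ⁻ ⊕ (+ 4) · shift 5 (inv κκ2)) ∎)
  where
  X = U1-19 ⊛ dil 4 U1-19
  distrib : ∀ F a b c → F ⊛ (a ⊕ b ⊕ c) ≈ F ⊛ a ⊕ F ⊛ b ⊕ F ⊛ c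
  distrib = solve 4 (λ F a b c → F :* (a :+ b :+ c) := F :* a :+ F :* b :+ F :* c) ≈-refl

second-identity : (+ 4) · shift 1 (U1-19 ⊛ alt U1-19) ≈ κκ ⊖ κκ⁻ ⊕ (+ 12) · shift 5 (inv κκ2)
second-identity = cancel-F (begin
  F ⊛ ((+ 4) · shift 1 X) ≈⟨ ⊛-· F (+ 4) (shift 1 X) ⟩
  four ⊛ (F ⊛ shift 1 X) ≈⟨ ⊛-congˡ four (≈-trans (⊛-congˡ F (shift≈⊛ 1 X)) (solve∙ 3 (λ F m i → F ∙ (m ∙ i) ⊜ m ∙ (F ∙ i)) ≈-refl F q X)) ⟩
  four ⊛ (q ⊛ (F ⊛ X)) ≈⟨ ⊛-congˡ four (⊛-congˡ q (≈-trans FUU⁻ (⊕-congˡ (a ⊕ mono 8 ⊛ b) (⊛-congˡ (mono 4) γγ+δδ)))) ⟩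
  four ⊛ (q ⊛ (a ⊕ mono 8 ⊛ b ⊕ mono 4 ⊛ (two ⊛ (s ⊕ mono 20 ⊛ t)))) ≈⟨ ⊛-congˡ four (≈-trans (distribute q a (mono 8) b (mono 4) s (mono 20) t)
      (⊕-cong (⊕-congˡ (q ⊛ a) (⊛-congʳ b (mono-⊛ 1 8))) (⊛-congˡ two (⊕-cong (⊛-congʳ s (mono-⊛ 1 4))
        (⊛-congʳ t (≈-trans (⊛-congʳ (mono 20) (mono-⊛ 1 4)) (mono-⊛ 5 20))))))) ⟩
  four ⊛ (q ⊛ a ⊕ mono 9 ⊛ b ⊕ two ⊛ (mono 5 ⊛ s ⊕ mono 25 ⊛ t))
    ≈⟨ combine₂ (φ ⊛ φ ′) (alt φ ⊛ (alt φ) ′) (q ⊛ a) (mono 9 ⊛ b) (mono 5 ⊛ s) (mono 25 ⊛ t)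
         (q ⊛ (E ′ ⊛ O) ⊕ mono 19 ⊛ (O ′ ⊛ E)) odd-form-identity φφ-difference ⟩
  φ ⊛ φ ′ ⊖ alt φ ⊛ (alt φ) ′ ⊕ const (+ 12) ⊛ (mono 5 ⊛ s)
    ≈⟨ ⊕-cong (⊕-cong Fκκ (⊝-cong Fκκ⁻)) (≈-trans (⊛-· F (+ 12) (shift 5 (inv κκ2))) (⊛-congˡ (const (+ 12)) F-shift-inv)) ⟨
  F ⊛ κκ ⊖ F ⊛ κκ⁻ ⊕ F ⊛ ((+ 12) · shift 5 (inv κκ2)) ≈⟨ distrib F κκ κκ⁻ ((+ 12) · shift 5 (inv κκ2)) ⟨
  F ⊛ (κκ ⊖ κκ⁻ ⊕ (+ 12) · shift 5 (inv κκ2)) ∎)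
  where
  X = U1-19 ⊛ alt U1-19
  a = f⁺ 6 4 ⊛ f⁺ 6 4 ′
  b = f⁺ 8 2 ⊛ f⁺ 8 2 ′
  s = ψ₂ ⊛ ψ₂ ′
  t = ψ₁₀ ⊛ ψ₁₀ ′
  distrib : ∀ F a b c → F ⊛ (a ⊖ b ⊕ c) ≈ F ⊛ a ⊖ F ⊛ b ⊕ F ⊛ c
  distrib = solve 4 (λ F a b c → F :* (a :- b :+ c) := F :* a :- F :* b :+ F :* c) ≈-refl
  distribute : ∀ q a m b n s u t → q ⊛ (a ⊕ m ⊛ b ⊕ n ⊛ (two ⊛ (s ⊕ u ⊛ t))) ≈ q ⊛ a ⊕ (q ⊛ m) ⊛ b ⊕ two ⊛ ((q ⊛ n) ⊛ s ⊕ ((q ⊛ n) ⊛ u) ⊛ t)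
  distribute = solve 8 (λ q a m b n s u t → q :* (a :+ m :* b :+ n :* (con (+ 2) :* (s :+ u :* t))) := q :* a :+ (q :* m) :* b :+ con (+ 2) :* ((q :* n) :* s :+ ((q :* n) :* u) :* t)) ≈-refl

theorem4p9 : ((+ 4) · (U1-19 ⊛ dil 4 U1-19)
    ≐ (+ 3) · κκ ⊕ κκ⁻ ⊕ (+ 4) · shift 5 (inv κκ2))
    ×
    ((+ 4) · shift 1 (U1-19 ⊛ alt U1-19)
    ≐ κκ ⊖ κκ⁻ ⊕ (+ 12) · shift 5 (inv κκ2))
theorem4p9 = at first-identity , at second-identity
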